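{- Given a graph $G$ with at least two cycles, $n$ nodes, and $m$ edges, suppose $H$ is its $r$-subdivision. Let $\lambda$ be an $r$th root of unity. Then $\lambda$ is an eigenvalue of the NB matrix of $H$ and $\operatorname{am}_H(\lambda)=\operatorname{gm}_H(\lambda)=m-n+1$. Further, let $\mu$ be an $r$th root of $-1$. Then $\mu$ is an eigenvalue of the NB matrix of $H$ and $\operatorname{am}_H(\mu)=\operatorname{gm}_H(\mu)=m-n+\mathbf{1}\{G\text{ is bipartite}\}$.
   Context: Graphs are finite, undirected, unweighted, connected, possibly with self-loops or multi-edges, and (for nonzero spectrum purposes) with no nodes of degree 1. The non-backtracking (NB) matrix $\mathbf{B}$ is indexed by oriented edges with $\mathbf{B}_{k\to l,i\to j}=\mathbf{1}\{j=k\}(1-\mathbf{1}\{i=l\})$. $\operatorname{am}_H(\lambda)$ and $\operatorname{gm}_H(\lambda)$ denote the algebraic multiplicity (multiplicity as a root of the characteristic polynomial) and geometric multiplicity (dimension of the nullspace of $\mathbf{B}-\lambda\mathbf{I}$) of $\lambda$ as an eigenvalue of the NB matrix of $H$. The $r$-subdivision of $G$ is the graph obtained by inserting $r-1$ new nodes (of degree 2) into each edge of $G$, i.e. replacing each edge by a chain of $r$ edges. -}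

module Defs where

open import Level using (Level; _⊔_)
open import Data.Nat using (ℕ; zero; suc; _<?_; _≤_)
import Data.Nat as N
open import Data.Fin using (Fin; zero; suc; toℕ; fromℕ<; _↑ˡ_; _↑ʳ_; splitAt; remQuot; combine; inject₁; punchIn; _≟_)
open import Data.Bool using (Bool; true; false; if_then_else_; _∧_; not)
open import Data.Product using (Σ; ∃; _×_; _,_; proj₁; proj₂)
open import Data.Sum using (_⊎_; inj₁; inj₂)
open import Data.List using (List; []; _∷_; map)
open import Relation.Nullary using (¬_; Dec; yes; no; does)
open import Relation.Binary.PropositionalEquality using (_≡_; _≢_)
open import Algebra.Bundles using (CommutativeRing)

sumℕ : (n : ℕ) → (Fin n → ℕ) → ℕ
sumℕ zero    f = 0
sumℕ (suc n) f = f zero N.+ sumℕ n (λ i → f (suc i))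

ind : Bool → ℕ
ind true  = 1
ind false = 0

-- Finite multigraphs (self-loops and multi-edges allowed).
-- Nodes Fin nV, edges Fin nE, edge e joins the two nodes in  ends e.

record Graph : Set where
  field
    nV   : ℕ
    nE   : ℕ
    ends : Fin nE → Fin nV × Fin nV
open Graph public

Joins : (G : Graph) → Fin (nE G) → Fin (nV G) → Fin (nV G) → Set
Joins G e v w = ends G e ≡ (v , w) ⊎ ends G e ≡ (w , v)

-- degree of v in the spanning subgraph with edge set S (a self-loop counts 2)
degIn : (G : Graph) → (Fin (nE G) → Bool) → Fin (nV G) → ℕ
degIn G S v = sumℕ (nE G) (λ e → if S e
  then ind (does (proj₁ (ends G e) ≟ v)) N.+ ind (does (proj₂ (ends G e) ≟ v))
  else 0)

degree : (G : Graph) → Fin (nV G) → ℕ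
degree G = degIn G (λ _ → true)

data Reach (G : Graph) (S : Fin (nE G) → Bool) (u : Fin (nV G)) : Fin (nV G) → Set where
  here : Reach G S u u
  step : ∀ {v w} (e : Fin (nE G)) → S e ≡ true → Joins G e v w → Reach G S u v → Reach G S u w

Connected : Graph → Set
Connected G = ∀ u v → Reach G (λ _ → true) u v

NoLeaf : Graph → Set
NoLeaf G = ∀ v → degree G v ≢ 1

IsCycle : (G : Graph) → (Fin (nE G) → Bool) → Set
IsCycle G S =
  (∃ λ e → S e ≡ true) ×
  (∀ v → degIn G S v ≡ 0 ⊎ degIn G S v ≡ 2) ×
  (∀ e e′ → S e ≡ true → S e′ ≡ true → Reach G S (proj₁ (ends G e)) (proj₁ (ends G e′)))

AtLeastTwoCycles : Graph → Set
AtLeastTwoCycles G = Σ (Fin (nE G) → Bool) λ S → Σ (Fin (nE G) → Bool) λ S′ →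
  IsCycle G S × IsCycle G S′ × (∃ λ e → S e ≢ S′ e)

Bipartite : Graph → Set
Bipartite G = Σ (Fin (nV G) → Bool) λ col → ∀ e → col (proj₁ (ends G e)) ≢ col (proj₂ (ends G e))

-- The r-subdivision, for r = suc r′ ≥ 1.
-- New nodes: nV N.+ (edge e , i) for i : Fin r′ ; edge (e , j), j : Fin r,
-- joins the j-th and (j+1)-th node of the chain replacing e.

module _ (G : Graph) (r′ : ℕ) where
  private
    N = nV G
    M = nE G

  chainAux : (e : Fin M) → (k : Fin (suc r′)) → Dec (toℕ k Data.Nat.< r′) → Fin (N N.+ M N.* r′)
  chainAux e k (yes p) = N ↑ʳ combine e (fromℕ< p)
  chainAux e k (no _)  = proj₂ (ends G e) ↑ˡ (M N.* r′)

  -- the (r+1) nodes of the chain replacing edge e (position 0 = first end, position r = second end)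
  chainNode : Fin M → Fin (suc (suc r′)) → Fin (N N.+ M N.* r′)
  chainNode e zero    = proj₁ (ends G e) ↑ˡ (M N.* r′)
  chainNode e (suc k) = chainAux e k (toℕ k <? r′)

  subdEnds : Fin (M N.* suc r′) → Fin (N N.+ M N.* r′) × Fin (N N.+ M N.* r′)
  subdEnds x with remQuot (suc r′) x
  ... | (e , j) = chainNode e (inject₁ j) , chainNode e (suc j)

subdivision : Graph → (r′ : ℕ) → Graph
subdivision G r′ = record { nV = nV G N.+ nE G N.* r′ ; nE = nE G N.* suc r′ ; ends = subdEnds G r′ }

-- Oriented edges (darts): Fin (nE N.+ nE); left copy = e oriented proj₁→proj₂,
-- right copy = e oriented proj₂→proj₁.

Dart : Graph → Set
Dart G = Fin (nE G N.+ nE G)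

dTail : (G : Graph) → Dart G → Fin (nV G)
dTail G d with splitAt (nE G) d
... | inj₁ e = proj₁ (ends G e)
... | inj₂ e = proj₂ (ends G e)

dHead : (G : Graph) → Dart G → Fin (nV G)
dHead G d with splitAt (nE G) d
... | inj₁ e = proj₂ (ends G e)
... | inj₂ e = proj₁ (ends G e)

dRev : (G : Graph) → Dart G → Dart G
dRev G d with splitAt (nE G) d
... | inj₁ e = nE G ↑ʳ e
... | inj₂ e = e ↑ˡ nE G

module LinAlg {c ℓ : Level} (R : CommutativeRing c ℓ) where
  open CommutativeRing R hiding (zero)

  NB : (G : Graph) → Dart G → Dart G → Carrier
  NB G k i = if does (dHead G i ≟ dTail G k) ∧ not (does (k ≟ dRev G i)) then 1# else 0#

  natR : ℕ → Carrier
  natR zero    = 0#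
  natR (suc k) = 1# + natR k

  pow : Carrier → ℕ → Carrier
  pow x zero    = 1#
  pow x (suc k) = x * pow x k

  IsField : Set (c ⊔ ℓ)
  IsField = (¬ (1# ≈ 0#)) × (∀ x → ¬ (x ≈ 0#) → ∃ λ y → x * y ≈ 1#)

  CharZero : Set ℓ
  CharZero = ∀ k → ¬ (natR (suc k) ≈ 0#)

  -- polynomials: coefficient lists, lowest degree first
  Poly : Set c
  Poly = List Carrier

  coeff : Poly → ℕ → Carrier
  coeff []       _       = 0#
  coeff (a ∷ p)  zero    = a
  coeff (a ∷ p)  (suc i) = coeff p i

  _≈P_ : Poly → Poly → Set ℓ
  p ≈P q = ∀ i → coeff p i ≈ coeff q i

  _+P_ : Poly → Poly → Poly
  []       +P q        = q
  (a ∷ p)  +P []       = a ∷ p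
  (a ∷ p)  +P (b ∷ q)  = (a + b) ∷ (p +P q)

  _*P_ : Poly → Poly → Poly
  []      *P q = []
  (a ∷ p) *P q = map (a *_) q +P (0# ∷ (p *P q))

  negP : Poly → Poly
  negP = map (-_)

  powP : Poly → ℕ → Poly
  powP p zero    = 1# ∷ []
  powP p (suc k) = p *P powP p k

  eval : Poly → Carrier → Carrier
  eval []      x = 0#
  eval (a ∷ p) x = a + x * eval p x

  _∣P_ : Poly → Poly → Set (c ⊔ ℓ)
  d ∣P p = ∃ λ q → p ≈P (d *P q)

  AlgClosed : Set (c ⊔ ℓ)
  AlgClosed = ∀ (p : Poly) → (∃ λ i → ¬ (coeff p (suc i) ≈ 0#)) → ∃ λ x → eval p x ≈ 0#

  sumP : (n : ℕ) → (Fin n → Poly) → Poly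
  sumP zero    f = []
  sumP (suc n) f = f zero +P sumP n (λ i → f (suc i))

  signP : ℕ → Poly → Poly
  signP zero    p = p
  signP (suc k) p = negP (signP k p)

  detP : (n : ℕ) → (Fin n → Fin n → Poly) → Poly
  detP zero    A = 1# ∷ []
  detP (suc n) A = sumP (suc n) (λ j →
    signP (toℕ j) (A zero j *P detP n (λ a b → A (suc a) (punchIn j b))))

  charPoly : (n : ℕ) → (Fin n → Fin n → Carrier) → Poly
  charPoly n A = detP n (λ i j → if does (i ≟ j) then (- A i j) ∷ 1# ∷ [] else (- A i j) ∷ [])

  linFactor : Carrier → Poly
  linFactor λ₀ = (- λ₀) ∷ 1# ∷ []

  AlgMult : (n : ℕ) → (Fin n → Fin n → Carrier) → Carrier → ℕ → Set (c ⊔ ℓ)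
  AlgMult n A λ₀ k = (powP (linFactor λ₀) k ∣P charPoly n A) × ¬ (powP (linFactor λ₀) (suc k) ∣P charPoly n A)

  sumR : (n : ℕ) → (Fin n → Carrier) → Carrier
  sumR zero    f = 0#
  sumR (suc n) f = f zero + sumR n (λ i → f (suc i))

  InNull : (n : ℕ) → (Fin n → Fin n → Carrier) → Carrier → (Fin n → Carrier) → Set ℓ
  InNull n A λ₀ v = ∀ i → sumR n (λ j → A i j * v j) ≈ λ₀ * v i

  LinIndep : (n k : ℕ) → (Fin k → Fin n → Carrier) → Set (c ⊔ ℓ)
  LinIndep n k vs = ∀ (cs : Fin k → Carrier) →
    (∀ i → sumR k (λ t → cs t * vs t i) ≈ 0#) → ∀ t → cs t ≈ 0#

  GeoMult : (n : ℕ) → (Fin n → Fin n → Carrier) → Carrier → ℕ → Set (c ⊔ ℓ)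
  GeoMult n A λ₀ d =
    (Σ (Fin d → Fin n → Carrier) λ vs → (∀ t → InNull n A λ₀ (vs t)) × LinIndep n d vs) ×
    (∀ k (vs : Fin k → Fin n → Carrier) → (∀ t → InNull n A λ₀ (vs t)) → LinIndep n k vs → k ≤ d)

  IsEigenvalue : (n : ℕ) → (Fin n → Fin n → Carrier) → Carrier → Set (c ⊔ ℓ)
  IsEigenvalue n A λ₀ = Σ (Fin n → Carrier) λ v → InNull n A λ₀ v × (∃ λ i → ¬ (v i ≈ 0#))

  nD : Graph → ℕ
  nD H = nE H N.+ nE H

  amNB : Graph → Carrier → ℕ → Set (c ⊔ ℓ)
  amNB H λ₀ k = AlgMult (nD H) (NB H) λ₀ k

  gmNB : Graph → Carrier → ℕ → Set (c ⊔ ℓ)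
  gmNB H λ₀ k = GeoMult (nD H) (NB H) λ₀ k

  eigNB : Graph → Carrier → Set (c ⊔ ℓ)
  eigNB H λ₀ = IsEigenvalue (nD H) (NB H) λ₀

{-# OPTIONS --safe #-}
module Submission where

-- Put s = λʳ = ± 1.  Along the chain replacing an edge of G an eigenvector of the NB matrix B of H for λ is a
-- geometric progression, and the conditions at the nodes of G say that it comes from an element of the
-- kernel of the signed incidence matrix D with entries [src e = x] − s [tgt e = x].  By rank–nullity this kernel has
-- dimension m − n + l, where l is the dimension of the solutions of w (src e) = s w (tgt e), that is 1 for s = 1 or G
-- bipartite and 0 otherwise.
--
-- A generalized eigenvector u with (B − λ) u = z, z coming from a in the kernel of D, yields a potential S on the nodes
-- of G with S (src e) − s S (tgt e) = 2r a e, so S is harmonic; the star-mesh transform shows a = 0, as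
-- the characteristic is 0.  Hence λ is semisimple, which turns the explicit eigenvectors into the exact power of
-- x − λ in the characteristic polynomial.  The inequality n < m, used to see that S = 0, holds because two distinct
-- cycles are independent elements of the kernel of D over GF(2).

open import Defs
open import Level using (Level; _⊔_; 0ℓ) renaming (suc to lsuc)
open import Data.Nat using (ℕ; zero; suc; _∸_)
import Data.Nat as ℕ
import Data.Nat.Properties as ℕₚ
open import Data.Integer using (ℤ)
import Data.Integer as ℤ
import Data.Integer.Properties as ℤₚ
open import Data.Bool using (Bool; true; false; _∧_; not; _xor_; if_then_else_)
import Data.Bool.Properties as Boolₚ
open import Data.Fin using (Fin; zero; suc; punchIn; punchOut; _↑ˡ_; _↑ʳ_; splitAt; toℕ; fromℕ; fromℕ<; inject₁; combine; remQuot)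
import Data.Fin as Fin
import Data.Fin.Properties as Finₚ
open import Data.Fin.Induction using (<-weakInduction)
open import Data.Fin.Relation.Unary.Top using (view; ‵fromℕ; ‵inject₁)
open import Data.List using ([]; _∷_; map; length)
open import Data.Maybe using (Maybe; just; nothing)
open import Data.Product using (Σ; ∃; ∃₂; _×_; _,_; proj₁; proj₂)
open import Data.Sum using (_⊎_; inj₁; inj₂; [_,_]′)
open import Data.Unit using (⊤; tt)
open import Data.Vec.Functional using (updateAt; insertAt)
open import Data.Vec.Functional.Properties using (updateAt-updates; updateAt-minimal; insertAt-lookup; insertAt-punchIn)
open import Function using (_∘_; id; const)
open import Relation.Nullary using (¬_; Dec; yes; no; does)
open import Relation.Nullary.Decidable using (¬¬-excluded-middle)
open import Relation.Nullary.Negation using (contradiction)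
open import Relation.Binary.PropositionalEquality as ≡ using (_≡_; _≢_)
import Relation.Binary.Reasoning.Setoid
open import Algebra.Bundles using (CommutativeRing)
open import Algebra.Solver.Ring.AlmostCommutativeRing using (_-Raw-AlmostCommutative⟶_; fromCommutativeRing)
import Algebra.Solver.Ring
import Algebra.Properties.Ring
import Algebra.Properties.AbelianGroup
import Algebra.Properties.Semiring.Sum

-- Equality in `F` is not assumed decidable, and this shapes the proof. Ranks are computed only for
-- D, whose entries lie in the prime field. Uniqueness of eigenvectors, where `λ₀` enters, is
-- reached up to double negation; this is enough, because the upper bounds on the two multiplicities
-- are a refutation and a decidable comparison of numbers. All bases are kept in reduced echelon
-- form, so that coordinates are read off instead of solved for.
--
-- The number 2r counts the darts of a chain: the equation at each of them contributes one copy of a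
-- e. Applying D to the gradient of S gives D Dᵀ S = 2r D a = 0. Over the reals, pairing with S
-- would now finish, but in F a sum of squares can vanish without its terms doing so; natural
-- conductances take the place of positivity. After a = 0 it remains to see that S = 0: the sum of
-- the squares S² over the nodes equals that of S (src e)² over the edges, and all these squares
-- agree, so (m - n) S² = 0.

-- A ring solver with integer coefficients.

module IntegerSolver {c ℓ : Level} (R : CommutativeRing c ℓ) where
  open import Data.Integer using (+_; -[1+_]; _⊖_)
  open CommutativeRing R
  open Algebra.Properties.Ring ring using (-‿distribˡ-*; -‿distribʳ-*; -0#≈0#; -‿involutive)
  open Algebra.Properties.AbelianGroup +-abelianGroup using (⁻¹-∙-comm)
  open Relation.Binary.Reasoning.Setoid setoid

  -- The clause for 1 makes the literal  con (+ 1)  evaluate to 1# itself.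
  fromℕ# : ℕ → Carrier
  fromℕ# zero          = 0#
  fromℕ# (suc zero)    = 1#
  fromℕ# (suc (suc n)) = 1# + fromℕ# (suc n)

  fromℤ# : ℤ → Carrier
  fromℤ# (+ n)      = fromℕ# n
  fromℤ# (-[1+ n ]) = - fromℕ# (suc n)

  fromℕ#-suc : ∀ n → fromℕ# (suc n) ≈ 1# + fromℕ# n
  fromℕ#-suc zero    = sym (+-identityʳ 1#)
  fromℕ#-suc (suc n) = refl

  fromℕ#-+ : ∀ m n → fromℕ# (m ℕ.+ n) ≈ fromℕ# m + fromℕ# n
  fromℕ#-+ zero    n = sym (+-identityˡ _)
  fromℕ#-+ (suc m) n = begin
    fromℕ# (suc (m ℕ.+ n)) ≈⟨ fromℕ#-suc (m ℕ.+ n) ⟩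
    1# + fromℕ# (m ℕ.+ n) ≈⟨ +-congˡ (fromℕ#-+ m n) ⟩
    1# + (fromℕ# m + fromℕ# n) ≈⟨ +-assoc _ _ _ ⟨
    1# + fromℕ# m + fromℕ# n ≈⟨ +-congʳ (fromℕ#-suc m) ⟨
    fromℕ# (suc m) + fromℕ# n ∎

  fromℕ#-* : ∀ m n → fromℕ# (m ℕ.* n) ≈ fromℕ# m * fromℕ# n
  fromℕ#-* zero    n = sym (zeroˡ _)
  fromℕ#-* (suc m) n = begin
    fromℕ# (n ℕ.+ m ℕ.* n) ≈⟨ fromℕ#-+ n (m ℕ.* n) ⟩
    fromℕ# n + fromℕ# (m ℕ.* n) ≈⟨ +-cong (sym (*-identityˡ _)) (fromℕ#-* m n) ⟩
    1# * fromℕ# n + fromℕ# m * fromℕ# n ≈⟨ distribʳ _ _ _ ⟨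
    (1# + fromℕ# m) * fromℕ# n ≈⟨ *-congʳ (fromℕ#-suc m) ⟨
    fromℕ# (suc m) * fromℕ# n ∎

  fromℤ#-⊖ : ∀ m n → fromℤ# (m ⊖ n) ≈ fromℕ# m - fromℕ# n
  fromℤ#-⊖ m zero = begin
    fromℕ# m ≈⟨ +-identityʳ _ ⟨
    fromℕ# m + 0# ≈⟨ +-congˡ -0#≈0# ⟨
    fromℕ# m - 0# ∎
  fromℤ#-⊖ zero    (suc n) = sym (+-identityˡ _)
  fromℤ#-⊖ (suc m) (suc n) = begin
    fromℤ# (suc m ⊖ suc n) ≡⟨ ≡.cong fromℤ# (ℤₚ.[1+m]⊖[1+n]≡m⊖n m n) ⟩
    fromℤ# (m ⊖ n) ≈⟨ fromℤ#-⊖ m n ⟩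
    fromℕ# m - fromℕ# n ≈⟨ +-congʳ (+-identityʳ _) ⟨
    fromℕ# m + 0# - fromℕ# n ≈⟨ +-congʳ (+-congˡ (-‿inverseʳ 1#)) ⟨
    fromℕ# m + (1# - 1#) - fromℕ# n ≈⟨ +-congʳ (+-assoc _ _ _) ⟨
    fromℕ# m + 1# - 1# - fromℕ# n ≈⟨ +-assoc _ _ _ ⟩
    fromℕ# m + 1# + (- 1# - fromℕ# n) ≈⟨ +-cong (+-comm _ _) (⁻¹-∙-comm _ _) ⟩
    1# + fromℕ# m - (1# + fromℕ# n) ≈⟨ +-cong (fromℕ#-suc m) (-‿cong (fromℕ#-suc n)) ⟨
    fromℕ# (suc m) - fromℕ# (suc n) ∎

  fromℤ#-neg : ∀ i → fromℤ# (ℤ.- i) ≈ - fromℤ# i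
  fromℤ#-neg (+ zero)  = sym -0#≈0#
  fromℤ#-neg (+ suc n) = refl
  fromℤ#-neg -[1+ n ]  = sym (-‿involutive _)

  fromℤ#-+ : ∀ i j → fromℤ# (i ℤ.+ j) ≈ fromℤ# i + fromℤ# j
  fromℤ#-+ (+ m)      (+ n)      = fromℕ#-+ m n
  fromℤ#-+ (+ m)      (-[1+ n ]) = fromℤ#-⊖ m (suc n)
  fromℤ#-+ (-[1+ m ]) (+ n)      = trans (fromℤ#-⊖ n (suc m)) (+-comm _ _)
  fromℤ#-+ (-[1+ m ]) (-[1+ n ]) = begin
    - fromℕ# (suc (suc (m ℕ.+ n))) ≡⟨ ≡.cong (λ k → - fromℕ# (suc k)) (ℕₚ.+-suc m n) ⟨
    - fromℕ# (suc m ℕ.+ suc n) ≈⟨ -‿cong (fromℕ#-+ (suc m) (suc n)) ⟩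
    - (fromℕ# (suc m) + fromℕ# (suc n)) ≈⟨ ⁻¹-∙-comm _ _ ⟨
    - fromℕ# (suc m) - fromℕ# (suc n) ∎

  fromℤ#-*⁺ : ∀ m j → fromℤ# (+ m ℤ.* j) ≈ fromℕ# m * fromℤ# j
  fromℤ#-*⁺ m (+ n) = begin
    fromℤ# (+ m ℤ.* + n) ≡⟨ ≡.cong fromℤ# (ℤₚ.pos-* m n) ⟨
    fromℕ# (m ℕ.* n) ≈⟨ fromℕ#-* m n ⟩
    fromℕ# m * fromℕ# n ∎
  fromℤ#-*⁺ m (-[1+ n ]) = begin
    fromℤ# (+ m ℤ.* ℤ.- (+ suc n)) ≡⟨ ≡.cong fromℤ# (ℤₚ.neg-distribʳ-* (+ m) (+ suc n)) ⟨
    fromℤ# (ℤ.- (+ m ℤ.* + suc n)) ≈⟨ fromℤ#-neg (+ m ℤ.* + suc n) ⟩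
    - fromℤ# (+ m ℤ.* + suc n) ≈⟨ -‿cong (fromℤ#-*⁺ m (+ suc n)) ⟩
    - (fromℕ# m * fromℕ# (suc n)) ≈⟨ -‿distribʳ-* _ _ ⟩
    fromℕ# m * - fromℕ# (suc n) ∎

  fromℤ#-* : ∀ i j → fromℤ# (i ℤ.* j) ≈ fromℤ# i * fromℤ# j
  fromℤ#-* (+ m)      j = fromℤ#-*⁺ m j
  fromℤ#-* (-[1+ m ]) j = begin
    fromℤ# (ℤ.- (+ suc m) ℤ.* j) ≡⟨ ≡.cong fromℤ# (ℤₚ.neg-distribˡ-* (+ suc m) j) ⟨
    fromℤ# (ℤ.- (+ suc m ℤ.* j)) ≈⟨ fromℤ#-neg (+ suc m ℤ.* j) ⟩
    - fromℤ# (+ suc m ℤ.* j) ≈⟨ -‿cong (fromℤ#-*⁺ (suc m) j) ⟩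
    - (fromℕ# (suc m) * fromℤ# j) ≈⟨ -‿distribˡ-* _ _ ⟩
    - fromℕ# (suc m) * fromℤ# j ∎

  homomorphism : ℤ.+-*-rawRing -Raw-AlmostCommutative⟶ fromCommutativeRing R
  homomorphism = record
    { ⟦_⟧ = fromℤ# ; +-homo = fromℤ#-+ ; *-homo = fromℤ#-* ; -‿homo = fromℤ#-neg
    ; 0-homo = refl ; 1-homo = refl }

  -- The coefficients are integers because the solver has to recognise equal ones, and equality in
  -- `R` need not be decidable.
  coefficient≟ : ∀ i j → Maybe (fromℤ# i ≈ fromℤ# j)
  coefficient≟ i j with i ℤ.≟ j
  ... | yes i≡j = just (reflexive (≡.cong fromℤ# i≡j))
  ... | no _    = nothing

  open Algebra.Solver.Ring ℤ.+-*-rawRing (fromCommutativeRing R) homomorphism coefficient≟ public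
    using (Polynomial; solve; _:=_; con; _:+_; _:*_; _:-_; :-_)

  :0 :1 :-1 : ∀ {n} → Polynomial n
  :0  = con (+ 0)
  :1  = con (+ 1)
  :-1 = con -[1+ 0 ]

-- Finite sums, Iverson brackets and the Kronecker delta.

module Sums {c ℓ : Level} (R : CommutativeRing c ℓ) where
  open CommutativeRing R renaming (zero to *-zero) public
  open LinAlg R public
  open IntegerSolver R using (solve; _:=_; _:+_; _:*_; _:-_; :-_; :0; :1; :-1) public
  open Relation.Binary.Reasoning.Setoid setoid public
  private module Sum = Algebra.Properties.Semiring.Sum semiring

  sumR≡sum : ∀ {n} (f : Fin n → Carrier) → sumR n f ≡ Sum.sum f
  sumR≡sum {zero}  f = ≡.refl
  sumR≡sum {suc n} f = ≡.cong (f zero +_) (sumR≡sum (f ∘ suc))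

  sum-cong : ∀ {n} {f g : Fin n → Carrier} → (∀ i → f i ≈ g i) → sumR n f ≈ sumR n g
  sum-cong {zero}  f≈g = refl
  sum-cong {suc n} f≈g = +-cong (f≈g zero) (sum-cong (f≈g ∘ suc))

  sum-0 : ∀ {n} {f : Fin n → Carrier} → (∀ i → f i ≈ 0#) → sumR n f ≈ 0#
  sum-0 {zero}  f≈0 = refl
  sum-0 {suc n} f≈0 = trans (+-cong (f≈0 zero) (sum-0 (f≈0 ∘ suc))) (+-identityˡ 0#)

  sum-+ : ∀ {n} (f g : Fin n → Carrier) → sumR n (λ i → f i + g i) ≈ sumR n f + sumR n g
  sum-+ f g rewrite sumR≡sum f | sumR≡sum g | sumR≡sum (λ i → f i + g i) = Sum.∑-distrib-+ f g

  sum-*ˡ : ∀ {n} x (f : Fin n → Carrier) → sumR n (λ i → x * f i) ≈ x * sumR n f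
  sum-*ˡ x f rewrite sumR≡sum f | sumR≡sum (λ i → x * f i) = sym (Sum.*-distribˡ-sum x f)

  sum-*ʳ : ∀ {n} x (f : Fin n → Carrier) → sumR n (λ i → f i * x) ≈ sumR n f * x
  sum-*ʳ x f rewrite sumR≡sum f | sumR≡sum (λ i → f i * x) = sym (Sum.*-distribʳ-sum x f)

  sum-neg : ∀ {n} (f : Fin n → Carrier) → sumR n (λ i → - f i) ≈ - sumR n f
  sum-neg {n} f = begin
    sumR n (λ i → - f i) ≈⟨ sum-cong (λ i → solve 1 (λ x → :- x := :-1 :* x) refl (f i)) ⟩
    sumR n (λ i → - 1# * f i) ≈⟨ sum-*ˡ (- 1#) f ⟩
    - 1# * sumR n f ≈⟨ solve 1 (λ x → :-1 :* x := :- x) refl (sumR n f) ⟩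
    - sumR n f ∎

  sum-minus : ∀ {n} (f g : Fin n → Carrier) → sumR n (λ i → f i - g i) ≈ sumR n f - sumR n g
  sum-minus f g = trans (sum-+ f (λ i → - g i)) (+-congˡ (sum-neg g))

  sum-swap : ∀ {m n} (f : Fin m → Fin n → Carrier) →
    sumR m (λ i → sumR n (f i)) ≈ sumR n (λ j → sumR m (λ i → f i j))
  sum-swap {m} {n} f = begin
    sumR m (λ i → sumR n (f i)) ≡⟨ sumR≡sum (λ i → sumR n (f i)) ⟩
    Sum.sum (λ i → sumR n (f i)) ≡⟨ Sum.sum-cong-≗ (λ i → sumR≡sum (f i)) ⟩
    Sum.sum (λ i → Sum.sum (f i)) ≈⟨ Sum.∑-comm f ⟩
    Sum.sum (λ j → Sum.sum (λ i → f i j)) ≡⟨ Sum.sum-cong-≗ (λ j → sumR≡sum (λ i → f i j)) ⟨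
    Sum.sum (λ j → sumR m (λ i → f i j)) ≡⟨ sumR≡sum (λ j → sumR m (λ i → f i j)) ⟨
    sumR n (λ j → sumR m (λ i → f i j)) ∎

  sum-remove : ∀ {n} (i : Fin (suc n)) (f : Fin (suc n) → Carrier) →
    sumR (suc n) f ≈ f i + sumR n (λ j → f (punchIn i j))
  sum-remove i f rewrite sumR≡sum (f ∘ suc) | sumR≡sum (λ j → f (punchIn i j)) = Sum.sum-remove {i = i} f

  sum-last : ∀ {n} (f : Fin (suc n) → Carrier) →
    sumR (suc n) f ≈ sumR n (λ i → f (inject₁ i)) + f (fromℕ n)
  sum-last {zero}  f = +-comm _ _
  sum-last {suc n} f = trans (+-congˡ (sum-last (f ∘ suc))) (sym (+-assoc _ _ _))

  sum-split : ∀ m n (f : Fin (m ℕ.+ n) → Carrier) →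
    sumR (m ℕ.+ n) f ≈ sumR m (λ i → f (i ↑ˡ n)) + sumR n (λ j → f (m ↑ʳ j))
  sum-split zero    n f = sym (+-identityˡ _)
  sum-split (suc m) n f = trans (+-congˡ (sum-split m n (f ∘ suc))) (sym (+-assoc _ _ _))

  sum-combine : ∀ m n (f : Fin (m ℕ.* n) → Carrier) →
    sumR (m ℕ.* n) f ≈ sumR m (λ i → sumR n (λ j → f (combine i j)))
  sum-combine zero    n f = refl
  sum-combine (suc m) n f = trans (sum-split n (m ℕ.* n) f) (+-congˡ (sum-combine m n (λ k → f (n ↑ʳ k))))

  ⟦_⟧ : ∀ {p} {P : Set p} → Dec P → Carrier
  ⟦ yes _ ⟧ = 1#
  ⟦ no _ ⟧  = 0#

  ⟦⟧-cong : ∀ {p q} {P : Set p} {Q : Set q} → (P → Q) → (Q → P) → (d : Dec P) (e : Dec Q) → ⟦ d ⟧ ≈ ⟦ e ⟧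
  ⟦⟧-cong f g (yes p) (yes q) = refl
  ⟦⟧-cong f g (yes p) (no ¬q) = contradiction (f p) ¬q
  ⟦⟧-cong f g (no ¬p) (yes q) = contradiction (g q) ¬p
  ⟦⟧-cong f g (no ¬p) (no ¬q) = refl

  ⟦⟧-yes : ∀ {p} {P : Set p} (d : Dec P) → P → ⟦ d ⟧ ≈ 1#
  ⟦⟧-yes (yes _) p = refl
  ⟦⟧-yes (no ¬p) p = contradiction p ¬p

  ⟦⟧-no : ∀ {p} {P : Set p} (d : Dec P) → ¬ P → ⟦ d ⟧ ≈ 0#
  ⟦⟧-no (yes p) ¬p = contradiction p ¬p
  ⟦⟧-no (no _)  ¬p = refl

  δ : ∀ {n} → Fin n → Fin n → Carrier
  δ i j = ⟦ i Fin.≟ j ⟧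

  δ-refl : ∀ {n} (i : Fin n) → δ i i ≈ 1#
  δ-refl i = ⟦⟧-yes (i Fin.≟ i) ≡.refl

  δ-≢ : ∀ {n} {i j : Fin n} → i ≢ j → δ i j ≈ 0#
  δ-≢ {_} {i} {j} = ⟦⟧-no (i Fin.≟ j)

  δ-sym : ∀ {n} (i j : Fin n) → δ i j ≈ δ j i
  δ-sym i j = ⟦⟧-cong ≡.sym ≡.sym (i Fin.≟ j) (j Fin.≟ i)

  sum-δ : ∀ {n} (i : Fin n) (f : Fin n → Carrier) → sumR n (λ j → δ i j * f j) ≈ f i
  sum-δ {suc n} i f = begin
    sumR (suc n) (λ j → δ i j * f j) ≈⟨ sum-remove i (λ j → δ i j * f j) ⟩
    δ i i * f i + sumR n (λ j → δ i (punchIn i j) * f (punchIn i j)) ≈⟨ +-cong (trans (*-congʳ (δ-refl i)) (*-identityˡ _)) (sum-0 (λ j → trans (*-congʳ (δ-≢ (Finₚ.punchInᵢ≢i i j ∘ ≡.sym))) (zeroˡ _))) ⟩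
    f i + 0# ≈⟨ +-identityʳ _ ⟩
    f i ∎

  sum-δ′ : ∀ {n} (i : Fin n) (f : Fin n → Carrier) → sumR n (λ j → δ j i * f j) ≈ f i
  sum-δ′ i f = trans (sum-cong (λ j → *-congʳ (δ-sym j i))) (sum-δ i f)

  pow-cong : ∀ {x y} k → x ≈ y → pow x k ≈ pow y k
  pow-cong zero    x≈y = refl
  pow-cong (suc k) x≈y = *-cong x≈y (pow-cong k x≈y)

  pow-* : ∀ x y k → pow (x * y) k ≈ pow x k * pow y k
  pow-* x y zero    = sym (*-identityˡ _)
  pow-* x y (suc k) = trans (*-congˡ (pow-* x y k)) (solve 4 (λ x y p q → x :* y :* (p :* q) := x :* p :* (y :* q)) refl x y (pow x k) (pow y k))

  natR-+ : ∀ m n → natR (m ℕ.+ n) ≈ natR m + natR n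
  natR-+ zero    n = sym (+-identityˡ _)
  natR-+ (suc m) n = trans (+-congˡ (natR-+ m n)) (sym (+-assoc _ _ _))

  natR-* : ∀ m n → natR (m ℕ.* n) ≈ natR m * natR n
  natR-* zero    n = sym (zeroˡ _)
  natR-* (suc m) n = begin
    natR (n ℕ.+ m ℕ.* n) ≈⟨ natR-+ n (m ℕ.* n) ⟩
    natR n + natR (m ℕ.* n) ≈⟨ +-congˡ (natR-* m n) ⟩
    natR n + natR m * natR n ≈⟨ solve 2 (λ x y → x :+ y :* x := (:1 :+ y) :* x) refl (natR n) (natR m) ⟩
    (1# + natR m) * natR n ∎

  natR-sum : ∀ {n} (f : Fin n → ℕ) → natR (sumℕ n f) ≈ sumR n (λ i → natR (f i))
  natR-sum {zero}  f = refl
  natR-sum {suc n} f = trans (natR-+ (f zero) _) (+-congˡ (natR-sum (f ∘ suc)))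

  natR-ind : ∀ {p} {P : Set p} (d : Dec P) → natR (ind (does d)) ≈ ⟦ d ⟧
  natR-ind (yes _) = +-identityʳ 1#
  natR-ind (no _)  = refl

-- Determinants: multilinear and alternating in the rows.

module Determinant {c ℓ : Level} (R : CommutativeRing c ℓ) where
  open Sums R

  Matrix : ℕ → Set c
  Matrix n = Fin n → Fin n → Carrier

  -- Iterated negation instead of a sign factor, in order to agree with `signP` on the nose;
  -- `alternate≈` passes to the multiplicative form.
  alternate : ℕ → Carrier → Carrier
  alternate zero    x = x
  alternate (suc k) x = - alternate k x

  minor : ∀ {n} → Matrix (suc n) → Fin (suc n) → Matrix n
  minor A j a b = A (suc a) (punchIn j b)

  det : ∀ {n} → Matrix n → Carrier
  det {zero}  A = 1#
  det {suc n} A = sumR (suc n) (λ j → alternate (toℕ j) (A zero j * det (minor A j)))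

  sign : ℕ → Carrier
  sign k = alternate k 1#

  alternate≈ : ∀ k x → alternate k x ≈ sign k * x
  alternate≈ zero    x = sym (*-identityˡ x)
  alternate≈ (suc k) x = trans (-‿cong (alternate≈ k x)) (solve 2 (λ s x → :- (s :* x) := :- s :* x) refl (sign k) x)

  cofactor : ∀ {n} → Matrix (suc n) → Fin (suc n) → Carrier
  cofactor A j = sign (toℕ j) * (A zero j * det (minor A j))

  cofactor-cong : ∀ {n} (A : Matrix (suc n)) j {x y} → A zero j ≈ x → det (minor A j) ≈ y →
    cofactor A j ≈ sign (toℕ j) * (x * y)
  cofactor-cong A j p q = *-congˡ (*-cong p q)

  cofactor-0 : ∀ {n} (A : Matrix (suc n)) j → A zero j * det (minor A j) ≈ 0# → cofactor A j ≈ 0#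
  cofactor-0 A j p = trans (*-congˡ p) (zeroʳ (sign (toℕ j)))

  det-expand : ∀ {n} (A : Matrix (suc n)) → det A ≈ sumR (suc n) (cofactor A)
  det-expand A = sum-cong (λ j → alternate≈ (toℕ j) (A zero j * det (minor A j)))

  det-cong : ∀ {n} {A B : Matrix n} → (∀ i j → A i j ≈ B i j) → det A ≈ det B
  det-cong {zero}  A≈B = refl
  det-cong {suc n} {A} {B} A≈B = begin
    det A ≈⟨ det-expand A ⟩
    sumR (suc n) (cofactor A) ≈⟨ sum-cong (λ j → cofactor-cong A j (A≈B zero j) (det-cong {n} (λ a b → A≈B (suc a) (punchIn j b)))) ⟩
    sumR (suc n) (cofactor B) ≈⟨ det-expand B ⟨
    det B ∎

  AgreeOff : ∀ {n} → Fin n → Matrix n → Matrix n → Set ℓ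
  AgreeOff p A B = ∀ i → i ≢ p → ∀ j → A i j ≈ B i j

  -- Three matrices that agree off row `p`, rather than one updated matrix: this hypothesis passes
  -- to every minor as it stands, so the induction never has to commute an update with a minor.
  det-linear : ∀ {n} (p : Fin n) (A B C : Matrix n) x y → AgreeOff p A B → AgreeOff p A C →
    (∀ j → A p j ≈ x * B p j + y * C p j) → det A ≈ x * det B + y * det C
  det-linear {suc n} p A B C x y A~B A~C Ap = begin
    det A ≈⟨ det-expand A ⟩
    sumR (suc n) (cofactor A) ≈⟨ sum-cong (term-linear p A~B A~C Ap) ⟩
    sumR (suc n) (λ j → x * cofactor B j + y * cofactor C j) ≈⟨ sum-+ (λ j → x * cofactor B j) (λ j → y * cofactor C j) ⟩
    sumR (suc n) (λ j → x * cofactor B j) + sumR (suc n) (λ j → y * cofactor C j) ≈⟨ +-cong (sum-*ˡ x (cofactor B)) (sum-*ˡ y (cofactor C)) ⟩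
    x * sumR (suc n) (cofactor B) + y * sumR (suc n) (cofactor C) ≈⟨ +-cong (*-congˡ (det-expand B)) (*-congˡ (det-expand C)) ⟨
    x * det B + y * det C ∎
    where
    term-linear : ∀ p → AgreeOff p A B → AgreeOff p A C → (∀ j → A p j ≈ x * B p j + y * C p j) →
      ∀ j → cofactor A j ≈ x * cofactor B j + y * cofactor C j
    term-linear zero A~B A~C Ap j = begin
      sign (toℕ j) * (A zero j * det (minor A j))
        ≈⟨ *-congˡ (*-congʳ (Ap j)) ⟩
      sign (toℕ j) * ((x * B zero j + y * C zero j) * det (minor A j))
        ≈⟨ solve 6 (λ s x y b c d → s :* ((x :* b :+ y :* c) :* d) := x :* (s :* (b :* d)) :+ y :* (s :* (c :* d))) refl (sign (toℕ j)) x y (B zero j) (C zero j) (det (minor A j)) ⟩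
      x * (sign (toℕ j) * (B zero j * det (minor A j))) + y * (sign (toℕ j) * (C zero j * det (minor A j)))
        ≈⟨ +-cong (*-congˡ (*-congˡ (*-congˡ (det-cong (λ a b → A~B (suc a) (λ ()) _))))) (*-congˡ (*-congˡ (*-congˡ (det-cong (λ a b → A~C (suc a) (λ ()) _))))) ⟩
      x * cofactor B j + y * cofactor C j ∎
    term-linear (suc p) A~B A~C Ap j = begin
      sign (toℕ j) * (A zero j * det (minor A j))
        ≈⟨ *-congˡ (*-congˡ (det-linear p (minor A j) (minor B j) (minor C j) x y
             (λ i i≢p b → A~B (suc i) (i≢p ∘ Finₚ.suc-injective) _) (λ i i≢p b → A~C (suc i) (i≢p ∘ Finₚ.suc-injective) _) (λ b → Ap _))) ⟩
      sign (toℕ j) * (A zero j * (x * det (minor B j) + y * det (minor C j)))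
        ≈⟨ solve 6 (λ s x y a d e → s :* (a :* (x :* d :+ y :* e)) := x :* (s :* (a :* d)) :+ y :* (s :* (a :* e))) refl (sign (toℕ j)) x y (A zero j) (det (minor B j)) (det (minor C j)) ⟩
      x * (sign (toℕ j) * (A zero j * det (minor B j))) + y * (sign (toℕ j) * (A zero j * det (minor C j)))
        ≈⟨ +-cong (*-congˡ (*-congˡ (*-congʳ (A~B zero (λ ()) j)))) (*-congˡ (*-congˡ (*-congʳ (A~C zero (λ ()) j)))) ⟩
      x * cofactor B j + y * cofactor C j ∎

  private
    lift₀ : ∀ {m n} → (Fin m → Fin n) → Fin (suc m) → Fin (suc n)
    lift₀ f zero    = zero
    lift₀ f (suc i) = suc (f i)

    lift₀-cong : ∀ {m n} {f g : Fin m → Fin n} → (∀ i → f i ≡ g i) → ∀ i → lift₀ f i ≡ lift₀ g i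
    lift₀-cong f≗g zero    = ≡.refl
    lift₀-cong f≗g (suc i) = ≡.cong suc (f≗g i)

    lift₀-punchIn : ∀ {m} (j : Fin (suc (suc m))) (k : Fin (suc m)) i →
      punchIn (suc j) (punchIn (suc k) i) ≡ lift₀ (λ b → punchIn j (punchIn k b)) i
    lift₀-punchIn j k zero    = ≡.refl
    lift₀-punchIn j k (suc i) = ≡.refl

  -- In a double Laplace expansion along two equal rows a, the ordered pairs of columns (0, k + 1) and
  -- (k + 1, 0) leave the same columns h over and carry opposite signs; all other pairs avoid column 0.
  equalRows-cancel : ∀ m (a : Fin (suc (suc m)) → Carrier) (h : (Fin m → Fin (suc (suc m))) → Carrier) →
    (∀ {f g} → (∀ i → f i ≡ g i) → h f ≈ h g) →
    sumR (suc (suc m)) (λ j → sign (toℕ j) * (a j *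
      sumR (suc m) (λ k → sign (toℕ k) * (a (punchIn j k) * h (λ b → punchIn j (punchIn k b)))))) ≈ 0#
  equalRows-cancel m a h h-cong = begin
    sign 0 * (a zero * sumR (suc m) u) + sumR (suc m) (λ j → - sign (toℕ j) * (a (suc j) * (sign 0 * (a zero * w j) + r j)))
      ≈⟨ +-cong (solve 2 (λ x y → :1 :* (x :* y) := x :* y) refl (a zero) (sumR (suc m) u))
                (sum-cong (λ j → solve 5 (λ s x y w r → :- s :* (x :* (:1 :* (y :* w) :+ r)) := :-1 :* y :* (s :* (x :* w)) :+ :-1 :* (s :* (x :* r)))
                             refl (sign (toℕ j)) (a (suc j)) (a zero) (w j) (r j))) ⟩
    a zero * sumR (suc m) u + sumR (suc m) (λ j → - 1# * a zero * u j + - 1# * v j)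
      ≈⟨ +-congˡ (trans (sum-+ (λ j → - 1# * a zero * u j) (λ j → - 1# * v j)) (+-cong (sum-*ˡ (- 1# * a zero) u) (sum-*ˡ (- 1#) v))) ⟩
    a zero * sumR (suc m) u + (- 1# * a zero * sumR (suc m) u + - 1# * sumR (suc m) v)
      ≈⟨ +-congˡ (+-congˡ (*-congˡ (rest m a h h-cong))) ⟩
    a zero * sumR (suc m) u + (- 1# * a zero * sumR (suc m) u + - 1# * 0#)
      ≈⟨ solve 2 (λ x y → x :* y :+ (:-1 :* x :* y :+ :-1 :* :0) := :0) refl (a zero) (sumR (suc m) u) ⟩
    0# ∎
    where
    w : Fin (suc m) → Carrier
    w j = h (λ b → suc (punchIn j b))
    u : Fin (suc m) → Carrier
    u j = sign (toℕ j) * (a (suc j) * w j)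
    r : Fin (suc m) → Carrier
    r j = sumR m (λ k → - sign (toℕ k) * (a (suc (punchIn j k)) * h (λ b → punchIn (suc j) (punchIn (suc k) b))))
    v : Fin (suc m) → Carrier
    v j = sign (toℕ j) * (a (suc j) * r j)
    rest : ∀ m (a : Fin (suc (suc m)) → Carrier) (h : (Fin m → Fin (suc (suc m))) → Carrier) →
      (∀ {f g} → (∀ i → f i ≡ g i) → h f ≈ h g) →
      sumR (suc m) (λ j → sign (toℕ j) * (a (suc j) *
        sumR m (λ k → - sign (toℕ k) * (a (suc (punchIn j k)) * h (λ b → punchIn (suc j) (punchIn (suc k) b)))))) ≈ 0#
    rest zero a h h-cong = sum-0 {n = 1} {f = λ j → sign (toℕ j) * (a (suc j) * 0#)} (λ j → trans (*-congˡ (zeroʳ _)) (zeroʳ _))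
    -- Column 0 is never chosen here, so it stays among the columns left over, where `lift₀` fixes
    -- it; what remains is minus the same double expansion with one column fewer.
    rest (suc m) a h h-cong = begin
      sumR (suc (suc m)) (λ j → sign (toℕ j) * (a (suc j) *
        sumR (suc m) (λ k → - sign (toℕ k) * (a (suc (punchIn j k)) * h (λ b → punchIn (suc j) (punchIn (suc k) b))))))
        ≈⟨ sum-cong {suc (suc m)} (λ j → trans (*-congˡ (*-congˡ (negate j))) (solve 3 (λ s x y → s :* (x :* (:-1 :* y)) := :-1 :* (s :* (x :* y))) refl (sign (toℕ j)) (a (suc j)) _)) ⟩
      sumR (suc (suc m)) (λ j → - 1# * (sign (toℕ j) * (a (suc j) *
        sumR (suc m) (λ k → sign (toℕ k) * (a (suc (punchIn j k)) * h (lift₀ (λ b → punchIn j (punchIn k b))))))))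
        ≈⟨ sum-*ˡ {suc (suc m)} (- 1#) (λ j → sign (toℕ j) * (a (suc j) *
             sumR (suc m) (λ k → sign (toℕ k) * (a (suc (punchIn j k)) * h (lift₀ (λ b → punchIn j (punchIn k b))))))) ⟩
      - 1# * sumR (suc (suc m)) (λ j → sign (toℕ j) * (a (suc j) *
        sumR (suc m) (λ k → sign (toℕ k) * (a (suc (punchIn j k)) * h (lift₀ (λ b → punchIn j (punchIn k b)))))))
        ≈⟨ *-congˡ (equalRows-cancel m (a ∘ suc) (h ∘ lift₀) (h-cong ∘ lift₀-cong)) ⟩
      - 1# * 0# ≈⟨ zeroʳ _ ⟩
      0# ∎
      where
      negate : ∀ j →
        sumR (suc m) (λ k → - sign (toℕ k) * (a (suc (punchIn j k)) * h (λ b → punchIn (suc j) (punchIn (suc k) b)))) ≈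
        - 1# * sumR (suc m) (λ k → sign (toℕ k) * (a (suc (punchIn j k)) * h (lift₀ (λ b → punchIn j (punchIn k b)))))
      negate j = trans
        (sum-cong {suc m} (λ k → trans (*-congˡ (*-congˡ (h-cong (lift₀-punchIn j k))))
          (solve 3 (λ s x y → :- s :* (x :* y) := :-1 :* (s :* (x :* y))) refl (sign (toℕ k)) (a (suc (punchIn j k))) _)))
        (sum-*ˡ {suc m} (- 1#) (λ k → sign (toℕ k) * (a (suc (punchIn j k)) * h (lift₀ (λ b → punchIn j (punchIn k b))))))

  setRow : ∀ {n} → Fin n → (Fin n → Carrier) → Matrix n → Matrix n
  setRow p u A = updateAt A p (const u)

  setRow-at : ∀ {n} (p : Fin n) u (A : Matrix n) j → setRow p u A p j ≈ u j
  setRow-at p u A j = reflexive (≡.cong (λ v → v j) (updateAt-updates p A))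

  setRow-off : ∀ {n} (p : Fin n) u (A : Matrix n) → AgreeOff p (setRow p u A) A
  setRow-off p u A i i≢p j = reflexive (≡.cong (λ v → v j) (updateAt-minimal i p A i≢p))

  setRow-agree : ∀ {n} (p : Fin n) u v (A : Matrix n) → AgreeOff p (setRow p u A) (setRow p v A)
  setRow-agree p u v A i i≢p j = trans (setRow-off p u A i i≢p j) (sym (setRow-off p v A i i≢p j))

  det-setRow-linear : ∀ {n} (p : Fin n) (A : Matrix n) x y u v →
    det (setRow p (λ j → x * u j + y * v j) A) ≈ x * det (setRow p u A) + y * det (setRow p v A)
  det-setRow-linear p A x y u v = det-linear p _ _ _ x y (setRow-agree p _ u A) (setRow-agree p _ v A)
    (λ j → trans (setRow-at p _ A j) (sym (+-cong (*-congˡ (setRow-at p u A j)) (*-congˡ (setRow-at p v A j)))))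

  det-setRow-sum : ∀ {n} (p : Fin n) (A : Matrix n) k (x : Fin k → Carrier) (u : Fin k → Fin n → Carrier) →
    det (setRow p (λ j → sumR k (λ t → x t * u t j)) A) ≈ sumR k (λ t → x t * det (setRow p (u t) A))
  det-setRow-sum p A zero x u = begin
    det (setRow p (λ _ → 0#) A) ≈⟨ det-linear p _ Z Z 0# 0# (setRow-agree p _ _ A) (setRow-agree p _ _ A) (λ j → trans (setRow-at p _ A j) (solve 1 (λ z → :0 := :0 :* z :+ :0 :* z) refl (Z p j))) ⟩
    0# * det Z + 0# * det Z ≈⟨ solve 1 (λ z → :0 :* z :+ :0 :* z := :0) refl (det Z) ⟩
    0# ∎
    where Z = setRow p (λ _ → 0#) A
  det-setRow-sum p A (suc k) x u = begin
    det (setRow p (λ j → x zero * u zero j + s j) A)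
      ≈⟨ det-linear p _ (setRow p (u zero) A) (setRow p s A) (x zero) 1# (setRow-agree p _ _ A) (setRow-agree p _ _ A)
           (λ j → trans (setRow-at p _ A j) (+-cong (*-congˡ (sym (setRow-at p (u zero) A j))) (trans (sym (setRow-at p s A j)) (sym (*-identityˡ _))))) ⟩
    x zero * det (setRow p (u zero) A) + 1# * det (setRow p s A)
      ≈⟨ +-congˡ (trans (*-identityˡ _) (det-setRow-sum p A k (x ∘ suc) (u ∘ suc))) ⟩
    x zero * det (setRow p (u zero) A) + sumR k (λ t → x (suc t) * det (setRow p (u (suc t)) A)) ∎
    where
    s : Fin _ → Carrier
    s j = sumR k (λ t → x (suc t) * u (suc t) j)

  -- Two equal rows below row 0 survive in all minors of the expansion, which gives an induction.
  -- Rows 0 and 1 need the double expansion, and row 0 with a later row is reduced to these two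
  -- cases by multilinearity.
  det-alternating : ∀ {n} (p q : Fin n) (A : Matrix n) → p ≢ q → (∀ j → A p j ≈ A q j) → det A ≈ 0#

  private
    det-equalFirst : ∀ {n} (A : Matrix (suc (suc n))) → (∀ j → A zero j ≈ A (suc zero) j) → det A ≈ 0#
    det-equalFirst {n} A A₀≈A₁ = begin
      det A
        ≈⟨ det-expand A ⟩
      sumR (suc (suc n)) (cofactor A)
        ≈⟨ sum-cong {suc (suc n)} (λ j → cofactor-cong A j refl (trans (det-expand (minor A j)) (sum-cong (λ k → cofactor-cong (minor A j) k (sym (A₀≈A₁ (punchIn j k))) refl)))) ⟩
      sumR (suc (suc n)) (λ j → sign (toℕ j) * (A zero j *
        sumR (suc n) (λ k → sign (toℕ k) * (A zero (punchIn j k) * h (λ b → punchIn j (punchIn k b))))))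
        ≈⟨ equalRows-cancel n (A zero) h (λ f≗g → det-cong (λ a b → reflexive (≡.cong (A (suc (suc a))) (f≗g b)))) ⟩
      0# ∎
      where
      h : (Fin n → Fin (suc (suc n))) → Carrier
      h f = det (λ a b → A (suc (suc a)) (f b))

    det-equalMinor : ∀ {n} (p q : Fin n) (A : Matrix (suc n)) → p ≢ q → (∀ j → A (suc p) j ≈ A (suc q) j) → det A ≈ 0#
    det-equalMinor {n} p q A p≢q Ap≈Aq = begin
      det A
        ≈⟨ det-expand A ⟩
      sumR (suc n) (cofactor A)
        ≈⟨ sum-0 (λ j → cofactor-0 A j (trans (*-congˡ (det-alternating p q (minor A j) p≢q (λ b → Ap≈Aq (punchIn j b)))) (zeroʳ _))) ⟩
      0# ∎

    -- Writing the rows 0, 1, q as (a, b, a):  0 = (a, a + b, a + b) = (a, a, a + b) + (a, b, a) + (a, b, b) = (a, b, a).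
    det-equalZero : ∀ {n} (q : Fin (suc n)) (A : Matrix (suc (suc n))) → (∀ j → A zero j ≈ A (suc q) j) → det A ≈ 0#
    det-equalZero zero A A₀≈Aq = det-equalFirst A A₀≈Aq
    det-equalZero {suc n} (suc q) A A₀≈Aq = begin
      det A
        ≈⟨ det-cong (λ i j → agree i j) ⟩
      det (M B A₀)
        ≈⟨ solve 1 (λ x → x := :1 :* :0 :+ :1 :* (:1 :* x :+ :1 :* :0)) refl (det (M B A₀)) ⟩
      1# * 0# + 1# * (1# * det (M B A₀) + 1# * 0#)
        ≈⟨ +-cong (*-congˡ (sym (det-equalFirst (M A₀ A₀+B) (λ j → trans (M₀ A₀ A₀+B j) (sym (M₁ A₀ A₀+B j))))))
                  (*-congˡ (+-congˡ (*-congˡ (sym (det-equalMinor zero (suc q) (M B B) (λ ()) (λ j → trans (M₁ B B j) (sym (Mq B B j)))))))) ⟩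
      1# * det (M A₀ A₀+B) + 1# * (1# * det (M B A₀) + 1# * det (M B B))
        ≈⟨ +-congˡ (*-congˡ (det-setRow-linear (suc (suc q)) (setRow (suc zero) B A) 1# 1# A₀ B)) ⟨
      1# * det (M A₀ A₀+B) + 1# * det (M B A₀+B)
        ≈⟨ det-linear (suc zero) (M A₀+B A₀+B) (M A₀ A₀+B) (M B A₀+B) 1# 1# (M-agree A₀+B A₀) (M-agree A₀+B B)
             (λ j → trans (M₁ A₀+B A₀+B j) (sym (+-cong (*-congˡ (M₁ A₀ A₀+B j)) (*-congˡ (M₁ B A₀+B j))))) ⟨
      det (M A₀+B A₀+B)
        ≈⟨ det-equalMinor zero (suc q) (M A₀+B A₀+B) (λ ()) (λ j → trans (M₁ A₀+B A₀+B j) (sym (Mq A₀+B A₀+B j))) ⟩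
      0# ∎
      where
      A₀ B A₀+B : Fin (suc (suc (suc n))) → Carrier
      A₀ = A zero
      B  = A (suc zero)
      A₀+B j = 1# * A₀ j + 1# * B j
      M : (u v : Fin (suc (suc (suc n))) → Carrier) → Matrix (suc (suc (suc n)))
      M u v = setRow (suc (suc q)) v (setRow (suc zero) u A)
      M₀ : ∀ u v j → M u v zero j ≈ A₀ j
      M₀ u v j = trans (setRow-off (suc (suc q)) v (setRow (suc zero) u A) zero (λ ()) j) (setRow-off (suc zero) u A zero (λ ()) j)
      M₁ : ∀ u v j → M u v (suc zero) j ≈ u j
      M₁ u v j = trans (setRow-off (suc (suc q)) v (setRow (suc zero) u A) (suc zero) (λ ()) j) (setRow-at (suc zero) u A j)
      Mq : ∀ u v j → M u v (suc (suc q)) j ≈ v j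
      Mq u v j = setRow-at (suc (suc q)) v (setRow (suc zero) u A) j
      M-agree : ∀ u u′ → AgreeOff (suc zero) (M u A₀+B) (M u′ A₀+B)
      M-agree u u′ i i≢1 j with i Fin.≟ suc (suc q)
      ... | yes ≡.refl = trans (Mq u A₀+B j) (sym (Mq u′ A₀+B j))
      ... | no i≢q = trans (setRow-off _ _ (setRow (suc zero) u A) i i≢q j) (trans (setRow-agree (suc zero) u u′ A i i≢1 j)
                       (sym (setRow-off _ _ (setRow (suc zero) u′ A) i i≢q j)))
      agree : ∀ i j → A i j ≈ M B A₀ i j
      agree i j with i Fin.≟ suc (suc q)
      ... | yes ≡.refl = trans (sym (A₀≈Aq j)) (sym (Mq B A₀ j))
      ... | no i≢q with i Fin.≟ suc zero
      ...   | yes ≡.refl = sym (M₁ B A₀ j)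
      ...   | no i≢1 = sym (trans (setRow-off _ _ (setRow (suc zero) B A) i i≢q j) (setRow-off _ _ A i i≢1 j))

  det-alternating zero    zero    A p≢q Ap≈Aq = contradiction ≡.refl p≢q
  det-alternating {suc (suc n)} zero    (suc q) A p≢q Ap≈Aq = det-equalZero q A Ap≈Aq
  det-alternating {suc (suc n)} (suc p) zero    A p≢q Ap≈Aq = det-equalZero p A (sym ∘ Ap≈Aq)
  det-alternating (suc p) (suc q) A p≢q Ap≈Aq = det-equalMinor p q A (p≢q ∘ ≡.cong suc) Ap≈Aq

  -- Multilinearity expands the new row, and every term except i = p repeats a row. For a left
  -- eigenvector `x` the new row is a multiple of `x`, so that a factor can be pulled out of the
  -- determinant.
  det-setRow-combination : ∀ {n} (p : Fin n) (A : Matrix n) (x : Fin n → Carrier) →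
    det (setRow p (λ j → sumR n (λ i → x i * A i j)) A) ≈ x p * det A
  det-setRow-combination {n} p A x = begin
    det (setRow p (λ j → sumR n (λ i → x i * A i j)) A) ≈⟨ det-setRow-sum p A n x A ⟩
    sumR n (λ i → x i * det (setRow p (A i) A)) ≈⟨ sum-cong term ⟩
    sumR n (λ i → δ p i * (x i * det A)) ≈⟨ sum-δ p (λ i → x i * det A) ⟩
    x p * det A ∎
    where
    term : ∀ i → x i * det (setRow p (A i) A) ≈ δ p i * (x i * det A)
    term i with p Fin.≟ i
    ... | no p≢i = begin
      x i * det (setRow p (A i) A) ≈⟨ *-congˡ (det-alternating p i _ p≢i (λ j → trans (setRow-at p (A i) A j) (sym (setRow-off p (A i) A i (p≢i ∘ ≡.sym) j)))) ⟩
      x i * 0# ≈⟨ trans (zeroʳ _) (sym (zeroˡ _)) ⟩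
      0# * (x i * det A) ∎
    ... | yes ≡.refl = begin
      x p * det (setRow p (A p) A) ≈⟨ *-congˡ (det-cong same) ⟩
      x p * det A ≈⟨ *-identityˡ _ ⟨
      1# * (x p * det A) ∎
      where
      same : ∀ i j → setRow p (A p) A i j ≈ A i j
      same i j with i Fin.≟ p
      ... | yes ≡.refl = setRow-at p (A p) A j
      ... | no i≢p     = setRow-off p (A p) A i i≢p j

  det-addRow : ∀ {n} (p q : Fin n) (A B : Matrix n) x → p ≢ q → AgreeOff p A B →
    (∀ j → A p j ≈ B p j + x * B q j) → det A ≈ det B
  det-addRow p q A B x p≢q A~B Ap = begin
    det A ≈⟨ det-linear p A B (setRow p (B q) B) 1# x A~B (λ i i≢p j → trans (A~B i i≢p j) (sym (setRow-off p (B q) B i i≢p j)))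
                                              (λ j → trans (Ap j) (+-cong (sym (*-identityˡ _)) (*-congˡ (sym (setRow-at p (B q) B j))))) ⟩
    1# * det B + x * det (setRow p (B q) B) ≈⟨ +-congˡ (*-congˡ (det-alternating p q _ p≢q (λ j → trans (setRow-at p (B q) B j) (sym (setRow-off p (B q) B q (p≢q ∘ ≡.sym) j))))) ⟩
    1# * det B + x * 0# ≈⟨ solve 2 (λ b x → :1 :* b :+ x :* :0 := b) refl (det B) x ⟩
    det B ∎

  det-zeroColumn : ∀ {n} (A : Matrix (suc n)) → (∀ i → A i zero ≈ 0#) → det A ≈ 0#
  det-zeroColumn {n} A A₀≈0 = trans (det-expand A) (sum-0 (λ j → cofactor-0 A j (term A A₀≈0 j)))
    where
    term : ∀ {n} (A : Matrix (suc n)) → (∀ i → A i zero ≈ 0#) → ∀ j → A zero j * det (minor A j) ≈ 0#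
    term         A A₀≈0 zero    = trans (*-congʳ (A₀≈0 zero)) (zeroˡ _)
    term {suc n} A A₀≈0 (suc j) = trans (*-congˡ (det-zeroColumn (minor A (suc j)) (λ a → A₀≈0 (suc a)))) (zeroʳ _)

  -- The expansion runs along the first row, not the first column: the minors that omit another
  -- column keep a zero column and vanish.
  det-firstColumn : ∀ {n} (A : Matrix (suc n)) → (∀ a → A (suc a) zero ≈ 0#) →
    det A ≈ A zero zero * det (λ a b → A (suc a) (suc b))
  det-firstColumn {n} A A₀≈0 = begin
    det A
      ≈⟨ det-expand A ⟩
    1# * (A zero zero * det (minor A zero)) + sumR n (λ j → cofactor A (suc j))
      ≈⟨ +-cong (*-identityˡ _) (sum-0 (λ j → cofactor-0 A (suc j) (trans (*-congˡ (vanish A A₀≈0 j)) (zeroʳ _)))) ⟩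
    A zero zero * det (λ a b → A (suc a) (suc b)) + 0#
      ≈⟨ +-identityʳ _ ⟩
    A zero zero * det (λ a b → A (suc a) (suc b)) ∎
    where
    vanish : ∀ {n} (A : Matrix (suc n)) → (∀ a → A (suc a) zero ≈ 0#) → ∀ j → det (minor A (suc j)) ≈ 0#
    vanish {suc n} A A₀≈0 j = det-zeroColumn (minor A (suc j)) A₀≈0

-- The polynomial ring, evaluation, and cancellation of linear factors.

module Polynomials {c ℓ : Level} (R : CommutativeRing c ℓ) where
  open Sums R

  -- Coefficient lists are compared up to trailing zeros, so the ring laws are proved for the Cauchy
  -- product `conv` of infinite coefficient sequences and carried over by `coeff-*`.
  Series : Set c
  Series = ℕ → Carrier

  tail : Series → Series
  tail f i = f (suc i)

  conv : Series → Series → Series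
  conv f g zero    = f zero * g zero
  conv f g (suc i) = f zero * g (suc i) + conv (tail f) g i

  conv-cong : ∀ {f f′ g g′} → (∀ i → f i ≈ f′ i) → (∀ i → g i ≈ g′ i) → ∀ i → conv f g i ≈ conv f′ g′ i
  conv-cong f≈ g≈ zero    = *-cong (f≈ 0) (g≈ 0)
  conv-cong f≈ g≈ (suc i) = +-cong (*-cong (f≈ 0) (g≈ (suc i))) (conv-cong (f≈ ∘ suc) g≈ i)

  conv-suc : ∀ f g i → conv f g (suc i) ≈ conv f (tail g) i + f (suc i) * g zero
  conv-suc f g zero    = refl
  conv-suc f g (suc i) = trans (+-congˡ (conv-suc (tail f) g i)) (sym (+-assoc _ _ _))

  conv-comm : ∀ f g i → conv f g i ≈ conv g f i
  conv-comm f g zero    = *-comm _ _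
  conv-comm f g (suc i) = begin
    f zero * g (suc i) + conv (tail f) g i ≈⟨ +-cong (*-comm _ _) (conv-comm (tail f) g i) ⟩
    g (suc i) * f zero + conv g (tail f) i ≈⟨ +-comm _ _ ⟩
    conv g (tail f) i + g (suc i) * f zero ≈⟨ conv-suc g f i ⟨
    conv g f (suc i) ∎

  conv-+ : ∀ f f′ g i → conv (λ i → f i + f′ i) g i ≈ conv f g i + conv f′ g i
  conv-+ f f′ g zero    = distribʳ _ _ _
  conv-+ f f′ g (suc i) = trans (+-congˡ (conv-+ (tail f) (tail f′) g i))
    (solve 5 (λ a b g x y → (a :+ b) :* g :+ (x :+ y) := a :* g :+ x :+ (b :* g :+ y)) refl (f 0) (f′ 0) (g (suc i)) (conv (tail f) g i) (conv (tail f′) g i))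

  conv-scale : ∀ a f g i → conv (λ i → a * f i) g i ≈ a * conv f g i
  conv-scale a f g zero    = *-assoc _ _ _
  conv-scale a f g (suc i) = trans (+-congˡ (conv-scale a (tail f) g i))
    (solve 4 (λ a f g x → a :* f :* g :+ a :* x := a :* (f :* g :+ x)) refl a (f 0) (g (suc i)) (conv (tail f) g i))

  conv-0 : ∀ f g i → (∀ j → f j ≈ 0#) → conv f g i ≈ 0#
  conv-0 f g zero    f≈0 = trans (*-congʳ (f≈0 0)) (zeroˡ _)
  conv-0 f g (suc i) f≈0 = trans (+-cong (trans (*-congʳ (f≈0 0)) (zeroˡ _)) (conv-0 (tail f) g i (f≈0 ∘ suc))) (+-identityˡ 0#)

  conv-assoc : ∀ f g h i → conv (conv f g) h i ≈ conv f (conv g h) i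
  conv-assoc f g h zero    = *-assoc _ _ _
  conv-assoc f g h (suc i) = begin
    f 0 * g 0 * h (suc i) + conv (λ j → f 0 * g (suc j) + conv (tail f) g j) h i
      ≈⟨ +-congˡ (conv-+ (λ j → f 0 * g (suc j)) (conv (tail f) g) h i) ⟩
    f 0 * g 0 * h (suc i) + (conv (λ j → f 0 * g (suc j)) h i + conv (conv (tail f) g) h i)
      ≈⟨ +-congˡ (+-cong (conv-scale (f 0) (tail g) h i) (conv-assoc (tail f) g h i)) ⟩
    f 0 * g 0 * h (suc i) + (f 0 * conv (tail g) h i + conv (tail f) (conv g h) i)
      ≈⟨ solve 5 (λ f g h x y → f :* g :* h :+ (f :* x :+ y) := f :* (g :* h :+ x) :+ y) refl (f 0) (g 0) (h (suc i)) (conv (tail g) h i) (conv (tail f) (conv g h) i) ⟩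
    f 0 * (g 0 * h (suc i) + conv (tail g) h i) + conv (tail f) (conv g h) i ∎

  constant : Carrier → Poly
  constant a = a ∷ []

  conv-constant : ∀ a g i → conv (coeff (constant a)) g i ≈ a * g i
  conv-constant a g zero    = refl
  conv-constant a g (suc i) = trans (+-congˡ (conv-0 (λ _ → 0#) g i (λ _ → refl))) (+-identityʳ _)

  coeff-+ : ∀ p q i → coeff (p +P q) i ≈ coeff p i + coeff q i
  coeff-+ []      q       i       = sym (+-identityˡ _)
  coeff-+ (a ∷ p) []      i       = sym (+-identityʳ _)
  coeff-+ (a ∷ p) (b ∷ q) zero    = refl
  coeff-+ (a ∷ p) (b ∷ q) (suc i) = coeff-+ p q i

  coeff-map* : ∀ a q i → coeff (map (a *_) q) i ≈ a * coeff q i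
  coeff-map* a []      i       = sym (zeroʳ a)
  coeff-map* a (b ∷ q) zero    = refl
  coeff-map* a (b ∷ q) (suc i) = coeff-map* a q i

  coeff-neg : ∀ p i → coeff (negP p) i ≈ - coeff p i
  coeff-neg []      i       = solve 0 (:0 := :- :0) refl
  coeff-neg (a ∷ p) zero    = refl
  coeff-neg (a ∷ p) (suc i) = coeff-neg p i

  coeff-* : ∀ p q i → coeff (p *P q) i ≈ conv (coeff p) (coeff q) i
  coeff-* []      q i       = sym (conv-0 (λ _ → 0#) (coeff q) i (λ _ → refl))
  coeff-* (a ∷ p) q zero    = trans (coeff-+ (map (a *_) q) _ 0) (trans (+-identityʳ _) (coeff-map* a q 0))
  coeff-* (a ∷ p) q (suc i) = trans (coeff-+ (map (a *_) q) _ (suc i)) (+-cong (coeff-map* a q (suc i)) (coeff-* p q i))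

  *P-cong : ∀ {p p′ q q′} → p ≈P p′ → q ≈P q′ → (p *P q) ≈P (p′ *P q′)
  *P-cong {p} {p′} {q} {q′} p≈ q≈ i = trans (coeff-* p q i) (trans (conv-cong p≈ q≈ i) (sym (coeff-* p′ q′ i)))

  *P-comm : ∀ p q → (p *P q) ≈P (q *P p)
  *P-comm p q i = trans (coeff-* p q i) (trans (conv-comm (coeff p) (coeff q) i) (sym (coeff-* q p i)))

  *P-assoc : ∀ p q r → ((p *P q) *P r) ≈P (p *P (q *P r))
  *P-assoc p q r i = begin
    coeff ((p *P q) *P r) i ≈⟨ coeff-* (p *P q) r i ⟩
    conv (coeff (p *P q)) (coeff r) i ≈⟨ conv-cong (coeff-* p q) (λ _ → refl) i ⟩
    conv (conv (coeff p) (coeff q)) (coeff r) i ≈⟨ conv-assoc (coeff p) (coeff q) (coeff r) i ⟩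
    conv (coeff p) (conv (coeff q) (coeff r)) i ≈⟨ conv-cong (λ _ → refl) (coeff-* q r) i ⟨
    conv (coeff p) (coeff (q *P r)) i ≈⟨ coeff-* p (q *P r) i ⟨
    coeff (p *P (q *P r)) i ∎

  constant-* : ∀ a p i → coeff (constant a *P p) i ≈ a * coeff p i
  constant-* a p i = trans (coeff-* (constant a) p i) (conv-constant a (coeff p) i)

  *P-identityˡ : ∀ p → (constant 1# *P p) ≈P p
  *P-identityˡ p i = trans (constant-* 1# p i) (*-identityˡ _)

  *P-distribʳ : ∀ p q r → ((q +P r) *P p) ≈P ((q *P p) +P (r *P p))
  *P-distribʳ p q r i = begin
    coeff ((q +P r) *P p) i ≈⟨ coeff-* (q +P r) p i ⟩
    conv (coeff (q +P r)) (coeff p) i ≈⟨ conv-cong (coeff-+ q r) (λ _ → refl) i ⟩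
    conv (λ i → coeff q i + coeff r i) (coeff p) i ≈⟨ conv-+ (coeff q) (coeff r) (coeff p) i ⟩
    conv (coeff q) (coeff p) i + conv (coeff r) (coeff p) i ≈⟨ +-cong (coeff-* q p i) (coeff-* r p i) ⟨
    coeff (q *P p) i + coeff (r *P p) i ≈⟨ coeff-+ (q *P p) (r *P p) i ⟨
    coeff ((q *P p) +P (r *P p)) i ∎

  +P-cong : ∀ {p p′ q q′} → p ≈P p′ → q ≈P q′ → (p +P q) ≈P (p′ +P q′)
  +P-cong {p} {p′} {q} {q′} p≈ q≈ i = trans (coeff-+ p q i) (trans (+-cong (p≈ i) (q≈ i)) (sym (coeff-+ p′ q′ i)))

  +P-assoc : ∀ p q r → ((p +P q) +P r) ≈P (p +P (q +P r))
  +P-assoc p q r i = begin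
    coeff ((p +P q) +P r) i ≈⟨ trans (coeff-+ (p +P q) r i) (+-congʳ (coeff-+ p q i)) ⟩
    coeff p i + coeff q i + coeff r i ≈⟨ +-assoc _ _ _ ⟩
    coeff p i + (coeff q i + coeff r i) ≈⟨ trans (coeff-+ p (q +P r) i) (+-congˡ (coeff-+ q r i)) ⟨
    coeff (p +P (q +P r)) i ∎

  +P-comm : ∀ p q → (p +P q) ≈P (q +P p)
  +P-comm p q i = trans (coeff-+ p q i) (trans (+-comm _ _) (sym (coeff-+ q p i)))

  negP-cong : ∀ {p q} → p ≈P q → negP p ≈P negP q
  negP-cong {p} {q} p≈q i = trans (coeff-neg p i) (trans (-‿cong (p≈q i)) (sym (coeff-neg q i)))

  negP-inverseˡ : ∀ p → (negP p +P p) ≈P []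
  negP-inverseˡ p i = trans (coeff-+ (negP p) p i) (trans (+-congʳ (coeff-neg p i)) (-‿inverseˡ _))

  -- A record, so that the two polynomials can be inferred from the type of an equation.
  infix 4 _≋_
  record _≋_ (p q : Poly) : Set ℓ where
    constructor coefficientwise
    field coefficients : p ≈P q
  open _≋_ public

  -- As a ring in its own right this lets all determinant lemmas be used for the characteristic
  -- matrix.
  polyRing : CommutativeRing c ℓ
  polyRing = record
    { Carrier = Poly ; _≈_ = _≋_ ; _+_ = _+P_ ; _*_ = _*P_ ; -_ = negP ; 0# = [] ; 1# = constant 1#
    ; isCommutativeRing = record
      { isRing = record
        { +-isAbelianGroup = record
          { isGroup = record
            { isMonoid = record
              { isSemigroup = record
                { isMagma = record
                  { isEquivalence = record
                    { refl = coefficientwise (λ _ → refl)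
                    ; sym = λ e → coefficientwise (λ i → sym (coefficients e i))
                    ; trans = λ e f → coefficientwise (λ i → trans (coefficients e i) (coefficients f i)) }
                  ; ∙-cong = λ {p} {p′} {q} {q′} e f → coefficientwise (+P-cong {p} {p′} {q} {q′} (coefficients e) (coefficients f)) }
                ; assoc = λ p q r → coefficientwise (+P-assoc p q r) }
              ; identity = (λ p → coefficientwise (λ i → refl)) , (λ p → coefficientwise (λ i → trans (coeff-+ p [] i) (+-identityʳ _))) }
            ; inverse = (λ p → coefficientwise (negP-inverseˡ p))
                      , (λ p → coefficientwise (λ i → trans (+P-comm p (negP p) i) (negP-inverseˡ p i)))
            ; ⁻¹-cong = λ {p} {q} e → coefficientwise (negP-cong {p} {q} (coefficients e)) }
          ; comm = λ p q → coefficientwise (+P-comm p q) }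
        ; *-cong = λ {p} {p′} {q} {q′} e f → coefficientwise (*P-cong {p} {p′} {q} {q′} (coefficients e) (coefficients f))
        ; *-assoc = λ p q r → coefficientwise (*P-assoc p q r)
        ; *-identity = (λ p → coefficientwise (*P-identityˡ p))
                     , (λ p → coefficientwise (λ i → trans (*P-comm p (constant 1#) i) (*P-identityˡ p i)))
        ; distrib = (λ p q r → coefficientwise (λ i → trans (*P-comm p (q +P r) i) (trans (*P-distribʳ p q r i)
                      (+P-cong {q *P p} {p *P q} {r *P p} {p *P r} (*P-comm q p) (*P-comm r p) i))))
                  , (λ p q r → coefficientwise (*P-distribʳ p q r)) }
      ; *-comm = λ p q → coefficientwise (*P-comm p q) } }

  eval-≈[] : ∀ p x → p ≈P [] → eval p x ≈ 0#
  eval-≈[] []      x p≈0 = refl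
  eval-≈[] (a ∷ p) x p≈0 = trans (+-cong (p≈0 0) (trans (*-congˡ (eval-≈[] p x (p≈0 ∘ suc))) (zeroʳ x))) (+-identityˡ 0#)

  eval-cong′ : ∀ p q x → p ≈P q → eval p x ≈ eval q x
  eval-cong′ []      q       x p≈q = sym (eval-≈[] q x (λ i → sym (p≈q i)))
  eval-cong′ (a ∷ p) []      x p≈q = eval-≈[] (a ∷ p) x p≈q
  eval-cong′ (a ∷ p) (b ∷ q) x p≈q = +-cong (p≈q 0) (*-congˡ (eval-cong′ p q x (p≈q ∘ suc)))

  eval-cong : ∀ {p q} x → p ≋ q → eval p x ≈ eval q x
  eval-cong {p} {q} x p≈q = eval-cong′ p q x (coefficients p≈q)

  eval-+ : ∀ p q x → eval (p +P q) x ≈ eval p x + eval q x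
  eval-+ []      q       x = sym (+-identityˡ _)
  eval-+ (a ∷ p) []      x = sym (+-identityʳ _)
  eval-+ (a ∷ p) (b ∷ q) x = trans (+-congˡ (*-congˡ (eval-+ p q x)))
    (solve 5 (λ a b x p q → a :+ b :+ x :* (p :+ q) := a :+ x :* p :+ (b :+ x :* q)) refl a b x (eval p x) (eval q x))

  eval-neg : ∀ p x → eval (negP p) x ≈ - eval p x
  eval-neg []      x = solve 0 (:0 := :- :0) refl
  eval-neg (a ∷ p) x = trans (+-congˡ (*-congˡ (eval-neg p x))) (solve 3 (λ a x p → :- a :+ x :* :- p := :- (a :+ x :* p)) refl a x (eval p x))

  eval-map* : ∀ a q x → eval (map (a *_) q) x ≈ a * eval q x
  eval-map* a []      x = sym (zeroʳ a)
  eval-map* a (b ∷ q) x = trans (+-congˡ (*-congˡ (eval-map* a q x))) (solve 4 (λ a b x q → a :* b :+ x :* (a :* q) := a :* (b :+ x :* q)) refl a b x (eval q x))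

  eval-* : ∀ p q x → eval (p *P q) x ≈ eval p x * eval q x
  eval-* []      q x = sym (zeroˡ _)
  eval-* (a ∷ p) q x = begin
    eval (map (a *_) q +P (0# ∷ (p *P q))) x ≈⟨ eval-+ (map (a *_) q) _ x ⟩
    eval (map (a *_) q) x + (0# + x * eval (p *P q) x) ≈⟨ +-cong (eval-map* a q x) (+-congˡ (*-congˡ (eval-* p q x))) ⟩
    a * eval q x + (0# + x * (eval p x * eval q x)) ≈⟨ solve 4 (λ a x p q → a :* q :+ (:0 :+ x :* (p :* q)) := (a :+ x :* p) :* q) refl a x (eval p x) (eval q x) ⟩
    (a + x * eval p x) * eval q x ∎

  module DP = Determinant polyRing
  module D  = Determinant R
  private module P = CommutativeRing polyRing

  sumP-cong : ∀ {n} {f g : Fin n → Poly} → (∀ j → f j ≋ g j) → sumP n f ≋ sumP n g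
  sumP-cong {zero}  f≈g = P.refl
  sumP-cong {suc n} f≈g = P.+-cong (f≈g zero) (sumP-cong (λ j → f≈g (suc j)))

  sumP≡sumR : ∀ {n} (f : Fin n → Poly) → sumP n f ≡ LinAlg.sumR polyRing n f
  sumP≡sumR {zero}  f = ≡.refl
  sumP≡sumR {suc n} f = ≡.cong (f zero +P_) (sumP≡sumR (f ∘ suc))

  signP≡alternate : ∀ k p → signP k p ≡ DP.alternate k p
  signP≡alternate zero    p = ≡.refl
  signP≡alternate (suc k) p = ≡.cong negP (signP≡alternate k p)

  signP-cong : ∀ k {p q} → p ≋ q → signP k p ≋ signP k q
  signP-cong zero    p≈q = p≈q
  signP-cong (suc k) p≈q = P.-‿cong (signP-cong k p≈q)

  detP≋det : ∀ n A → detP n A ≋ DP.det A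
  detP≋det zero    A = P.refl
  detP≋det (suc n) A = P.trans (sumP-cong {suc n} entry) (P.reflexive (sumP≡sumR {suc n} (λ j → DP.alternate (toℕ j) (A zero j *P DP.det (DP.minor A j)))))
    where
    entry : ∀ j → signP (toℕ j) (A zero j *P detP n (DP.minor A j)) ≋ DP.alternate (toℕ j) (A zero j *P DP.det (DP.minor A j))
    entry j = P.trans (signP-cong (toℕ j) (P.*-congˡ {A zero j} (detP≋det n (DP.minor A j))))
                      (P.reflexive (signP≡alternate (toℕ j) _))

  eval-sum : ∀ {n} (f : Fin n → Poly) x → eval (LinAlg.sumR polyRing n f) x ≈ sumR n (λ i → eval (f i) x)
  eval-sum {zero}  f x = refl
  eval-sum {suc n} f x = trans (eval-+ (f zero) _ x) (+-congˡ (eval-sum (f ∘ suc) x))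

  eval-alternate : ∀ k p x → eval (DP.alternate k p) x ≈ D.alternate k (eval p x)
  eval-alternate zero    p x = refl
  eval-alternate (suc k) p x = trans (eval-neg (DP.alternate k p) x) (-‿cong (eval-alternate k p x))

  eval-det : ∀ {n} (A : DP.Matrix n) x → eval (DP.det A) x ≈ D.det (λ i j → eval (A i j) x)
  eval-det {zero}  A x = trans (+-congˡ (zeroʳ x)) (+-identityʳ 1#)
  eval-det {suc n} A x = trans (eval-sum (λ j → DP.alternate (toℕ j) (A zero j *P DP.det (DP.minor A j))) x) (sum-cong entry)
    where
    entry : ∀ j → eval (DP.alternate (toℕ j) (A zero j *P DP.det (DP.minor A j))) x ≈
                  D.alternate (toℕ j) (eval (A zero j) x * D.det (λ a b → eval (DP.minor A j a b) x))
    entry j = begin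
      eval (DP.alternate (toℕ j) (A zero j *P DP.det (DP.minor A j))) x
        ≈⟨ eval-alternate (toℕ j) _ x ⟩
      D.alternate (toℕ j) (eval (A zero j *P DP.det (DP.minor A j)) x)
        ≈⟨ D.alternate≈ (toℕ j) _ ⟩
      D.sign (toℕ j) * eval (A zero j *P DP.det (DP.minor A j)) x
        ≈⟨ *-congˡ (trans (eval-* (A zero j) _ x) (*-congˡ (eval-det (DP.minor A j) x))) ⟩
      D.sign (toℕ j) * (eval (A zero j) x * D.det (λ a b → eval (DP.minor A j a b) x))
        ≈⟨ D.alternate≈ (toℕ j) _ ⟨
      D.alternate (toℕ j) (eval (A zero j) x * D.det (λ a b → eval (DP.minor A j a b) x)) ∎

  coeff-beyond : ∀ p i → coeff p (i ℕ.+ length p) ≈ 0#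
  coeff-beyond []      i = refl
  coeff-beyond (a ∷ p) i = trans (reflexive (≡.cong (coeff (a ∷ p)) (ℕₚ.+-suc i (length p)))) (coeff-beyond p i)

  coeff-linFactor : ∀ a p i → coeff (linFactor a *P p) (suc i) ≈ - a * coeff p (suc i) + coeff p i
  coeff-linFactor a p i = trans (coeff-* (linFactor a) p (suc i)) (+-congˡ (trans (conv-constant 1# (coeff p) i) (*-identityˡ _)))

  -- The relation p_i = a p_{i+1} between consecutive coefficients is followed up past the degree.
  linFactor-regular : ∀ a p → linFactor a *P p ≋ [] → p ≋ []
  linFactor-regular a p ap≈0 = coefficientwise λ i → trans (climb i (length p)) (trans (*-congˡ (beyond i)) (zeroʳ _))
    where
    beyond : ∀ i → coeff p (length p ℕ.+ i) ≈ 0#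
    beyond i = trans (reflexive (≡.cong (coeff p) (ℕₚ.+-comm (length p) i))) (coeff-beyond p i)
    next : ∀ i → coeff p i ≈ a * coeff p (suc i)
    next i = begin
      coeff p i ≈⟨ solve 3 (λ a x y → x := a :* y :+ (:- a :* y :+ x)) refl a (coeff p i) (coeff p (suc i)) ⟩
      a * coeff p (suc i) + (- a * coeff p (suc i) + coeff p i) ≈⟨ +-congˡ (trans (sym (coeff-linFactor a p i)) (coefficients ap≈0 (suc i))) ⟩
      a * coeff p (suc i) + 0# ≈⟨ +-identityʳ _ ⟩
      a * coeff p (suc i) ∎
    climb : ∀ i k → coeff p i ≈ pow a k * coeff p (k ℕ.+ i)
    climb i zero    = sym (*-identityˡ _)
    climb i (suc k) = begin
      coeff p i ≈⟨ climb i k ⟩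
      pow a k * coeff p (k ℕ.+ i) ≈⟨ *-congˡ (next (k ℕ.+ i)) ⟩
      pow a k * (a * coeff p (suc k ℕ.+ i)) ≈⟨ solve 3 (λ a p x → p :* (a :* x) := a :* p :* x) refl a (pow a k) _ ⟩
      a * pow a k * coeff p (suc k ℕ.+ i) ∎

  -- A monic linear factor is regular over every commutative ring, so no integral domain is
  -- involved; cancellation is regularity applied to a difference.
  powP-cancel : ∀ a k p q → powP (linFactor a) k *P p ≋ powP (linFactor a) k *P q → p ≋ q
  powP-cancel a zero    p q eq = P.trans (P.sym (P.*-identityˡ p)) (P.trans eq (P.*-identityˡ q))
  powP-cancel a (suc k) p q eq = powP-cancel a k p q (x∙y⁻¹≈ε⇒x≈y _ _ (linFactor-regular a ((Lᵏ *P p) +P negP (Lᵏ *P q))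
    (P.trans (P.distribˡ L (Lᵏ *P p) (negP (Lᵏ *P q)))
      (P.trans (P.+-cong (P.trans (P.sym (P.*-assoc L Lᵏ p)) (P.trans eq (P.*-assoc L Lᵏ q))) (P.sym (-‿distribʳ-* L (Lᵏ *P q))))
        (P.-‿inverseʳ (L *P (Lᵏ *P q)))))))
    where
    L  = linFactor a
    Lᵏ = powP L k
    open Algebra.Properties.Ring P.ring using (-‿distribʳ-*)
    open Algebra.Properties.AbelianGroup P.+-abelianGroup using (x∙y⁻¹≈ε⇒x≈y)

-- Linear independence over a field without decidable equality.

-- The double-negation shift, valid since the index set is finite. Whenever the goal is a
-- contradiction, it turns coordinates that are not nonzero into coordinates that are zero.
¬¬-∀Fin : ∀ {p n} {P : Fin n → Set p} → (∀ i → ¬ ¬ P i) → ¬ ¬ (∀ i → P i)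
¬¬-∀Fin {n = zero}  ¬¬P k = k λ ()
¬¬-∀Fin {n = suc n} ¬¬P k = ¬¬P zero λ p₀ → ¬¬-∀Fin (λ i → ¬¬P (suc i)) λ p → k λ { zero → p₀ ; (suc i) → p i }

module InsertSums {c ℓ : Level} (R : CommutativeRing c ℓ) where
  open Sums R

  sum-insertAt : ∀ {n} (x : Fin n → Carrier) i v (y : Fin (suc n) → Carrier) →
    sumR (suc n) (λ j → insertAt x i v j * y j) ≈ v * y i + sumR n (λ b → x b * y (punchIn i b))
  sum-insertAt x i v y = trans (sum-remove i (λ j → insertAt x i v j * y j))
    (+-cong (*-congʳ (reflexive (insertAt-lookup x i v))) (sum-cong (λ b → *-congʳ (reflexive (insertAt-punchIn x i v b)))))

module Independence {c ℓ : Level} (F : CommutativeRing c ℓ) (isField : LinAlg.IsField F) where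
  open Sums F
  open Determinant F
  open InsertSums F

  infix 4 _≉0
  _≉0 : Carrier → Set ℓ
  x ≉0 = ¬ (x ≈ 0#)

  1≉0 : 1# ≉0
  1≉0 = proj₁ isField

  nonzero-cancel : ∀ {x y} → x ≉0 → x * y ≈ 0# → y ≈ 0#
  nonzero-cancel {x} {y} x≉0 xy≈0 with proj₂ isField x x≉0
  ... | x⁻¹ , xx⁻¹≈1 = begin
    y ≈⟨ *-identityˡ y ⟨
    1# * y ≈⟨ *-congʳ xx⁻¹≈1 ⟨
    x * x⁻¹ * y ≈⟨ solve 3 (λ x i y → x :* i :* y := i :* (x :* y)) refl x x⁻¹ y ⟩
    x⁻¹ * (x * y) ≈⟨ *-congˡ xy≈0 ⟩
    x⁻¹ * 0# ≈⟨ zeroʳ _ ⟩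
    0# ∎

  -- Equality in F need not be decidable, so independence only yields ¬ ¬ (u t ≈ 0#).
  Independent : ∀ {k d} → (Fin k → Fin d → Carrier) → Set (c ⊔ ℓ)
  Independent {k} V = ∀ (u : Fin k → Carrier) → (∀ j → sumR k (λ i → u i * V i j) ≈ 0#) → ∀ t → ¬ (u t ≉0)

  -- The goal is a negation, so excluded middle may look for a pivot in column 0. If there is none
  -- the column is dropped; otherwise the column is eliminated from the other vectors by
  -- cross-multiplication, without dividing by the pivot.
  too-many-dependent : ∀ d k → d ℕ.< k → (V : Fin k → Fin d → Carrier) → ¬ Independent V
  too-many-dependent zero    (suc k) _           V ind = ind (λ _ → 1#) (λ ()) zero 1≉0
  too-many-dependent (suc d) (suc k) (ℕ.s≤s d<k) V ind = ¬¬-excluded-middle {A = ∃ λ t → V t zero ≉0} λ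
    { (no none) → ¬¬-∀Fin (λ t V≉0 → none (t , V≉0)) λ V₀≈0 →
      too-many-dependent d (suc k) (ℕₚ.m≤n⇒m≤1+n d<k) (λ t i → V t (suc i)) λ u u⊥ → ind u λ
        { zero    → sum-0 {suc k} {λ i → u i * V i zero} (λ i → trans (*-congˡ (V₀≈0 i)) (zeroʳ _))
        ; (suc j) → u⊥ j }
    ; (yes (t , V≉0)) → too-many-dependent d k d<k (reduced t) (reduced-independent t V≉0) }
    where
    reduced : ∀ t → Fin k → Fin d → Carrier
    reduced t b j = V t zero * V (punchIn t b) (suc j) - V (punchIn t b) zero * V t (suc j)
    reduced-independent : ∀ t → V t zero ≉0 → Independent (reduced t)
    reduced-independent t V≉0 u u⊥ b ub≉0 = ind w w⊥ (punchIn t b) λ w≈0 →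
      ub≉0 (nonzero-cancel V≉0 (trans (reflexive (≡.sym (insertAt-punchIn (λ b → V t zero * u b) t (- s) b))) w≈0))
      where
      s : Carrier
      s = sumR k (λ b → u b * V (punchIn t b) zero)
      w : Fin (suc k) → Carrier
      -- The coefficient - s of the pivot vector is forced by the vanishing of column 0.
      w = insertAt (λ b → V t zero * u b) t (- s)
      w⊥ : ∀ j → sumR (suc k) (λ i → w i * V i j) ≈ 0#
      w⊥ j = trans (sum-insertAt (λ b → V t zero * u b) t (- s) (λ i → V i j)) (entry j)
        where
        entry : ∀ j → - s * V t j + sumR k (λ b → V t zero * u b * V (punchIn t b) j) ≈ 0#
        entry zero = begin
          - s * V t zero + sumR k (λ b → V t zero * u b * V (punchIn t b) zero)
            ≈⟨ +-congˡ (trans (sum-cong {k} (λ b → *-assoc _ _ _)) (sum-*ˡ (V t zero) (λ b → u b * V (punchIn t b) zero))) ⟩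
          - s * V t zero + V t zero * s
            ≈⟨ solve 2 (λ s v → :- s :* v :+ v :* s := :0) refl s (V t zero) ⟩
          0# ∎
        entry (suc j) = begin
          - s * V t (suc j) + sumR k (λ b → V t zero * u b * V (punchIn t b) (suc j))
            ≈⟨ +-congʳ (trans (solve 2 (λ s v → :- s :* v := :- v :* s) refl s (V t (suc j))) (sym (sum-*ˡ (- V t (suc j)) (λ b → u b * V (punchIn t b) zero)))) ⟩
          sumR k (λ b → - V t (suc j) * (u b * V (punchIn t b) zero)) + sumR k (λ b → V t zero * u b * V (punchIn t b) (suc j))
            ≈⟨ sum-+ (λ b → - V t (suc j) * (u b * V (punchIn t b) zero)) (λ b → V t zero * u b * V (punchIn t b) (suc j)) ⟨
          sumR k (λ b → - V t (suc j) * (u b * V (punchIn t b) zero) + V t zero * u b * V (punchIn t b) (suc j))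
            ≈⟨ sum-cong (λ b → solve 5 (λ x u y z w → :- x :* (u :* y) :+ z :* u :* w := u :* (z :* w :- y :* x)) refl
                 (V t (suc j)) (u b) (V (punchIn t b) zero) (V t zero) (V (punchIn t b) (suc j))) ⟩
          sumR k (λ b → u b * reduced t b j)
            ≈⟨ u⊥ j ⟩
          0# ∎

  -- A contradictory pair, refuted by `not-singular`; row operations carry both halves along.
  Singular : ∀ {n} → Matrix n → Set (c ⊔ ℓ)
  Singular M = Independent M × det M ≈ 0#

  addRow : ∀ {n} → Fin n → Fin n → Carrier → Matrix n → Matrix n
  addRow p q x M = setRow p (λ j → M p j + x * M q j) M

  addRow-singular : ∀ {n} (p q : Fin n) x (M : Matrix n) → p ≢ q → Singular M → Singular (addRow p q x M)
  addRow-singular {n} p q x M p≢q (ind , det≈0) =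
    independent , trans (det-addRow p q (addRow p q x M) M x p≢q (setRow-off p _ M) (setRow-at p _ M)) det≈0
    where
    entry : ∀ i j → addRow p q x M i j ≈ M i j + δ p i * (x * M q j)
    entry i j with p Fin.≟ i
    ... | yes ≡.refl = trans (setRow-at p _ M j) (+-congˡ (sym (*-identityˡ _)))
    ... | no p≢i     = trans (setRow-off p _ M i (p≢i ∘ ≡.sym) j) (trans (sym (+-identityʳ _)) (+-congˡ (sym (zeroˡ _))))
    independent : Independent (addRow p q x M)
    independent u u⊥ = result
      where
      w : Fin n → Carrier
      -- The row operation moved onto the coefficients: the multiple of row q inside the new row p
      -- is charged to row q.
      w i = u i + δ q i * (x * u p)
      same : ∀ j → sumR n (λ i → w i * M i j) ≈ sumR n (λ i → u i * addRow p q x M i j)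
      same j = begin
        sumR n (λ i → w i * M i j)
          ≈⟨ sum-cong (λ i → solve 4 (λ u d y m → (u :+ d :* y) :* m := u :* m :+ d :* (y :* m)) refl (u i) (δ q i) (x * u p) (M i j)) ⟩
        sumR n (λ i → u i * M i j + δ q i * (x * u p * M i j))
          ≈⟨ trans (sum-+ (λ i → u i * M i j) _) (+-congˡ (sum-δ q (λ i → x * u p * M i j))) ⟩
        sumR n (λ i → u i * M i j) + x * u p * M q j
          ≈⟨ +-congˡ (trans (solve 3 (λ x u m → x :* u :* m := u :* (x :* m)) refl x (u p) (M q j)) (sym (sum-δ p (λ i → u i * (x * M q j))))) ⟩
        sumR n (λ i → u i * M i j) + sumR n (λ i → δ p i * (u i * (x * M q j)))
          ≈⟨ sum-+ (λ i → u i * M i j) (λ i → δ p i * (u i * (x * M q j))) ⟨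
        sumR n (λ i → u i * M i j + δ p i * (u i * (x * M q j)))
          ≈⟨ sum-cong (λ i → trans (solve 4 (λ u m d y → u :* m :+ d :* (u :* y) := u :* (m :+ d :* y)) refl (u i) (M i j) (δ p i) (x * M q j)) (*-congˡ (sym (entry i j)))) ⟩
        sumR n (λ i → u i * addRow p q x M i j) ∎
      w≈0 : ∀ i → ¬ (w i ≉0)
      w≈0 = ind w (λ j → trans (same j) (u⊥ j))
      result : ∀ i → ¬ (u i ≉0)
      result i ui≉0 = w≈0 p λ wp≈0 → w≈0 i λ wi≈0 → ui≉0 (begin
        u i ≈⟨ solve 3 (λ u d y → u := u :+ d :* y :- d :* y) refl (u i) (δ q i) (x * u p) ⟩
        w i - δ q i * (x * u p) ≈⟨ +-cong wi≈0 (-‿cong (*-congˡ (*-congˡ (up≈0 wp≈0)))) ⟩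
        0# - δ q i * (x * 0#) ≈⟨ solve 2 (λ d x → :0 :- d :* (x :* :0) := :0) refl (δ q i) x ⟩
        0# ∎)
        where
        up≈0 : w p ≈ 0# → u p ≈ 0#
        up≈0 wp≈0 = trans (solve 2 (λ u y → u := u :+ :0 :* y) refl (u p) (x * u p)) (trans (+-congˡ (*-congʳ (sym (δ-≢ (p≢q ∘ ≡.sym))))) wp≈0)

  -- One row at a time, so that each stage is a single row operation preserving `Singular`. Row 0
  -- never changes, hence the inverse of its pivot serves throughout.
  clearColumn : ∀ {n} (M : Matrix (suc n)) → M zero zero ≉0 → Singular M → ∀ k → k ℕ.≤ n →
    Σ (Matrix (suc n)) λ M′ → Singular M′ × (∀ j → M′ zero j ≈ M zero j) × (∀ a → toℕ a ℕ.< k → M′ (suc a) zero ≈ 0#)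
  clearColumn M M≉0 sing zero    _   = M , sing , (λ _ → refl) , (λ a ())
  clearColumn M M≉0 sing (suc k) k<n with clearColumn M M≉0 sing k (ℕₚ.<⇒≤ k<n) | proj₂ isField (M zero zero) M≉0
  ... | M′ , sing′ , row₀ , cleared | y , My≈1 =
    addRow (suc a) zero x M′ , addRow-singular (suc a) zero x M′ (λ ()) sing′ ,
    (λ j → trans (setRow-off (suc a) (λ j → M′ (suc a) j + x * M′ zero j) M′ zero (λ ()) j) (row₀ j)) , cleared′
    where
    a = fromℕ< k<n
    x = - (M′ (suc a) zero * y)
    cleared′ : ∀ b → toℕ b ℕ.< suc k → addRow (suc a) zero x M′ (suc b) zero ≈ 0#
    cleared′ b (ℕ.s≤s b≤k) with a Fin.≟ b
    ... | yes ≡.refl = begin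
      addRow (suc a) zero x M′ (suc a) zero ≈⟨ setRow-at (suc a) _ M′ zero ⟩
      M′ (suc a) zero + x * M′ zero zero ≈⟨ +-congˡ (*-congˡ (row₀ zero)) ⟩
      M′ (suc a) zero + x * M zero zero ≈⟨ +-congˡ (solve 3 (λ m y z → :- (m :* y) :* z := :- m :* (z :* y)) refl (M′ (suc a) zero) y (M zero zero)) ⟩
      M′ (suc a) zero + - M′ (suc a) zero * (M zero zero * y) ≈⟨ +-congˡ (*-congˡ My≈1) ⟩
      M′ (suc a) zero + - M′ (suc a) zero * 1# ≈⟨ solve 1 (λ m → m :+ :- m :* :1 := :0) refl (M′ (suc a) zero) ⟩
      0# ∎
    ... | no a≢b = trans (setRow-off (suc a) _ M′ (suc b) (a≢b ∘ ≡.sym ∘ Finₚ.suc-injective) zero)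
      (cleared b (ℕₚ.≤∧≢⇒< b≤k (λ b≡k → a≢b (Finₚ.toℕ-injective (≡.trans (Finₚ.toℕ-fromℕ< k<n) (≡.sym b≡k))))))

  -- Only a contradiction is sought, so the pivot in column 0 may come from excluded middle. Without
  -- a pivot, n + 1 independent rows would live in n columns; with one, the matrix without row and
  -- column 0 inherits both properties.
  not-singular : ∀ {n} (M : Matrix n) → ¬ Singular M

  private
    pivot-first : ∀ {n} (M : Matrix (suc n)) → M zero zero ≉0 → ¬ Singular M
    pivot-first {n} M M≉0 sing with clearColumn M M≉0 sing n ℕₚ.≤-refl
    ... | M′ , (ind , det≈0) , row₀ , cleared = not-singular (λ a b → M′ (suc a) (suc b)) (independent , det′≈0)
      where
      det′≈0 : det (λ a b → M′ (suc a) (suc b)) ≈ 0#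
      det′≈0 = nonzero-cancel (λ M′≈0 → M≉0 (trans (sym (row₀ zero)) M′≈0))
        (trans (sym (det-firstColumn M′ (λ a → cleared a (Finₚ.toℕ<n a)))) det≈0)
      independent : Independent (λ a b → M′ (suc a) (suc b))
      independent u u⊥ t ut≉0 = ind (insertAt u zero 0#) u⊥′ (suc t) ut≉0
        where
        u⊥′ : ∀ j → 0# * M′ zero j + sumR n (λ a → u a * M′ (suc a) j) ≈ 0#
        u⊥′ zero    = trans (+-cong (zeroˡ _) (sum-0 (λ a → trans (*-congˡ (cleared a (Finₚ.toℕ<n a))) (zeroʳ _)))) (+-identityˡ 0#)
        u⊥′ (suc j) = trans (+-cong (zeroˡ _) (u⊥ j)) (+-identityˡ 0#)

  not-singular {zero}  M (ind , det≈0) = 1≉0 det≈0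
  not-singular {suc n} M sing@(ind , det≈0) = ¬¬-excluded-middle {A = ∃ λ i → M i zero ≉0} λ where
    (no none) → ¬¬-∀Fin (λ i M≉0 → none (i , M≉0)) λ M₀≈0 →
      too-many-dependent n (suc n) ℕₚ.≤-refl (λ i j → M i (suc j)) λ u u⊥ → ind u λ where
        zero    → sum-0 {suc n} {λ i → u i * M i zero} (λ i → trans (*-congˡ (M₀≈0 i)) (zeroʳ _))
        (suc j) → u⊥ j
    (yes (zero  , M≉0)) → pivot-first M M≉0 sing
    (yes (suc i , M≉0)) → ¬¬-excluded-middle {A = M zero zero ≈ 0#} λ where
      (no M₀₀≉0)  → pivot-first M M₀₀≉0 sing
      -- The pivot row is added to row 0 instead of being exchanged with it: this leaves the
      -- determinant unchanged, with no sign to follow.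
      (yes M₀₀≈0) → pivot-first (addRow zero (suc i) 1# M)
        (λ sum≈0 → M≉0 (trans (solve 1 (λ m → m := :0 :+ :1 :* m) refl (M (suc i) zero)) (trans (+-congʳ (sym M₀₀≈0)) sum≈0)))
        (addRow-singular zero (suc i) 1# M (λ ()) sing)

-- Replacing rows of a matrix by left eigenvectors.

module RowReplacement {c ℓ : Level} (R : CommutativeRing c ℓ) where
  open Sums R
  open Determinant R

  replaceRows : ∀ {n} k → (Fin k → Fin n) → (Fin k → Fin n → Carrier) → Matrix n → Matrix n
  replaceRows zero    p v X = X
  replaceRows (suc k) p v X = replaceRows k (p ∘ suc) (v ∘ suc) (setRow (p zero) (v zero) X)

  setRow-cong : ∀ {n} (p : Fin n) {u v} {A B : Matrix n} → (∀ j → u j ≈ v j) → (∀ i j → A i j ≈ B i j) →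
    ∀ i j → setRow p u A i j ≈ setRow p v B i j
  setRow-cong p {u} {v} {A} {B} u≈v A≈B i j with i Fin.≟ p
  ... | yes ≡.refl = trans (setRow-at p u A j) (trans (u≈v j) (sym (setRow-at p v B j)))
  ... | no i≢p     = trans (setRow-off p u A i i≢p j) (trans (A≈B i j) (sym (setRow-off p v B i i≢p j)))

  replaceRows-cong : ∀ {n} k p v {A B : Matrix n} → (∀ i j → A i j ≈ B i j) → ∀ i j → replaceRows k p v A i j ≈ replaceRows k p v B i j
  replaceRows-cong zero    p v A≈B = A≈B
  replaceRows-cong (suc k) p v A≈B = replaceRows-cong k (p ∘ suc) (v ∘ suc) (setRow-cong (p zero) (λ _ → refl) A≈B)

  -- Since `v t` is 1 at `p t`, row `p t` may be replaced by the combination with coefficients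
  -- `v t`, which is ξ times `v t`. The vectors still to come vanish at `p t`, so they do not see
  -- the new row and remain left eigenvectors.
  det-replaceRows : ∀ {n} k (p : Fin k → Fin n) (v : Fin k → Fin n → Carrier) (X : Matrix n) ξ →
    (∀ t s → v t (p s) ≈ δ t s) → (∀ t j → sumR n (λ i → v t i * X i j) ≈ ξ * v t j) →
    det X ≈ pow ξ k * det (replaceRows k p v X)
  det-replaceRows zero    p v X ξ v-δ vX = sym (*-identityˡ _)
  det-replaceRows {n} (suc k) p v X ξ v-δ vX = begin
    det X
      ≈⟨ *-identityˡ _ ⟨
    1# * det X
      ≈⟨ *-congʳ (v-δ zero zero) ⟨
    v zero (p zero) * det X
      ≈⟨ det-setRow-combination (p zero) X (v zero) ⟨
    det (setRow (p zero) (λ j → sumR n (λ i → v zero i * X i j)) X)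
      ≈⟨ det-cong (setRow-cong (p zero) (λ j → trans (vX zero j) (solve 2 (λ x v → x :* v := x :* v :+ :0 :* v) refl ξ (v zero j))) (λ _ _ → refl)) ⟩
    det (setRow (p zero) (λ j → ξ * v zero j + 0# * v zero j) X)
      ≈⟨ det-setRow-linear (p zero) X ξ 0# (v zero) (v zero) ⟩
    ξ * det X¹ + 0# * det X¹
      ≈⟨ solve 2 (λ x d → x :* d :+ :0 :* d := x :* d) refl ξ (det X¹) ⟩
    ξ * det X¹
      ≈⟨ *-congˡ (det-replaceRows k (p ∘ suc) (v ∘ suc) X¹ ξ (λ t s → trans (v-δ (suc t) (suc s)) (⟦⟧-cong Finₚ.suc-injective (≡.cong suc) (suc t Fin.≟ suc s) (t Fin.≟ s))) vX¹) ⟩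
    ξ * (pow ξ k * det (replaceRows k (p ∘ suc) (v ∘ suc) X¹))
      ≈⟨ *-assoc _ _ _ ⟨
    pow ξ (suc k) * det (replaceRows (suc k) p v X) ∎
    where
    X¹ = setRow (p zero) (v zero) X
    vX¹ : ∀ t j → sumR n (λ i → v (suc t) i * X¹ i j) ≈ ξ * v (suc t) j
    vX¹ t j = trans (sum-cong entry) (vX (suc t) j)
      where
      entry : ∀ i → v (suc t) i * X¹ i j ≈ v (suc t) i * X i j
      entry i with i Fin.≟ p zero
      ... | yes ≡.refl = trans (trans (*-congʳ v≈0) (zeroˡ _)) (sym (trans (*-congʳ v≈0) (zeroˡ _)))
        where v≈0 = trans (v-δ (suc t) zero) (δ-≢ {i = suc t} {zero} λ ())
      ... | no i≢p = *-congˡ (setRow-off (p zero) (v zero) X i i≢p j)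

  zeroAt : ∀ {n} k → (Fin k → Fin n) → (Fin n → Carrier) → Fin n → Carrier
  zeroAt zero    p u i = u i
  zeroAt (suc k) p u i = zeroAt k (p ∘ suc) u i * (1# - δ (p zero) i)

  zeroAt-on : ∀ {n} k (p : Fin k → Fin n) u t → zeroAt k p u (p t) ≈ 0#
  zeroAt-on (suc k) p u zero    = trans (*-congˡ (trans (+-congˡ (-‿cong (δ-refl (p zero)))) (-‿inverseʳ 1#))) (zeroʳ _)
  zeroAt-on (suc k) p u (suc t) = trans (*-congʳ (zeroAt-on k (p ∘ suc) u t)) (zeroˡ _)

  zeroAt-off : ∀ {n} k (p : Fin k → Fin n) u i → (∀ t → p t ≢ i) → zeroAt k p u i ≈ u i
  zeroAt-off zero    p u i p≢i = refl
  zeroAt-off (suc k) p u i p≢i = trans (*-cong (zeroAt-off k (p ∘ suc) u i (p≢i ∘ suc)) (+-congˡ (-‿cong (δ-≢ (p≢i zero)))))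
    (solve 1 (λ u → u :* (:1 :- :0) := u) refl (u i))

  -- The rows kept from `X` and the inserted rows contribute separately; injectivity of `p` ensures
  -- that no inserted row is overwritten by a later one.
  combine-replaceRows : ∀ {n} k (p : Fin k → Fin n) v (X : Matrix n) u → (∀ {t s} → p t ≡ p s → t ≡ s) → ∀ j →
    sumR n (λ i → u i * replaceRows k p v X i j) ≈ sumR n (λ i → zeroAt k p u i * X i j) + sumR k (λ t → u (p t) * v t j)
  combine-replaceRows zero    p v X u p-inj j = sym (+-identityʳ _)
  combine-replaceRows {n} (suc k) p v X u p-inj j = begin
    sumR n (λ i → u i * replaceRows k (p ∘ suc) (v ∘ suc) X¹ i j)
      ≈⟨ combine-replaceRows k (p ∘ suc) (v ∘ suc) X¹ u (Finₚ.suc-injective ∘ p-inj) j ⟩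
    sumR n (λ i → w i * X¹ i j) + rest
      ≈⟨ +-congʳ (trans (sum-cong entry) (sum-+ (λ i → w i * (1# - δ (p zero) i) * X i j) (λ i → δ (p zero) i * (w i * v zero j)))) ⟩
    sumR n (λ i → zeroAt (suc k) p u i * X i j) + sumR n (λ i → δ (p zero) i * (w i * v zero j)) + rest
      ≈⟨ +-congʳ (+-congˡ (trans (sum-δ (p zero) (λ i → w i * v zero j)) (*-congʳ (zeroAt-off k (p ∘ suc) u (p zero) (λ t pt≡p₀ → 0≢suc (p-inj pt≡p₀)))))) ⟩
    sumR n (λ i → zeroAt (suc k) p u i * X i j) + u (p zero) * v zero j + rest
      ≈⟨ +-assoc _ _ _ ⟩
    sumR n (λ i → zeroAt (suc k) p u i * X i j) + sumR (suc k) (λ t → u (p t) * v t j) ∎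
    where
    X¹   = setRow (p zero) (v zero) X
    w    = zeroAt k (p ∘ suc) u
    rest = sumR k (λ t → u (p (suc t)) * v (suc t) j)
    0≢suc : {t : Fin k} → suc t ≢ zero
    0≢suc ()
    entry : ∀ i → w i * X¹ i j ≈ w i * (1# - δ (p zero) i) * X i j + δ (p zero) i * (w i * v zero j)
    entry i with p zero Fin.≟ i
    ... | yes ≡.refl = trans (*-congˡ (setRow-at (p zero) (v zero) X j))
      (solve 3 (λ w x v → w :* v := w :* (:1 :- :1) :* x :+ :1 :* (w :* v)) refl (w i) (X i j) (v zero j))
    ... | no p≢i     = trans (*-congˡ (setRow-off (p zero) (v zero) X i (p≢i ∘ ≡.sym) j))
      (solve 3 (λ w x v → w :* x := w :* (:1 :- :0) :* x :+ :0 :* (w :* v)) refl (w i) (X i j) (v zero j))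

-- Geometric and algebraic multiplicity from eigenvectors in echelon form.

module Multiplicity {c ℓ : Level} (F : CommutativeRing c ℓ) (isField : LinAlg.IsField F) where
  open Sums F
  open Independence F isField
  open Polynomials F
  private
    module P   = Sums polyRing
    module RP  = RowReplacement polyRing
    module RF  = RowReplacement F

  -- Reduced echelon form: on the coordinates `p` the vectors form the identity matrix, so the
  -- coefficients of a combination are its values there.
  DualBasis : ∀ {n} k → (Fin k → Fin n) → (Fin k → Fin n → Carrier) → Set ℓ
  DualBasis k p v = ∀ t s → v t (p s) ≈ δ t s

  dual-injective : ∀ {n} k (p : Fin k → Fin n) v → DualBasis k p v → ∀ {t s} → p t ≡ p s → t ≡ s
  dual-injective k p v v-δ {t} {s} pt≡ps with t Fin.≟ s
  ... | yes t≡s = t≡s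
  ... | no t≢s  = contradiction (trans (sym (δ-refl t)) (trans (sym (v-δ t t)) (trans (reflexive (≡.cong (v t) pt≡ps)) (trans (v-δ t s) (δ-≢ t≢s))))) 1≉0

  dual-coordinate : ∀ {n} k (p : Fin k → Fin n) v → DualBasis k p v → ∀ (c : Fin k → Carrier) s → sumR k (λ t → c t * v t (p s)) ≈ c s
  dual-coordinate k p v v-δ c s = trans (sum-cong (λ t → trans (*-congˡ (v-δ t s)) (*-comm _ _))) (sum-δ′ s c)

  InNull-combination : ∀ {n} A λ₀ k (v : Fin k → Fin n → Carrier) (c : Fin k → Carrier) → (∀ t → InNull n A λ₀ (v t)) →
    InNull n A λ₀ (λ i → sumR k (λ t → c t * v t i))
  InNull-combination {n} A λ₀ k v c v∈ i = begin
    sumR n (λ j → A i j * sumR k (λ t → c t * v t j))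
      ≈⟨ sum-cong {n} (λ j → trans (sym (sum-*ˡ (A i j) (λ t → c t * v t j))) (sum-cong {k} (λ t → solve 3 (λ a c v → a :* (c :* v) := c :* (a :* v)) refl (A i j) (c t) (v t j)))) ⟩
    sumR n (λ j → sumR k (λ t → c t * (A i j * v t j)))
      ≈⟨ sum-swap (λ j t → c t * (A i j * v t j)) ⟩
    sumR k (λ t → sumR n (λ j → c t * (A i j * v t j)))
      ≈⟨ sum-cong {k} (λ t → trans (sum-*ˡ (c t) (λ j → A i j * v t j)) (trans (*-congˡ (v∈ t i)) (solve 3 (λ c l v → c :* (l :* v) := l :* (c :* v)) refl (c t) λ₀ (v t i)))) ⟩
    sumR k (λ t → λ₀ * (c t * v t i))
      ≈⟨ sum-*ˡ λ₀ (λ t → c t * v t i) ⟩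
    λ₀ * sumR k (λ t → c t * v t i) ∎

  -- Up to double negation an eigenvector is determined by its k coordinates at `p`, so independent
  -- eigenvectors stay independent after restriction to them. As k′ ≤ k is decidable, refuting its
  -- negation suffices.
  geoMult : ∀ n A λ₀ k p v → DualBasis k p v → (∀ t → InNull n A λ₀ (v t)) →
    (∀ u → InNull n A λ₀ u → (∀ t → u (p t) ≈ 0#) → ∀ i → ¬ (u i ≉0)) → GeoMult n A λ₀ k
  geoMult n A λ₀ k p v v-δ v∈ unique =
    (v , v∈ , λ c Σ≈0 s → trans (sym (dual-coordinate k p v v-δ c s)) (Σ≈0 (p s))) , upper
    where
    upper : ∀ k′ (w : Fin k′ → Fin n → Carrier) → (∀ t → InNull n A λ₀ (w t)) → LinIndep n k′ w → k′ ℕ.≤ k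
    upper k′ w w∈ indep with k′ ℕ.≤? k
    ... | yes k′≤k = k′≤k
    ... | no k′≰k = contradiction restricted-independent (too-many-dependent k k′ (ℕₚ.≰⇒> k′≰k) (λ t s → w t (p s)))
      where
      restricted-independent : Independent (λ t s → w t (p s))
      restricted-independent u u⊥ t ut≉0 =
        ¬¬-∀Fin (unique (λ i → sumR k′ (λ t → u t * w t i)) (InNull-combination A λ₀ k′ w u w∈) u⊥) λ Σ≈0 → ut≉0 (indep u Σ≈0 t)

  charMatrix : ∀ n → (Fin n → Fin n → Carrier) → DP.Matrix n
  charMatrix n A i j = if does (i Fin.≟ j) then (- A i j) ∷ 1# ∷ [] else (- A i j) ∷ []

  coeff-sum : ∀ {n} (f : Fin n → Poly) l → coeff (P.sumR n f) l ≈ sumR n (λ i → coeff (f i) l)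
  coeff-sum {zero}  f l = refl
  coeff-sum {suc n} f l = trans (coeff-+ (f zero) _ l) (+-congˡ (coeff-sum (f ∘ suc) l))

  -- Left multiplication by a constant vector acts on x - A through A alone. Left eigenvectors are
  -- the right ones to use, because `det-replaceRows` combines rows.
  charMatrix-left : ∀ n A λ₀ (v : Fin n → Carrier) → (∀ j → sumR n (λ i → v i * A i j) ≈ λ₀ * v j) →
    ∀ j → P.sumR n (λ i → constant (v i) *P charMatrix n A i j) ≋ linFactor λ₀ *P constant (v j)
  charMatrix-left n A λ₀ v vA j = coefficientwise λ l → begin
    coeff (P.sumR n (λ i → constant (v i) *P charMatrix n A i j)) l
      ≈⟨ coeff-sum (λ i → constant (v i) *P charMatrix n A i j) l ⟩
    sumR n (λ i → coeff (constant (v i) *P charMatrix n A i j) l)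
      ≈⟨ sum-cong (λ i → constant-* (v i) (charMatrix n A i j) l) ⟩
    sumR n (λ i → v i * coeff (charMatrix n A i j) l)
      ≈⟨ level l ⟩
    v j * coeff (linFactor λ₀) l
      ≈⟨ constant-* (v j) (linFactor λ₀) l ⟨
    coeff (constant (v j) *P linFactor λ₀) l
      ≈⟨ *P-comm (constant (v j)) (linFactor λ₀) l ⟩
    coeff (linFactor λ₀ *P constant (v j)) l ∎
    where
    coeff₀ : ∀ i → coeff (charMatrix n A i j) 0 ≈ - A i j
    coeff₀ i with i Fin.≟ j
    ... | yes _ = refl
    ... | no _  = refl
    coeff₁ : ∀ i → coeff (charMatrix n A i j) 1 ≈ δ i j
    coeff₁ i with i Fin.≟ j
    ... | yes _ = refl
    ... | no _  = refl
    coeff₂ : ∀ i l → coeff (charMatrix n A i j) (suc (suc l)) ≈ 0#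
    coeff₂ i l with i Fin.≟ j
    ... | yes _ = refl
    ... | no _  = refl
    level : ∀ l → sumR n (λ i → v i * coeff (charMatrix n A i j) l) ≈ v j * coeff (linFactor λ₀) l
    level zero = begin
      sumR n (λ i → v i * coeff (charMatrix n A i j) 0) ≈⟨ sum-cong {n} (λ i → trans (*-congˡ (coeff₀ i)) (solve 2 (λ v a → v :* :- a := :- (v :* a)) refl (v i) (A i j))) ⟩
      sumR n (λ i → - (v i * A i j)) ≈⟨ trans (sum-neg (λ i → v i * A i j)) (-‿cong (vA j)) ⟩
      - (λ₀ * v j) ≈⟨ solve 2 (λ l v → :- (l :* v) := v :* :- l) refl λ₀ (v j) ⟩
      v j * - λ₀ ∎
    level (suc zero) = begin
      sumR n (λ i → v i * coeff (charMatrix n A i j) 1) ≈⟨ sum-cong {n} (λ i → trans (*-congˡ (coeff₁ i)) (*-comm _ _)) ⟩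
      sumR n (λ i → δ i j * v i) ≈⟨ sum-δ′ j v ⟩
      v j ≈⟨ *-identityʳ _ ⟨
      v j * 1# ∎
    level (suc (suc l)) = trans (sum-0 {n} (λ i → trans (*-congˡ (coeff₂ i l)) (zeroʳ _))) (sym (zeroʳ _))

  eval-charMatrix : ∀ n A x i j → eval (charMatrix n A i j) x ≈ x * δ i j - A i j
  eval-charMatrix n A x i j with i Fin.≟ j
  ... | yes _ = solve 2 (λ x a → :- a :+ x :* (:1 :+ x :* :0) := x :* :1 :- a) refl x (A i j)
  ... | no _  = solve 2 (λ x a → :- a :+ x :* :0 := x :* :0 :- a) refl x (A i j)

  eval-replaceRows : ∀ {n} k (p : Fin k → Fin n) v X x i j →
    eval (RP.replaceRows k p (λ t l → constant (v t l)) X i j) x ≈ RF.replaceRows k p v (λ i j → eval (X i j) x) i j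
  eval-replaceRows zero    p v X x i j = refl
  eval-replaceRows (suc k) p v X x i j = trans (eval-replaceRows k (p ∘ suc) (v ∘ suc) (DP.setRow (p zero) v₀ X) x i j)
    (RF.replaceRows-cong k (p ∘ suc) (v ∘ suc) entry i j)
    where
    v₀ = λ l → constant (v zero l)
    entry : ∀ i j → eval (DP.setRow (p zero) v₀ X i j) x ≈ D.setRow (p zero) (v zero) (λ i j → eval (X i j) x) i j
    entry i j with i Fin.≟ p zero
    ... | yes ≡.refl = trans (eval-cong x (DP.setRow-at (p zero) v₀ X j))
                         (trans (solve 2 (λ v x → v :+ x :* :0 := v) refl (v zero j) x) (sym (D.setRow-at (p zero) (v zero) _ j)))
    ... | no i≢p     = trans (eval-cong x (DP.setRow-off (p zero) v₀ X i i≢p j)) (sym (D.setRow-off (p zero) (v zero) _ i i≢p j))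

  powP≡pow : ∀ p k → powP p k ≡ P.pow p k
  powP≡pow p zero    = ≡.refl
  powP≡pow p (suc k) = ≡.cong (p *P_) (powP≡pow p k)

  -- Replacing row p t of x − A by the left eigenvector v t splits off one factor x − λ₀ for each t.  If one more
  -- factor divided the determinant, the remaining matrix would be singular at x = λ₀, and a relation
  -- between its rows is a generalized eigenvector, excluded by the last hypothesis.
  algMult : ∀ n A λ₀ k p v → DualBasis k p v → (∀ t j → sumR n (λ i → v t i * A i j) ≈ λ₀ * v t j) →
    (∀ (u : Fin n → Carrier) (c : Fin k → Carrier) → (∀ t → u (p t) ≈ 0#) → (∀ j → sumR n (λ i → u i * A i j) ≈ λ₀ * u j + sumR k (λ t → c t * v t j)) → ∀ i → ¬ (u i ≉0)) →
    AlgMult n A λ₀ k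
  algMult n A λ₀ k p v v-δ vA unique = (DP.det Y , coefficients factorisation) , not-more
    where
    ξ = linFactor λ₀
    X = charMatrix n A
    v̂ = λ t l → constant (v t l)
    Y = RP.replaceRows k p v̂ X
    v̂-δ : ∀ t s → v̂ t (p s) ≋ P.δ t s
    v̂-δ t s with t Fin.≟ s | v-δ t s
    ... | yes _ | v≈1 = coefficientwise λ { zero → v≈1 ; (suc l) → refl }
    ... | no _  | v≈0 = coefficientwise λ { zero → v≈0 ; (suc l) → refl }
    factorisation : charPoly n A ≋ powP ξ k *P DP.det Y
    factorisation = P.trans (detP≋det n X) (P.trans (RP.det-replaceRows k p v̂ X ξ v̂-δ (λ t → charMatrix-left n A λ₀ (v t) (vA t)))
      (P.*-congʳ {DP.det Y} (P.reflexive (≡.sym (powP≡pow ξ k)))))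
    Yλ = RF.replaceRows k p v (λ i j → eval (X i j) λ₀)
    independent : Independent Yλ
    independent u u⊥ i ui≉0 = ¬¬-∀Fin w~0 λ w≈0 → conclude w≈0
      where
      -- `unique` wants a vector that vanishes at every `p t`; the coefficients at the inserted rows
      -- are split off and reappear as the coefficients of the eigenvectors.
      w = RF.zeroAt k p u
      relation : ∀ j → sumR n (λ i → w i * A i j) ≈ λ₀ * w j + sumR k (λ t → u (p t) * v t j)
      relation j = begin
        sumR n (λ i → w i * A i j)
          ≈⟨ solve 2 (λ s t → s := s :+ t :+ :- t) refl (sumR n (λ i → w i * A i j)) S ⟩
        sumR n (λ i → w i * A i j) + S + - S
          ≈⟨ +-congˡ (-‿cong (trans (+-congʳ (sum-cong {n} (λ i → *-congˡ (sym (eval-charMatrix n A λ₀ i j))))) (trans (sym (RF.combine-replaceRows k p v (λ i j → eval (X i j) λ₀) u (dual-injective k p v v-δ) j)) (u⊥ j)))) ⟩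
        sumR n (λ i → w i * A i j) + S + - 0#
          ≈⟨ solve 3 (λ a b c → a :+ (b :+ c) :- :0 := a :+ b :+ c) refl (sumR n (λ i → w i * A i j)) (sumR n (λ i → w i * (λ₀ * δ i j - A i j))) (sumR k (λ t → u (p t) * v t j)) ⟩
        sumR n (λ i → w i * A i j) + sumR n (λ i → w i * (λ₀ * δ i j - A i j)) + sumR k (λ t → u (p t) * v t j)
          ≈⟨ +-congʳ (trans (sym (sum-+ (λ i → w i * A i j) (λ i → w i * (λ₀ * δ i j - A i j))))
               (trans (sum-cong {n} (λ i → solve 4 (λ w a l d → w :* a :+ w :* (l :* d :- a) := d :* (l :* w)) refl (w i) (A i j) λ₀ (δ i j))) (sum-δ′ j (λ i → λ₀ * w i)))) ⟩
        λ₀ * w j + sumR k (λ t → u (p t) * v t j) ∎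
        where S = sumR n (λ i → w i * (λ₀ * δ i j - A i j)) + sumR k (λ t → u (p t) * v t j)
      w~0 : ∀ i → ¬ (w i ≉0)
      w~0 = unique w (u ∘ p) (RF.zeroAt-on k p u) relation
      conclude : ¬ (∀ i → w i ≈ 0#)
      conclude w≈0 with Finₚ.any? (λ t → p t Fin.≟ i)
      ... | no off = ui≉0 (trans (sym (RF.zeroAt-off k p u i (λ t pt≡i → off (t , pt≡i)))) (w≈0 i))
      ... | yes (t , ≡.refl) = ui≉0 (begin
        u (p t) ≈⟨ dual-coordinate k p v v-δ (u ∘ p) t ⟨
        sumR k (λ s → u (p s) * v s (p t)) ≈⟨ +-identityˡ _ ⟨
        0# + sumR k (λ s → u (p s) * v s (p t)) ≈⟨ +-congʳ (trans (*-congˡ (w≈0 (p t))) (zeroʳ _)) ⟨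
        λ₀ * w (p t) + sumR k (λ s → u (p s) * v s (p t)) ≈⟨ relation (p t) ⟨
        sumR n (λ i → w i * A i (p t)) ≈⟨ sum-0 {n} (λ i → trans (*-congʳ (w≈0 i)) (zeroˡ _)) ⟩
        0# ∎)
    not-more : ¬ (powP ξ (suc k) ∣P charPoly n A)
    not-more (q , charPoly≈) = not-singular Yλ (independent , (begin
      D.det Yλ ≈⟨ D.det-cong (eval-replaceRows k p v X λ₀) ⟨
      D.det (λ i j → eval (Y i j) λ₀) ≈⟨ eval-det Y λ₀ ⟨
      eval (DP.det Y) λ₀ ≈⟨ eval-cong λ₀ det≋ ⟩
      eval (ξ *P q) λ₀ ≈⟨ eval-* ξ q λ₀ ⟩
      eval ξ λ₀ * eval q λ₀ ≈⟨ solve 2 (λ l q → (:- l :+ l :* (:1 :+ l :* :0)) :* q := :0) refl λ₀ (eval q λ₀) ⟩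
      0# ∎))
      where
      det≋ : DP.det Y ≋ ξ *P q
      det≋ = powP-cancel λ₀ k (DP.det Y) (ξ *P q) (P.trans (P.sym factorisation) (P.trans (coefficientwise charPoly≈)
        (P.solve 3 (λ x y z → x P.:* y P.:* z P.:= y P.:* (x P.:* z)) P.refl ξ (powP ξ k) q)))

-- Gaussian elimination and rank-nullity.

punchIn-elim : ∀ {p n} (P : Fin (suc n) → Set p) e → P e → (∀ f → P (punchIn e f)) → ∀ j → P j
punchIn-elim P e at-e off-e j with e Fin.≟ j
... | yes ≡.refl = at-e
... | no e≢j     = ≡.subst P (Finₚ.punchIn-punchOut e≢j) (off-e (punchOut e≢j))

all-or-some : ∀ {a b n} {A : Fin n → Set a} {B : Fin n → Set b} → (∀ i → A i ⊎ B i) → (∀ i → A i) ⊎ ∃ B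
all-or-some {n = zero}  AB = inj₁ λ ()
all-or-some {n = suc n} AB with AB zero | all-or-some (AB ∘ suc)
... | inj₂ b | _              = inj₂ (zero , b)
... | inj₁ a | inj₂ (i , b)   = inj₂ (suc i , b)
... | inj₁ a | inj₁ as        = inj₁ λ { zero → a ; (suc i) → as i }

-- Equality in F is not assumed decidable; pivots are searched for in the prime field only.
record DecidableSubfield {c ℓ : Level} (R : CommutativeRing c ℓ) (k : Level) : Set (c ⊔ ℓ ⊔ lsuc k) where
  open CommutativeRing R
  field
    Member  : Carrier → Set k
    _+-mem_ : ∀ {x y} → Member x → Member y → Member (x + y)
    _*-mem_ : ∀ {x y} → Member x → Member y → Member (x * y)
    neg-mem : ∀ {x} → Member x → Member (- x)
    invert  : ∀ {x} → Member x → x ≈ 0# ⊎ ∃ λ y → Member y × x * y ≈ 1#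

module Elimination {c ℓ : Level} (R : CommutativeRing c ℓ) where
  open Sums R
  open InsertSums R

  -- `unique` stands in for spanning: subtracting the combination of the `vector`s prescribed by the
  -- free coordinates leaves a kernel element that vanishes at all of them.
  record KernelBasis {n m : ℕ} (D : Fin n → Fin m → Carrier) (k : ℕ) : Set (c ⊔ ℓ) where
    field
      free      : Fin k → Fin m
      vector    : Fin k → Fin m → Carrier
      dual      : ∀ t s → vector t (free s) ≈ δ t s
      in-kernel : ∀ t x → sumR m (λ e → vector t e * D x e) ≈ 0#
      unique    : ∀ (a : Fin m → Carrier) → (∀ x → sumR m (λ e → a e * D x e) ≈ 0#) → (∀ t → a (free t) ≈ 0#) → ∀ e → a e ≈ 0#
  open KernelBasis

  transpose : ∀ {n m} → (Fin n → Fin m → Carrier) → Fin m → Fin n → Carrier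
  transpose D e x = D x e

  noEquations : ∀ {m} (D : Fin 0 → Fin m → Carrier) → KernelBasis D m
  noEquations D = record
    { free = id ; vector = δ ; dual = λ t s → refl ; in-kernel = λ t () ; unique = λ a _ a≈0 → a≈0 }

  noUnknowns : ∀ {n} (D : Fin n → Fin 0 → Carrier) → KernelBasis D 0
  noUnknowns D = record
    { free = λ () ; vector = λ () ; dual = λ () ; in-kernel = λ () ; unique = λ _ _ _ () }

  module ZeroRow {n m} (D : Fin (suc n) → Fin m → Carrier) (D₀≈0 : ∀ e → D zero e ≈ 0#) where
    columns : ∀ {k} → KernelBasis (D ∘ suc) k → KernelBasis D k
    columns B = record
      { free = free B ; vector = vector B ; dual = dual B
      ; in-kernel = λ { t zero → sum-0 (λ e → trans (*-congˡ (D₀≈0 e)) (zeroʳ _)) ; t (suc x) → in-kernel B t x }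
      ; unique = λ a Da≈0 → unique B a (Da≈0 ∘ suc) }

    -- A zero row imposes nothing on the columns, but for the left kernel it is a free unknown:
    -- hence `suc l`.
    rows : ∀ {l} → KernelBasis (transpose (D ∘ suc)) l → KernelBasis (transpose D) (suc l)
    rows {l} B = record { free = free′ ; vector = vector′ ; dual = dual′ ; in-kernel = in-kernel′ ; unique = unique′ }
      where
      free′ : Fin (suc l) → Fin (suc n)
      free′ zero    = zero
      free′ (suc t) = suc (free B t)
      vector′ : Fin (suc l) → Fin (suc n) → Carrier
      vector′ zero    x       = δ zero x
      vector′ (suc t) zero    = 0#
      vector′ (suc t) (suc x) = vector B t x
      dual′ : ∀ t s → vector′ t (free′ s) ≈ δ t s
      dual′ zero    zero    = refl
      dual′ zero    (suc s) = refl
      dual′ (suc t) zero    = refl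
      dual′ (suc t) (suc s) = trans (dual B t s) (⟦⟧-cong (≡.cong suc) Finₚ.suc-injective (t Fin.≟ s) (suc t Fin.≟ suc s))
      in-kernel′ : ∀ t e → sumR (suc n) (λ x → vector′ t x * D x e) ≈ 0#
      in-kernel′ zero    e = trans (+-cong (trans (*-congˡ (D₀≈0 e)) (zeroʳ _)) (sum-0 {n} (λ x → zeroˡ _))) (+-identityˡ 0#)
      in-kernel′ (suc t) e = trans (+-cong (zeroˡ _) (in-kernel B t e)) (+-identityˡ 0#)
      unique′ : ∀ (w : Fin (suc n) → Carrier) → (∀ e → sumR (suc n) (λ x → w x * D x e) ≈ 0#) → (∀ t → w (free′ t) ≈ 0#) → ∀ x → w x ≈ 0#
      unique′ w wD≈0 w≈0 zero    = w≈0 zero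
      unique′ w wD≈0 w≈0 (suc x) = unique B (w ∘ suc)
        (λ e → trans (trans (sym (+-identityˡ _)) (+-congʳ (sym (trans (*-congˡ (D₀≈0 e)) (zeroʳ (w zero)))))) (wD≈0 e)) (w≈0 ∘ suc) x

  module Pivot {n m} (D : Fin (suc n) → Fin (suc m) → Carrier) (e : Fin (suc m)) (y : Carrier) (Dy≈1 : D zero e * y ≈ 1#) where
    -- The Schur complement of the pivot `D zero e`, whose inverse is `y`.
    reduced : Fin n → Fin m → Carrier
    reduced b f = D (suc b) (punchIn e f) - D (suc b) e * (y * D zero (punchIn e f))

    sum-reduced-columns : ∀ b (a : Fin m → Carrier) → sumR m (λ f → a f * reduced b f) ≈
      sumR m (λ f → a f * D (suc b) (punchIn e f)) - D (suc b) e * y * sumR m (λ f → a f * D zero (punchIn e f))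
    sum-reduced-columns b a = begin
      sumR m (λ f → a f * reduced b f)
        ≈⟨ sum-cong (λ f → solve 5 (λ a d g y h → a :* (d :- g :* (y :* h)) := a :* d :- g :* y :* (a :* h)) refl (a f) (D (suc b) (punchIn e f)) (D (suc b) e) y (D zero (punchIn e f))) ⟩
      sumR m (λ f → a f * D (suc b) (punchIn e f) - D (suc b) e * y * (a f * D zero (punchIn e f)))
        ≈⟨ sum-minus (λ f → a f * D (suc b) (punchIn e f)) (λ f → D (suc b) e * y * (a f * D zero (punchIn e f))) ⟩
      sumR m (λ f → a f * D (suc b) (punchIn e f)) - sumR m (λ f → D (suc b) e * y * (a f * D zero (punchIn e f)))
        ≈⟨ +-congˡ (-‿cong (sum-*ˡ (D (suc b) e * y) (λ f → a f * D zero (punchIn e f)))) ⟩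
      sumR m (λ f → a f * D (suc b) (punchIn e f)) - D (suc b) e * y * sumR m (λ f → a f * D zero (punchIn e f)) ∎

    sum-reduced-rows : ∀ f (w : Fin n → Carrier) → sumR n (λ b → w b * reduced b f) ≈
      sumR n (λ b → w b * D (suc b) (punchIn e f)) - sumR n (λ b → w b * D (suc b) e) * (y * D zero (punchIn e f))
    sum-reduced-rows f w = begin
      sumR n (λ b → w b * reduced b f)
        ≈⟨ sum-cong (λ b → solve 4 (λ a d g z → a :* (d :- g :* z) := a :* d :- a :* g :* z) refl (w b) (D (suc b) (punchIn e f)) (D (suc b) e) (y * D zero (punchIn e f))) ⟩
      sumR n (λ b → w b * D (suc b) (punchIn e f) - w b * D (suc b) e * (y * D zero (punchIn e f)))
        ≈⟨ sum-minus (λ b → w b * D (suc b) (punchIn e f)) (λ b → w b * D (suc b) e * (y * D zero (punchIn e f))) ⟩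
      sumR n (λ b → w b * D (suc b) (punchIn e f)) - sumR n (λ b → w b * D (suc b) e * (y * D zero (punchIn e f)))
        ≈⟨ +-congˡ (-‿cong (sum-*ʳ (y * D zero (punchIn e f)) (λ b → w b * D (suc b) e))) ⟩
      sumR n (λ b → w b * D (suc b) (punchIn e f)) - sumR n (λ b → w b * D (suc b) e) * (y * D zero (punchIn e f)) ∎

    private
      pivot-value : ∀ {p s} → p * D zero e + s ≈ 0# → p ≈ - (y * s)
      pivot-value {p} {s} eq = begin
        p ≈⟨ solve 1 (λ p → p := p :* :1) refl p ⟩
        p * 1# ≈⟨ *-congˡ Dy≈1 ⟨
        p * (D zero e * y) ≈⟨ solve 4 (λ p d y s → p :* (d :* y) := y :* (p :* d :+ s) :- y :* s) refl p (D zero e) y s ⟩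
        y * (p * D zero e + s) - y * s ≈⟨ +-congʳ (trans (*-congˡ eq) (zeroʳ y)) ⟩
        0# - y * s ≈⟨ +-identityˡ _ ⟩
        - (y * s) ∎

      pivot-solves : ∀ s → - (y * s) * D zero e + s ≈ 0#
      pivot-solves s = begin
        - (y * s) * D zero e + s ≈⟨ solve 3 (λ y s d → :- (y :* s) :* d :+ s := s :- (d :* y) :* s) refl y s (D zero e) ⟩
        s - D zero e * y * s ≈⟨ +-congˡ (-‿cong (*-congʳ Dy≈1)) ⟩
        s - 1# * s ≈⟨ solve 1 (λ s → s :- :1 :* s := :0) refl s ⟩
        0# ∎

    columns : ∀ {k} → KernelBasis reduced k → KernelBasis D k
    columns {k} B = record
      { free = punchIn e ∘ free B
      ; vector = vector′
      ; dual = λ t s → trans (reflexive (insertAt-punchIn (vector B t) e _ (free B s))) (dual B t s)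
      ; in-kernel = λ t x → trans (sum-insertAt (vector B t) e (value t) (D x)) (kernel t x)
      ; unique = unique′ }
      where
      S₀ : (Fin m → Carrier) → Carrier
      S₀ a = sumR m (λ f → a f * D zero (punchIn e f))
      value : Fin k → Carrier
      value t = - (y * S₀ (vector B t))
      vector′ : Fin k → Fin (suc m) → Carrier
      vector′ t = insertAt (vector B t) e (value t)
      kernel : ∀ t x → value t * D x e + sumR m (λ f → vector B t f * D x (punchIn e f)) ≈ 0#
      kernel t zero    = pivot-solves (S₀ (vector B t))
      kernel t (suc b) = begin
        - (y * S₀ (vector B t)) * D (suc b) e + sumR m (λ f → vector B t f * D (suc b) (punchIn e f))
          ≈⟨ solve 4 (λ y s d z → :- (y :* s) :* d :+ z := z :- d :* y :* s) refl y (S₀ (vector B t)) (D (suc b) e) (sumR m (λ f → vector B t f * D (suc b) (punchIn e f))) ⟩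
        sumR m (λ f → vector B t f * D (suc b) (punchIn e f)) - D (suc b) e * y * S₀ (vector B t)
          ≈⟨ sum-reduced-columns b (vector B t) ⟨
        sumR m (λ f → vector B t f * reduced b f)
          ≈⟨ in-kernel B t b ⟩
        0# ∎
      unique′ : ∀ (a : Fin (suc m) → Carrier) → (∀ x → sumR (suc m) (λ j → a j * D x j) ≈ 0#) → (∀ t → a (punchIn e (free B t)) ≈ 0#) → ∀ j → a j ≈ 0#
      unique′ a Da≈0 a≈0 = punchIn-elim (λ j → a j ≈ 0#) e aₑ≈0 a′≈0
        where
        a′ : Fin m → Carrier
        a′ f = a (punchIn e f)
        split : ∀ x → a e * D x e + sumR m (λ f → a′ f * D x (punchIn e f)) ≈ 0#
        split x = trans (sym (sum-remove e (λ j → a j * D x j))) (Da≈0 x)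
        aₑ : a e ≈ - (y * S₀ a′)
        aₑ = pivot-value (split zero)
        a′≈0 : ∀ f → a′ f ≈ 0#
        a′≈0 = unique B a′ (λ b → begin
          sumR m (λ f → a′ f * reduced b f)
            ≈⟨ sum-reduced-columns b a′ ⟩
          sumR m (λ f → a′ f * D (suc b) (punchIn e f)) - D (suc b) e * y * S₀ a′
            ≈⟨ solve 4 (λ s d y z → s :- d :* y :* z := :- (y :* z) :* d :+ s) refl (sumR m (λ f → a′ f * D (suc b) (punchIn e f))) (D (suc b) e) y (S₀ a′) ⟩
          - (y * S₀ a′) * D (suc b) e + sumR m (λ f → a′ f * D (suc b) (punchIn e f))
            ≈⟨ trans (+-congʳ (*-congʳ (sym aₑ))) (split (suc b)) ⟩
          0# ∎) a≈0
        aₑ≈0 : a e ≈ 0#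
        aₑ≈0 = trans aₑ (trans (-‿cong (*-congˡ (sum-0 (λ f → trans (*-congʳ (a′≈0 f)) (zeroˡ _))))) (solve 1 (λ y → :- (y :* :0) := :0) refl y))

    -- The unknown of row 0 is solved from the equation of column `e`. Here and in `columns` the
    -- pivot takes away one unknown and one equation, so both nullities persist.
    rows : ∀ {l} → KernelBasis (transpose reduced) l → KernelBasis (transpose D) l
    rows {l} B = record
      { free = suc ∘ free B
      ; vector = vector′
      ; dual = dual B
      ; in-kernel = λ t → punchIn-elim (λ j → vector′ t zero * D zero j + sumR n (λ b → vector B t b * D (suc b) j) ≈ 0#) e
          (pivot-solves (Sₑ (vector B t))) (λ f → begin
            - (y * Sₑ (vector B t)) * D zero (punchIn e f) + sumR n (λ b → vector B t b * D (suc b) (punchIn e f))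
              ≈⟨ solve 4 (λ y s d z → :- (y :* s) :* d :+ z := z :- s :* (y :* d)) refl y (Sₑ (vector B t)) (D zero (punchIn e f)) (sumR n (λ b → vector B t b * D (suc b) (punchIn e f))) ⟩
            sumR n (λ b → vector B t b * D (suc b) (punchIn e f)) - Sₑ (vector B t) * (y * D zero (punchIn e f))
              ≈⟨ sum-reduced-rows f (vector B t) ⟨
            sumR n (λ b → vector B t b * reduced b f)
              ≈⟨ in-kernel B t f ⟩
            0# ∎)
      ; unique = unique′ }
      where
      Sₑ : (Fin n → Carrier) → Carrier
      Sₑ w = sumR n (λ b → w b * D (suc b) e)
      vector′ : Fin l → Fin (suc n) → Carrier
      vector′ t zero    = - (y * Sₑ (vector B t))
      vector′ t (suc b) = vector B t b
      unique′ : ∀ (w : Fin (suc n) → Carrier) → (∀ j → sumR (suc n) (λ x → w x * D x j) ≈ 0#) → (∀ t → w (suc (free B t)) ≈ 0#) → ∀ x → w x ≈ 0#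
      unique′ w wD≈0 w≈0 = λ { zero → w₀≈0 ; (suc b) → w′≈0 b }
        where
        w′ : Fin n → Carrier
        w′ b = w (suc b)
        w₀ : w zero ≈ - (y * Sₑ w′)
        w₀ = pivot-value (wD≈0 e)
        w′≈0 : ∀ b → w′ b ≈ 0#
        w′≈0 = unique B w′ (λ f → begin
          sumR n (λ b → w′ b * reduced b f)
            ≈⟨ sum-reduced-rows f w′ ⟩
          sumR n (λ b → w′ b * D (suc b) (punchIn e f)) - Sₑ w′ * (y * D zero (punchIn e f))
            ≈⟨ solve 4 (λ z s y d → z :- s :* (y :* d) := :- (y :* s) :* d :+ z) refl (sumR n (λ b → w′ b * D (suc b) (punchIn e f))) (Sₑ w′) y (D zero (punchIn e f)) ⟩
          - (y * Sₑ w′) * D zero (punchIn e f) + sumR n (λ b → w′ b * D (suc b) (punchIn e f))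
            ≈⟨ trans (+-congʳ (*-congʳ (sym w₀))) (wD≈0 (punchIn e f)) ⟩
          0# ∎) w≈0
        w₀≈0 : w zero ≈ 0#
        w₀≈0 = trans w₀ (trans (-‿cong (*-congˡ (sum-0 (λ b → trans (*-congʳ (w′≈0 b)) (zeroˡ _))))) (solve 1 (λ y → :- (y :* :0) := :0) refl y))

  module _ {κ : Level} (K : DecidableSubfield R κ) where
    open DecidableSubfield K

    -- The equation k + n ≡ l + m says that row rank and column rank agree.
    eliminate : ∀ n m (D : Fin n → Fin m → Carrier) → (∀ x e → Member (D x e)) →
      ∃₂ λ k l → k ℕ.+ n ≡ l ℕ.+ m × KernelBasis D k × KernelBasis (transpose D) l
    eliminate zero    m D D∈K = m , 0 , ℕₚ.+-identityʳ m , noEquations D , noUnknowns (transpose D)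
    eliminate (suc n) m D D∈K with all-or-some (λ e → invert (D∈K zero e))
    eliminate (suc n) m D D∈K | inj₁ D₀≈0 =
      let k , l , k+n≡l+m , columns , rows = eliminate n m (D ∘ suc) (D∈K ∘ suc)
      in k , suc l , ≡.trans (ℕₚ.+-suc k n) (≡.cong suc k+n≡l+m) , ZeroRow.columns D D₀≈0 columns , ZeroRow.rows D D₀≈0 rows
    eliminate (suc n) (suc m) D D∈K | inj₂ (e , y , y∈K , Dy≈1) =
      let k , l , k+n≡l+m , columns , rows = eliminate n m (Pivot.reduced D e y Dy≈1)
            (λ b f → D∈K (suc b) (punchIn e f) +-mem neg-mem (D∈K (suc b) e *-mem (y∈K *-mem D∈K zero (punchIn e f))))
      in k , l , ≡.trans (ℕₚ.+-suc k n) (≡.trans (≡.cong suc k+n≡l+m) (≡.sym (ℕₚ.+-suc l m))) , Pivot.columns D e y Dy≈1 columns , Pivot.rows D e y Dy≈1 rows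

-- The signed incidence matrix and its left kernel.

module Incidence {c ℓ : Level} (R : CommutativeRing c ℓ) (G : Graph) (s : CommutativeRing.Carrier R) where
  open Sums R
  open Elimination R
  open KernelBasis

  src tgt : Fin (nE G) → Fin (nV G)
  src e = proj₁ (ends G e)
  tgt e = proj₂ (ends G e)

  -- A self-loop has the entry 1 - s at its node: 0 for s = 1, but 2 for s = -1, where a loop indeed
  -- obstructs a two-colouring.
  incidence : Fin (nV G) → Fin (nE G) → Carrier
  incidence x e = δ (src e) x - s * δ (tgt e) x

  Potential : (Fin (nV G) → Carrier) → Set ℓ
  Potential w = ∀ e → w (src e) ≈ s * w (tgt e)

  gradient : ∀ w e → sumR (nV G) (λ x → w x * incidence x e) ≈ w (src e) - s * w (tgt e)
  gradient w e = begin
    sumR (nV G) (λ x → w x * (δ (src e) x - s * δ (tgt e) x))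
      ≈⟨ sum-cong (λ x → solve 4 (λ w d s d′ → w :* (d :- s :* d′) := d :* w :- s :* (d′ :* w)) refl (w x) (δ (src e) x) s (δ (tgt e) x)) ⟩
    sumR (nV G) (λ x → δ (src e) x * w x - s * (δ (tgt e) x * w x))
      ≈⟨ sum-minus (λ x → δ (src e) x * w x) (λ x → s * (δ (tgt e) x * w x)) ⟩
    sumR (nV G) (λ x → δ (src e) x * w x) - sumR (nV G) (λ x → s * (δ (tgt e) x * w x))
      ≈⟨ +-cong (sum-δ (src e) w) (-‿cong (trans (sum-*ˡ s (λ x → δ (tgt e) x * w x)) (*-congˡ (sum-δ (tgt e) w)))) ⟩
    w (src e) - s * w (tgt e) ∎

  kernel⇒potential : ∀ w → (∀ e → sumR (nV G) (λ x → w x * incidence x e) ≈ 0#) → Potential w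
  kernel⇒potential w ker e = begin
    w (src e) ≈⟨ solve 2 (λ a b → a := a :- b :+ b) refl (w (src e)) (s * w (tgt e)) ⟩
    w (src e) - s * w (tgt e) + s * w (tgt e) ≈⟨ +-congʳ (trans (sym (gradient w e)) (ker e)) ⟩
    0# + s * w (tgt e) ≈⟨ +-identityˡ _ ⟩
    s * w (tgt e) ∎

  potential⇒kernel : ∀ w → Potential w → ∀ e → sumR (nV G) (λ x → w x * incidence x e) ≈ 0#
  potential⇒kernel w pot e = trans (gradient w e) (trans (+-congʳ (pot e)) (-‿inverseʳ _))

  module _ (s²≈1 : s * s ≈ 1#) where
    -- Because s is its own inverse, the relation along an edge does not depend on its orientation.
    potential-joins : ∀ w → Potential w → ∀ {e u v} → Joins G e u v → w v ≈ s * w u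
    potential-joins w pot {e} {u} {v} (inj₂ eq) with ends G e | pot e
    potential-joins w pot (inj₂ ≡.refl) | _ | p = p
    potential-joins w pot {e} {u} {v} (inj₁ eq) with ends G e | pot e
    potential-joins w pot {e} {u} {v} (inj₁ ≡.refl) | _ | p = begin
      w v ≈⟨ *-identityˡ _ ⟨
      1# * w v ≈⟨ *-congʳ s²≈1 ⟨
      s * s * w v ≈⟨ *-assoc _ _ _ ⟩
      s * (s * w v) ≈⟨ *-congˡ p ⟨
      s * w u ∎

    potential-zero : ∀ w → Potential w → ∀ {S u v} → Reach G S u v → w u ≈ 0# → w v ≈ 0#
    potential-zero w pot here                  w≈0 = w≈0
    potential-zero w pot (step e _ e∈ reach)   w≈0 =
      trans (potential-joins w pot {e} e∈) (trans (*-congˡ (potential-zero w pot reach w≈0)) (zeroʳ s))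

    -- With two free nodes, the second basis vector would be 0 at the first of them and 1 at the
    -- second, but zero propagates along a path between them.
    nullity≤1 : Connected G → ¬ (1# ≈ 0#) → ∀ {l} → KernelBasis (transpose incidence) l → l ℕ.≤ 1
    nullity≤1 conn 1≉0 {zero}        B = ℕ.z≤n
    nullity≤1 conn 1≉0 {suc zero}    B = ℕ.s≤s ℕ.z≤n
    nullity≤1 conn 1≉0 {suc (suc l)} B = contradiction
      (trans (sym (trans (dual B one one) (δ-refl one)))
        (potential-zero w (kernel⇒potential w (in-kernel B one)) (conn (free B zero) (free B one)) (trans (dual B one zero) (δ-≢ {i = one} {zero} λ ()))))
      1≉0
      where
      one : Fin (suc (suc l))
      one = suc zero
      w = vector B one

    nullity≥1 : ∀ {l} → KernelBasis (transpose incidence) l → ∀ χ → Potential χ → (∃ λ x → ¬ (χ x ≈ 0#)) → 1 ℕ.≤ l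
    nullity≥1 {zero}  B χ pot (x , χ≉0) = contradiction (unique B χ (potential⇒kernel χ pot) (λ ()) x) χ≉0
    nullity≥1 {suc l} B χ pot _         = ℕ.s≤s ℕ.z≤n

-- The cycle space over GF(2).

-- Over GF(2) a cycle is an element of the kernel of the incidence matrix, without any choice of orientation.
module GF2Cycles where
  private
    GF2 : CommutativeRing 0ℓ 0ℓ
    GF2 = Boolₚ.xor-∧-commutativeRing

  open Sums GF2
  open Elimination GF2
  open KernelBasis

  everything : DecidableSubfield GF2 0ℓ
  everything = record
    { Member = λ _ → ⊤ ; _+-mem_ = λ _ _ → tt ; _*-mem_ = λ _ _ → tt ; neg-mem = λ _ → tt
    ; invert = λ { {false} _ → inj₁ ≡.refl ; {true} _ → inj₂ (true , tt , ≡.refl) } }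

  -- Into GF(2), `natR` takes the parity, and minus is plus there, so a self-loop counts 2 = 0 on
  -- both sides.
  natR-degIn : ∀ (G : Graph) S v → natR (degIn G S v) ≈ sumR (nE G) (λ e → S e * Incidence.incidence GF2 G 1# v e)
  natR-degIn G S v = ≡.trans (natR-sum {nE G} _) (sum-cong entry)
    where
    entry : ∀ e → natR (if S e then ind (does (proj₁ (ends G e) Fin.≟ v)) ℕ.+ ind (does (proj₂ (ends G e) Fin.≟ v)) else 0)
              ≈ S e * Incidence.incidence GF2 G 1# v e
    entry e with S e
    ... | false = ≡.refl
    ... | true  = ≡.trans (natR-+ (ind (does (proj₁ (ends G e) Fin.≟ v))) _)
                    (≡.cong₂ _xor_ (natR-ind (proj₁ (ends G e) Fin.≟ v)) (natR-ind (proj₂ (ends G e) Fin.≟ v)))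

  cycle-in-kernel : ∀ G S → IsCycle G S → ∀ v → sumR (nE G) (λ e → S e * Incidence.incidence GF2 G 1# v e) ≈ 0#
  cycle-in-kernel G S (_ , degrees , _) v = ≡.trans (≡.sym (natR-degIn G S v)) (even (degIn G S v) (degrees v))
    where
    even : ∀ d → d ≡ 0 ⊎ d ≡ 2 → natR d ≈ 0#
    even _ (inj₁ ≡.refl) = ≡.refl
    even _ (inj₂ ≡.refl) = ≡.refl

  -- Connectedness gives l = 1, so the cycle space has dimension k = m - n + 1, and n < m says k ≥
  -- 2. Dimension 0 or 1 leaves room for at most one nonzero element over GF(2).
  cycles⇒nV<nE : ∀ G → Connected G → AtLeastTwoCycles G → nV G ℕ.< nE G
  cycles⇒nV<nE G conn (S , S′ , S-cycle@((e₁ , e₁∈S) , _) , S′-cycle@((e₂ , e₂∈S′) , _) , e , S≢S′)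
    with eliminate everything (nV G) (nE G) (Incidence.incidence GF2 G 1#) (λ _ _ → tt)
  ... | k , l , k+n≡l+m , columns , rows = bound k k+n≡l+m columns
    where
    l≡1 : l ≡ 1
    l≡1 = ℕₚ.≤-antisym (Incidence.nullity≤1 GF2 G 1# ≡.refl conn (λ ()) rows)
      (Incidence.nullity≥1 GF2 G 1# ≡.refl rows (λ _ → 1#) (λ _ → ≡.refl) (proj₁ (ends G e₁) , λ ()))
    S+S′ : Fin (nE G) → Bool
    S+S′ e = S e xor S′ e
    S+S′∈ker : ∀ v → sumR (nE G) (λ e → S+S′ e * Incidence.incidence GF2 G 1# v e) ≈ 0#
    S+S′∈ker v = ≡.trans (sum-cong (λ e → distribʳ (Incidence.incidence GF2 G 1# v e) (S e) (S′ e)))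
      (≡.trans (sum-+ (λ e → S e * Incidence.incidence GF2 G 1# v e) (λ e → S′ e * Incidence.incidence GF2 G 1# v e))
        (≡.cong₂ _xor_ (cycle-in-kernel G S S-cycle v) (cycle-in-kernel G S′ S′-cycle v)))
    bound : ∀ k → k ℕ.+ nV G ≡ l ℕ.+ nE G → KernelBasis (Incidence.incidence GF2 G 1#) k → nV G ℕ.< nE G
    bound zero _ B = contradiction (≡.trans (≡.sym e₁∈S) (unique B S (cycle-in-kernel G S S-cycle) (λ ()) e₁)) λ ()
    bound (suc zero) _ B with S (free B zero) in eq | S′ (free B zero) in eq′
    ... | false | _     = contradiction (≡.trans (≡.sym e₁∈S) (unique B S (cycle-in-kernel G S S-cycle) (λ { zero → eq }) e₁)) λ ()
    ... | true  | false = contradiction (≡.trans (≡.sym e₂∈S′) (unique B S′ (cycle-in-kernel G S′ S′-cycle) (λ { zero → eq′ }) e₂)) λ ()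
    -- Both cycles have the free coordinate 1; their sum has 0 there and hence vanishes, so they
    -- coincide.
    ... | true  | true  = contradiction (agree (S e) (S′ e) (unique B S+S′ S+S′∈ker (λ { zero → ≡.cong₂ _xor_ eq eq′ }) e)) S≢S′
      where
      agree : ∀ a b → a xor b ≡ false → a ≡ b
      agree false false _ = ≡.refl
      agree true  true  _ = ≡.refl
    bound (suc (suc k)) k+n≡l+m B =
      ≡.subst (nV G ℕ.<_) (ℕₚ.suc-injective (≡.trans k+n≡l+m (≡.cong (ℕ._+ nE G) l≡1))) (ℕ.s≤s (ℕₚ.m≤n+m (nV G) k))

-- The rational numbers inside a field of characteristic 0.

module PrimeField {c ℓ : Level} (F : CommutativeRing c ℓ) (isField : LinAlg.IsField F) (charZero : LinAlg.CharZero F) where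
  open Sums F
  open Independence F isField

  natR-cancel : ∀ k {x} → natR (suc k) * x ≈ 0# → x ≈ 0#
  natR-cancel k = nonzero-cancel (charZero k)

  -- x = (b - a) / (d + 1), written without subtraction: whether x is zero, and its sign otherwise,
  -- is decided by comparing the natural numbers `a` and `b`.
  IsRational : Carrier → Set ℓ
  IsRational x = Σ ℕ λ a → Σ ℕ λ b → Σ ℕ λ d → natR (suc d) * x + natR a ≈ natR b

  0-rational : IsRational 0#
  0-rational = 0 , 0 , 0 , solve 0 ((:1 :+ :0) :* :0 :+ :0 := :0) refl

  1-rational : IsRational 1#
  1-rational = 0 , 1 , 0 , solve 0 ((:1 :+ :0) :* :1 :+ :0 := :1 :+ :0) refl

  neg-rational : ∀ {x} → IsRational x → IsRational (- x)
  neg-rational {x} (a , b , d , eq) = b , a , d , (begin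
    natR (suc d) * - x + natR b ≈⟨ +-congˡ eq ⟨
    natR (suc d) * - x + (natR (suc d) * x + natR a) ≈⟨ solve 3 (λ d x a → d :* :- x :+ (d :* x :+ a) := a) refl (natR (suc d)) x (natR a) ⟩
    natR a ∎)

  +-rational : ∀ {x y} → IsRational x → IsRational y → IsRational (x + y)
  +-rational {x} {y} (a , b , d , eq) (a′ , b′ , d′ , eq′) =
    -- For the last component, `suc (d′ + d * suc d′)` is `suc d * suc d′` by computation.
    suc d′ ℕ.* a ℕ.+ suc d ℕ.* a′ , suc d′ ℕ.* b ℕ.+ suc d ℕ.* b′ , d′ ℕ.+ d ℕ.* suc d′ , (begin
    natR (suc d ℕ.* suc d′) * (x + y) + natR (suc d′ ℕ.* a ℕ.+ suc d ℕ.* a′)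
      ≈⟨ +-cong (*-congʳ (natR-* (suc d) (suc d′))) (expand a a′) ⟩
    natR (suc d) * natR (suc d′) * (x + y) + (natR (suc d′) * natR a + natR (suc d) * natR a′)
      ≈⟨ solve 6 (λ d d′ x y a a′ → d :* d′ :* (x :+ y) :+ (d′ :* a :+ d :* a′) := d′ :* (d :* x :+ a) :+ d :* (d′ :* y :+ a′)) refl
           (natR (suc d)) (natR (suc d′)) x y (natR a) (natR a′) ⟩
    natR (suc d′) * (natR (suc d) * x + natR a) + natR (suc d) * (natR (suc d′) * y + natR a′)
      ≈⟨ +-cong (*-congˡ eq) (*-congˡ eq′) ⟩
    natR (suc d′) * natR b + natR (suc d) * natR b′
      ≈⟨ expand b b′ ⟨
    natR (suc d′ ℕ.* b ℕ.+ suc d ℕ.* b′) ∎)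
    where
    expand : ∀ a a′ → natR (suc d′ ℕ.* a ℕ.+ suc d ℕ.* a′) ≈ natR (suc d′) * natR a + natR (suc d) * natR a′
    expand a a′ = trans (natR-+ (suc d′ ℕ.* a) (suc d ℕ.* a′)) (+-cong (natR-* (suc d′) a) (natR-* (suc d) a′))

  *-rational : ∀ {x y} → IsRational x → IsRational y → IsRational (x * y)
  *-rational {x} {y} (a , b , d , eq) (a′ , b′ , d′ , eq′) =
    a ℕ.* b′ ℕ.+ b ℕ.* a′ , b ℕ.* b′ ℕ.+ a ℕ.* a′ , d′ ℕ.+ d ℕ.* suc d′ , (begin
    natR (suc d ℕ.* suc d′) * (x * y) + natR (a ℕ.* b′ ℕ.+ b ℕ.* a′)
      ≈⟨ +-cong (*-congʳ (natR-* (suc d) (suc d′))) (trans (expand a b′ b a′) (+-cong (*-congˡ (sym eq′)) (*-congʳ (sym eq)))) ⟩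
    natR (suc d) * natR (suc d′) * (x * y) + (natR a * (natR (suc d′) * y + natR a′) + (natR (suc d) * x + natR a) * natR a′)
      ≈⟨ solve 6 (λ d d′ x y a a′ → d :* d′ :* (x :* y) :+ (a :* (d′ :* y :+ a′) :+ (d :* x :+ a) :* a′) := (d :* x :+ a) :* (d′ :* y :+ a′) :+ a :* a′) refl
           (natR (suc d)) (natR (suc d′)) x y (natR a) (natR a′) ⟩
    (natR (suc d) * x + natR a) * (natR (suc d′) * y + natR a′) + natR a * natR a′
      ≈⟨ +-congʳ (*-cong eq eq′) ⟩
    natR b * natR b′ + natR a * natR a′
      ≈⟨ expand b b′ a a′ ⟨
    natR (b ℕ.* b′ ℕ.+ a ℕ.* a′) ∎)
    where
    expand : ∀ a b c d → natR (a ℕ.* b ℕ.+ c ℕ.* d) ≈ natR a * natR b + natR c * natR d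
    expand a b c d = trans (natR-+ (a ℕ.* b) (c ℕ.* d)) (+-cong (natR-* a b) (natR-* c d))

  private
    -- The inverse comes from the field; the second equation then shows that it is rational.
    nonzero-inverse : ∀ d {x e} → natR (suc d) * x ≈ e → ¬ (e ≈ 0#) → ∃ λ y → x * y ≈ 1# × e * y ≈ natR (suc d)
    nonzero-inverse d {x} {e} eq e≉0 =
      let y , xy≈1 = proj₂ isField x (λ x≈0 → e≉0 (trans (sym eq) (trans (*-congˡ x≈0) (zeroʳ _))))
      in y , xy≈1 , (begin
        e * y ≈⟨ *-congʳ eq ⟨
        natR (suc d) * x * y ≈⟨ *-assoc _ _ _ ⟩
        natR (suc d) * (x * y) ≈⟨ *-congˡ xy≈1 ⟩
        natR (suc d) * 1# ≈⟨ *-identityʳ _ ⟩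
        natR (suc d) ∎)

    difference-zero : ∀ a {z} → z + natR a ≈ natR a → z ≈ 0#
    difference-zero a {z} eq = begin
      z ≈⟨ solve 2 (λ z a → z := z :+ a :- a) refl z (natR a) ⟩
      z + natR a - natR a ≈⟨ +-congʳ eq ⟩
      natR a - natR a ≈⟨ -‿inverseʳ _ ⟩
      0# ∎

    difference-positive : ∀ a k {z} → z + natR a ≈ natR (suc (a ℕ.+ k)) → z ≈ natR (suc k)
    difference-positive a k {z} eq = begin
      z ≈⟨ solve 2 (λ z a → z := z :+ a :- a) refl z (natR a) ⟩
      z + natR a - natR a ≈⟨ +-congʳ (trans eq (+-congˡ (natR-+ a k))) ⟩
      1# + (natR a + natR k) - natR a ≈⟨ solve 2 (λ a k → :1 :+ (a :+ k) :- a := :1 :+ k) refl (natR a) (natR k) ⟩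
      natR (suc k) ∎

    difference-negative : ∀ b k {z} → z + natR (suc (b ℕ.+ k)) ≈ natR b → z ≈ - natR (suc k)
    difference-negative b k {z} eq = begin
      z ≈⟨ solve 3 (λ z b k → z := z :+ (:1 :+ (b :+ k)) :- b :- (:1 :+ k)) refl z (natR b) (natR k) ⟩
      z + (1# + (natR b + natR k)) - natR b - natR (suc k) ≈⟨ +-congʳ (+-congʳ (trans (+-congˡ (+-congˡ (sym (natR-+ b k)))) eq)) ⟩
      natR b - natR b - natR (suc k) ≈⟨ solve 2 (λ b k → b :- b :- k := :- k) refl (natR b) (natR (suc k)) ⟩
      - natR (suc k) ∎

    natR-suc-negative : ∀ k → ¬ (- natR (suc k) ≈ 0#)
    natR-suc-negative k -k≈0 = charZero k (trans (solve 1 (λ x → x := :- :- x) refl (natR (suc k))) (trans (-‿cong -k≈0) (solve 0 (:- :0 := :0) refl)))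

    invert-positive : ∀ d k {x} → natR (suc d) * x ≈ natR (suc k) → ∃ λ y → IsRational y × x * y ≈ 1#
    invert-positive d k {x} eq =
      let y , xy≈1 , ky≈d = nonzero-inverse d eq (charZero k)
      in y , (0 , suc d , k , trans (+-identityʳ _) ky≈d) , xy≈1

    invert-negative : ∀ d k {x} → natR (suc d) * x ≈ - natR (suc k) → ∃ λ y → IsRational y × x * y ≈ 1#
    invert-negative d k {x} eq =
      let y , xy≈1 , ky≈d = nonzero-inverse d eq (natR-suc-negative k)
      in y , (suc d , 0 , k , trans (+-congˡ (sym ky≈d)) (solve 2 (λ k y → k :* y :+ :- k :* y := :0) refl (natR (suc k)) y)) , xy≈1

  invert-rational : ∀ {x} → IsRational x → x ≈ 0# ⊎ ∃ λ y → IsRational y × x * y ≈ 1#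
  invert-rational (a , b , d , eq) with ℕ.compare a b
  ... | ℕ.equal a     = inj₁ (natR-cancel d (difference-zero a eq))
  ... | ℕ.less a k    = inj₂ (invert-positive d k (difference-positive a k eq))
  ... | ℕ.greater b k = inj₂ (invert-negative d k (difference-negative b k eq))

  rationals : DecidableSubfield F ℓ
  rationals = record
    { Member = IsRational ; _+-mem_ = +-rational ; _*-mem_ = *-rational ; neg-mem = neg-rational ; invert = invert-rational }

-- Harmonic functions and the star-mesh transform.

sumℕ≡0 : ∀ {n} (f : Fin n → ℕ) → sumℕ n f ≡ 0 → ∀ i → f i ≡ 0
sumℕ≡0 f eq zero    = ℕₚ.m+n≡0⇒m≡0 (f zero) eq
sumℕ≡0 f eq (suc i) = sumℕ≡0 (f ∘ suc) (ℕₚ.m+n≡0⇒n≡0 (f zero) eq) i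

sumℕ-cong : ∀ {n} {f g : Fin n → ℕ} → (∀ i → f i ≡ g i) → sumℕ n f ≡ sumℕ n g
sumℕ-cong {zero}  f≗g = ≡.refl
sumℕ-cong {suc n} f≗g = ≡.cong₂ ℕ._+_ (f≗g zero) (sumℕ-cong (f≗g ∘ suc))

-- Harmonic functions of a network with conductances w.  Positivity of the Laplacian is not available over F;
-- instead the star-mesh transform eliminates one node at a time and keeps the conductances natural numbers.
module Network {c ℓ : Level} (F : CommutativeRing c ℓ) (isField : LinAlg.IsField F) (charZero : LinAlg.CharZero F) where
  open Sums F
  open PrimeField F isField charZero using (natR-cancel)

  Harmonic : ∀ {n} → (Fin n → Fin n → ℕ) → (Fin n → Carrier) → Set ℓ
  Harmonic {n} w T = ∀ x → sumR n (λ y → natR (w x y) * (T x - T y)) ≈ 0#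

  Symmetric : ∀ {n} → (Fin n → Fin n → ℕ) → Set
  Symmetric w = ∀ x y → w x y ≡ w y x

  module Star {n} (w : Fin (suc n) → Fin (suc n) → ℕ) (T : Fin (suc n) → Carrier) (harm : Harmonic w T) where
    total : ℕ
    total = sumℕ n (λ y → w zero (suc y))

    -- The usual star-mesh conductance w x y + w x 0 · w 0 y / total, multiplied by `total` to stay
    -- in the natural numbers.
    mesh : Fin n → Fin n → ℕ
    mesh x y = total ℕ.* w (suc x) (suc y) ℕ.+ w (suc x) zero ℕ.* w zero (suc y)

    mesh-sym : Symmetric w → Symmetric mesh
    mesh-sym w-sym x y = ≡.cong₂ ℕ._+_ (≡.cong (total ℕ.*_) (w-sym (suc x) (suc y)))
      (≡.trans (≡.cong₂ ℕ._*_ (w-sym (suc x) zero) (w-sym zero (suc y))) (ℕₚ.*-comm (w zero (suc x)) (w (suc y) zero)))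

    star-sum : ∀ z → sumR n (λ y → natR (w zero (suc y)) * (z - T (suc y))) ≈ natR total * z - natR total * T zero
    star-sum z = begin
      sumR n (λ y → natR (w zero (suc y)) * (z - T (suc y)))
        ≈⟨ sum-cong (λ y → solve 4 (λ w z t t₀ → w :* (z :- t) := w :* (z :- t₀) :+ w :* (t₀ :- t)) refl (natR (w zero (suc y))) z (T (suc y)) (T zero)) ⟩
      sumR n (λ y → natR (w zero (suc y)) * (z - T zero) + natR (w zero (suc y)) * (T zero - T (suc y)))
        ≈⟨ sum-+ (λ y → natR (w zero (suc y)) * (z - T zero)) (λ y → natR (w zero (suc y)) * (T zero - T (suc y))) ⟩
      sumR n (λ y → natR (w zero (suc y)) * (z - T zero)) + sumR n (λ y → natR (w zero (suc y)) * (T zero - T (suc y)))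
        ≈⟨ +-cong (trans (sum-*ʳ (z - T zero) (λ y → natR (w zero (suc y)))) (*-congʳ (sym (natR-sum (λ y → w zero (suc y)))))) equation ⟩
      natR total * (z - T zero) + 0#
        ≈⟨ solve 3 (λ a z t → a :* (z :- t) :+ :0 := a :* z :- a :* t) refl (natR total) z (T zero) ⟩
      natR total * z - natR total * T zero ∎
      where
      equation : sumR n (λ y → natR (w zero (suc y)) * (T zero - T (suc y))) ≈ 0#
      equation = trans (solve 3 (λ a t r → r := a :* (t :- t) :+ r) refl (natR (w zero zero)) (T zero) _) (harm zero)

    mesh-harmonic : Harmonic mesh (T ∘ suc)
    mesh-harmonic x = begin
      sumR n (λ y → natR (mesh x y) * (T (suc x) - T (suc y)))
        ≈⟨ sum-cong (λ y → trans (*-congʳ (trans (natR-+ (total ℕ.* w (suc x) (suc y)) _) (+-cong (natR-* total _) (natR-* (w (suc x) zero) _))))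
             (solve 5 (λ W a b d t → (W :* a :+ b :* d) :* t := W :* (a :* t) :+ b :* (d :* t)) refl (natR total) (natR (w (suc x) (suc y))) (natR (w (suc x) zero)) (natR (w zero (suc y))) (T (suc x) - T (suc y)))) ⟩
      sumR n (λ y → natR total * (natR (w (suc x) (suc y)) * (T (suc x) - T (suc y))) + natR (w (suc x) zero) * (natR (w zero (suc y)) * (T (suc x) - T (suc y))))
        ≈⟨ sum-+ (λ y → natR total * (natR (w (suc x) (suc y)) * (T (suc x) - T (suc y)))) _ ⟩
      sumR n (λ y → natR total * (natR (w (suc x) (suc y)) * (T (suc x) - T (suc y)))) + sumR n (λ y → natR (w (suc x) zero) * (natR (w zero (suc y)) * (T (suc x) - T (suc y))))
        ≈⟨ +-cong (sum-*ˡ (natR total) (λ y → natR (w (suc x) (suc y)) * (T (suc x) - T (suc y))))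
                  (trans (sum-*ˡ (natR (w (suc x) zero)) (λ y → natR (w zero (suc y)) * (T (suc x) - T (suc y)))) (*-congˡ (star-sum (T (suc x))))) ⟩
      natR total * rest + natR (w (suc x) zero) * (natR total * T (suc x) - natR total * T zero)
        ≈⟨ solve 5 (λ W r a t t₀ → W :* r :+ a :* (W :* t :- W :* t₀) := W :* (a :* (t :- t₀) :+ r)) refl (natR total) rest (natR (w (suc x) zero)) (T (suc x)) (T zero) ⟩
      natR total * (natR (w (suc x) zero) * (T (suc x) - T zero) + rest)
        ≈⟨ trans (*-congˡ (harm (suc x))) (zeroʳ _) ⟩
      0# ∎
      where rest = sumR n (λ y → natR (w (suc x) (suc y)) * (T (suc x) - T (suc y)))

    isolated-harmonic : (∀ x → w (suc x) zero ≡ 0) → Harmonic (λ x y → w (suc x) (suc y)) (T ∘ suc)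
    isolated-harmonic w≡0 x = trans (trans (sym (+-identityˡ _)) (+-congʳ (sym (trans (*-congʳ (reflexive (≡.cong natR (w≡0 x)))) (zeroˡ _))))) (harm (suc x))

    -- Harmonicity makes `T zero` the weighted mean of the values at its neighbours, and the sum of
    -- the weights is invertible once it is nonzero.
    centre-equal : total ≢ 0 → ∀ z → (∀ y → w zero (suc y) ≢ 0 → T (suc y) ≈ z) → T zero ≈ z
    centre-equal total≢0 z equal = difference total total≢0 (begin
      natR total * z - natR total * T zero ≈⟨ star-sum z ⟨
      sumR n (λ y → natR (w zero (suc y)) * (z - T (suc y))) ≈⟨ sum-0 vanish ⟩
      0# ∎)
      where
      vanish : ∀ y → natR (w zero (suc y)) * (z - T (suc y)) ≈ 0#
      vanish y with w zero (suc y) ℕ.≟ 0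
      ... | yes w≡0 = trans (*-congʳ (reflexive (≡.cong natR w≡0))) (zeroˡ _)
      ... | no w≢0  = trans (*-congˡ (trans (+-congˡ (-‿cong (equal y w≢0))) (-‿inverseʳ z))) (zeroʳ _)
      difference : ∀ k → k ≢ 0 → natR k * z - natR k * T zero ≈ 0# → T zero ≈ z
      difference zero    k≢0 eq = contradiction ≡.refl k≢0
      difference (suc k) k≢0 eq = begin
        T zero ≈⟨ solve 2 (λ t z → t := z :- (z :- t)) refl (T zero) z ⟩
        z - (z - T zero) ≈⟨ +-congˡ (-‿cong (natR-cancel k (trans (solve 3 (λ k z t → k :* (z :- t) := k :* z :- k :* t) refl (natR (suc k)) z (T zero)) eq))) ⟩
        z - 0# ≈⟨ solve 1 (λ z → z :- :0 := z) refl z ⟩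
        z ∎

  -- Induction on the number of nodes. An isolated node 0 is dropped. Otherwise the mesh keeps the
  -- old edges, as `total` is nonzero, and joins all neighbours of 0 to one another; by induction
  -- these share one value, and node 0 takes it as their mean. The loop at 0 is left out of `total`,
  -- since its term is 0 anyway.
  harmonic-constant : ∀ {n} (w : Fin n → Fin n → ℕ) T → Symmetric w → Harmonic w T → ∀ x y → w x y ≢ 0 → T x ≈ T y
  harmonic-constant {suc n} w T w-sym harm with sumℕ n (λ y → w zero (suc y)) ℕ.≟ 0
  ... | yes total≡0 = λ
    { zero    zero    _   → refl
    ; zero    (suc y) w≢0 → contradiction (isolated y) w≢0
    ; (suc x) zero    w≢0 → contradiction (≡.trans (w-sym (suc x) zero) (isolated x)) w≢0
    ; (suc x) (suc y) w≢0 → harmonic-constant (λ x y → w (suc x) (suc y)) (T ∘ suc) (λ x y → w-sym (suc x) (suc y))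
                              (Star.isolated-harmonic w T harm (λ x → ≡.trans (w-sym (suc x) zero) (isolated x))) x y w≢0 }
    where
    isolated : ∀ y → w zero (suc y) ≡ 0
    isolated = sumℕ≡0 (λ y → w zero (suc y)) total≡0
  ... | no total≢0 = λ
    { zero    zero    _   → refl
    ; zero    (suc y) w≢0 → centre y w≢0
    ; (suc x) zero    w≢0 → sym (centre x (w≢0 ∘ ≡.trans (w-sym (suc x) zero)))
    ; (suc x) (suc y) w≢0 → mesh-constant x y λ mesh≡0 → nonzero-* total≢0 w≢0 (ℕₚ.m+n≡0⇒m≡0 _ mesh≡0) }
    where
    open Star w T harm
    nonzero-* : ∀ {a b} → a ≢ 0 → b ≢ 0 → a ℕ.* b ≢ 0
    nonzero-* {a} a≢0 b≢0 ab≡0 with ℕₚ.m*n≡0⇒m≡0∨n≡0 a ab≡0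
    ... | inj₁ a≡0 = a≢0 a≡0
    ... | inj₂ b≡0 = b≢0 b≡0
    mesh-constant : ∀ x y → mesh x y ≢ 0 → T (suc x) ≈ T (suc y)
    mesh-constant = harmonic-constant mesh (T ∘ suc) (mesh-sym w-sym) mesh-harmonic
    centre : ∀ y → w zero (suc y) ≢ 0 → T zero ≈ T (suc y)
    centre y w≢0 = centre-equal total≢0 (T (suc y)) λ x wx≢0 → mesh-constant x y λ mesh≡0 →
      nonzero-* (wx≢0 ∘ ≡.trans (w-sym zero (suc x))) w≢0 (ℕₚ.m+n≡0⇒n≡0 (total ℕ.* w (suc x) (suc y)) mesh≡0)

  sum-splitAt : ∀ m n (f : Fin m ⊎ Fin n → Carrier) →
    sumR (m ℕ.+ n) (λ k → f (splitAt m k)) ≈ sumR m (λ i → f (inj₁ i)) + sumR n (λ j → f (inj₂ j))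
  sum-splitAt m n f = trans (sum-split m n (λ k → f (splitAt m k)))
    (+-cong (sum-cong (λ i → reflexive (≡.cong f (Finₚ.splitAt-↑ˡ m i n)))) (sum-cong (λ j → reflexive (≡.cong f (Finₚ.splitAt-↑ʳ m n j)))))

  module _ (G : Graph) (s : Carrier) (s²≈1 : s * s ≈ 1#) where
    open Incidence F G s

    adjacent : Fin (nV G) → Fin (nV G) → Fin (nE G) → ℕ
    adjacent x y e = ind (does (src e Fin.≟ x)) ℕ.* ind (does (tgt e Fin.≟ y)) ℕ.+ ind (does (tgt e Fin.≟ x)) ℕ.* ind (does (src e Fin.≟ y))

    adjacency : Fin (nV G) → Fin (nV G) → ℕ
    adjacency x y = sumℕ (nE G) (adjacent x y)

    adjacency-sym : Symmetric adjacency
    adjacency-sym x y = sumℕ-cong λ e → ≡.trans (ℕₚ.+-comm (ind (does (src e Fin.≟ x)) ℕ.* ind (does (tgt e Fin.≟ y))) _)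
      (≡.cong₂ ℕ._+_ (ℕₚ.*-comm (ind (does (tgt e Fin.≟ x))) _) (ℕₚ.*-comm (ind (does (src e Fin.≟ x))) _))

    ind-refl : ∀ {n} (x : Fin n) → ind (does (x Fin.≟ x)) ≡ 1
    ind-refl x with x Fin.≟ x
    ... | yes _  = ≡.refl
    ... | no x≢x = contradiction ≡.refl x≢x

    adjacency-edge : ∀ e → adjacency (src e) (tgt e) ≢ 0
    adjacency-edge e eq = contradiction
      (≡.trans (≡.sym (≡.cong₂ ℕ._*_ (ind-refl (src e)) (ind-refl (tgt e))))
        (ℕₚ.m+n≡0⇒m≡0 (ind (does (src e Fin.≟ src e)) ℕ.* ind (does (tgt e Fin.≟ tgt e))) (sumℕ≡0 (adjacent (src e) (tgt e)) eq e)))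
      λ ()

    δ-replace : ∀ {n} (i j : Fin n) (f : Fin n → Carrier) → δ i j * f i ≈ δ i j * f j
    δ-replace i j f with i Fin.≟ j
    ... | yes ≡.refl = refl
    ... | no _       = trans (zeroˡ _) (sym (zeroˡ _))

    -- The right side is D Dᵀ S; s² = 1 makes the two ends of an edge enter symmetrically.
    laplacian : ∀ (S : Fin (nV G) → Carrier) x →
      sumR (nV G) (λ y → natR (adjacency x y) * (S x - s * S y)) ≈ sumR (nE G) (λ e → (S (src e) - s * S (tgt e)) * incidence x e)
    laplacian S x = begin
      sumR (nV G) (λ y → natR (adjacency x y) * (S x - s * S y))
        ≈⟨ sum-cong (λ y → trans (*-congʳ (natR-sum (adjacent x y))) (sym (sum-*ʳ (S x - s * S y) (λ e → natR (adjacent x y e))))) ⟩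
      sumR (nV G) (λ y → sumR (nE G) (λ e → natR (adjacent x y e) * (S x - s * S y)))
        ≈⟨ sum-swap (λ y e → natR (adjacent x y e) * (S x - s * S y)) ⟩
      sumR (nE G) (λ e → sumR (nV G) (λ y → natR (adjacent x y e) * (S x - s * S y)))
        ≈⟨ sum-cong (λ e → trans (sum-cong (entry e)) (trans
             (sum-+ (λ y → δ (tgt e) y * (δ (src e) x * (S x - s * S y))) (λ y → δ (src e) y * (δ (tgt e) x * (S x - s * S y))))
             (trans (+-cong (sum-δ (tgt e) (λ y → δ (src e) x * (S x - s * S y))) (sum-δ (src e) (λ y → δ (tgt e) x * (S x - s * S y)))) (collect e)))) ⟩
      sumR (nE G) (λ e → (S (src e) - s * S (tgt e)) * incidence x e) ∎
      where
      entry : ∀ e y → natR (adjacent x y e) * (S x - s * S y) ≈ δ (tgt e) y * (δ (src e) x * (S x - s * S y)) + δ (src e) y * (δ (tgt e) x * (S x - s * S y))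
      entry e y = trans (*-congʳ (trans (natR-+ (ind (does (src e Fin.≟ x)) ℕ.* ind (does (tgt e Fin.≟ y))) _)
          (+-cong (trans (natR-* (ind (does (src e Fin.≟ x))) _) (*-cong (natR-ind (src e Fin.≟ x)) (natR-ind (tgt e Fin.≟ y))))
                  (trans (natR-* (ind (does (tgt e Fin.≟ x))) _) (*-cong (natR-ind (tgt e Fin.≟ x)) (natR-ind (src e Fin.≟ y)))))))
        (solve 5 (λ a b d f z → (a :* b :+ d :* f) :* z := b :* (a :* z) :+ f :* (d :* z)) refl (δ (src e) x) (δ (tgt e) y) (δ (tgt e) x) (δ (src e) y) (S x - s * S y))
      collect : ∀ e → δ (src e) x * (S x - s * S (tgt e)) + δ (tgt e) x * (S x - s * S (src e)) ≈ (S (src e) - s * S (tgt e)) * incidence x e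
      collect e = begin
        δ (src e) x * (S x - s * S (tgt e)) + δ (tgt e) x * (S x - s * S (src e))
          ≈⟨ solve 6 (λ a b z s t u → a :* (z :- s :* t) :+ b :* (z :- s :* u) := a :* z :+ :1 :* (b :* z) :- (s :* (a :* t) :+ s :* (b :* u))) refl
               (δ (src e) x) (δ (tgt e) x) (S x) s (S (tgt e)) (S (src e)) ⟩
        δ (src e) x * S x + 1# * (δ (tgt e) x * S x) - (s * (δ (src e) x * S (tgt e)) + s * (δ (tgt e) x * S (src e)))
          ≈⟨ +-congʳ (+-cong (sym (δ-replace (src e) x S)) (*-cong (sym s²≈1) (sym (δ-replace (tgt e) x S)))) ⟩
        δ (src e) x * S (src e) + s * s * (δ (tgt e) x * S (tgt e)) - (s * (δ (src e) x * S (tgt e)) + s * (δ (tgt e) x * S (src e)))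
          ≈⟨ solve 5 (λ a b s t u → a :* u :+ s :* s :* (b :* t) :- (s :* (a :* t) :+ s :* (b :* u)) := (u :- s :* t) :* (a :- s :* b)) refl
               (δ (src e) x) (δ (tgt e) x) s (S (tgt e)) (S (src e)) ⟩
        (S (src e) - s * S (tgt e)) * incidence x e ∎

    -- On the double cover with nodes (x, +), (x, −) and values S x, s S x the signed Laplacian is an ordinary one.
    private
      Cover = Fin (nV G) ⊎ Fin (nV G)

      weight : Cover → Cover → ℕ
      weight (inj₁ x) (inj₂ y) = adjacency x y
      weight (inj₂ x) (inj₁ y) = adjacency x y
      weight _        _        = 0

      weight-sym : ∀ a b → weight a b ≡ weight b a
      weight-sym (inj₁ x) (inj₁ y) = ≡.refl
      weight-sym (inj₁ x) (inj₂ y) = adjacency-sym x y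
      weight-sym (inj₂ x) (inj₁ y) = adjacency-sym x y
      weight-sym (inj₂ x) (inj₂ y) = ≡.refl

      value : (Fin (nV G) → Carrier) → Cover → Carrier
      value S (inj₁ x) = S x
      value S (inj₂ x) = s * S x

      -- On the second sheet the equation is s times that on the first, again by s² = 1.
      cover-harmonic : ∀ S → (∀ x → sumR (nV G) (λ y → natR (adjacency x y) * (S x - s * S y)) ≈ 0#) → ∀ a →
        sumR (nV G) (λ y → natR (weight a (inj₁ y)) * (value S a - value S (inj₁ y))) +
        sumR (nV G) (λ y → natR (weight a (inj₂ y)) * (value S a - value S (inj₂ y))) ≈ 0#
      cover-harmonic S harm (inj₁ x) = trans (+-cong (sum-0 {nV G} (λ y → zeroˡ _)) (harm x)) (+-identityˡ 0#)
      cover-harmonic S harm (inj₂ x) = begin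
        sumR (nV G) (λ y → natR (adjacency x y) * (s * S x - S y)) + sumR (nV G) (λ y → 0# * (s * S x - s * S y))
          ≈⟨ +-cong (sum-cong (λ y → trans (*-congˡ (trans (+-congˡ (-‿cong (trans (sym (*-identityˡ _)) (*-congʳ (sym s²≈1))))) (solve 3 (λ s x y → s :* x :- s :* s :* y := s :* (x :- s :* y)) refl s (S x) (S y))))
               (solve 3 (λ a s z → a :* (s :* z) := s :* (a :* z)) refl (natR (adjacency x y)) s (S x - s * S y)))) (sum-0 {nV G} (λ y → zeroˡ _)) ⟩
        sumR (nV G) (λ y → s * (natR (adjacency x y) * (S x - s * S y))) + 0#
          ≈⟨ trans (+-identityʳ _) (trans (sum-*ˡ s (λ y → natR (adjacency x y) * (S x - s * S y))) (trans (*-congˡ (harm x)) (zeroʳ s))) ⟩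
        0# ∎

    -- In the cover, e joins (src e, +) to (tgt e, -), and equal values there are exactly the
    -- potential equation.
    harmonic⇒potential : ∀ S → (∀ x → sumR (nE G) (λ e → (S (src e) - s * S (tgt e)) * incidence x e) ≈ 0#) → Potential S
    harmonic⇒potential S harm e = begin
      S (src e) ≡⟨ ≡.cong (value S) (Finₚ.splitAt-↑ˡ (nV G) (src e) (nV G)) ⟨
      value S (splitAt (nV G) (src e ↑ˡ nV G))
        ≈⟨ harmonic-constant (λ z z′ → weight (splitAt (nV G) z) (splitAt (nV G) z′)) (λ z → value S (splitAt (nV G) z))
             (λ z z′ → weight-sym (splitAt (nV G) z) (splitAt (nV G) z′))
             (λ z → trans (sum-splitAt (nV G) (nV G) (λ b → natR (weight (splitAt (nV G) z) b) * (value S (splitAt (nV G) z) - value S b)))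
                      (cover-harmonic S (λ x → trans (laplacian S x) (harm x)) (splitAt (nV G) z)))
             (src e ↑ˡ nV G) (nV G ↑ʳ tgt e)
             (λ w≡0 → adjacency-edge e (≡.trans (≡.sym (≡.cong₂ weight (Finₚ.splitAt-↑ˡ (nV G) (src e) (nV G)) (Finₚ.splitAt-↑ʳ (nV G) (nV G) (tgt e)))) w≡0)) ⟩
      value S (splitAt (nV G) (nV G ↑ʳ tgt e)) ≡⟨ ≡.cong (value S) (Finₚ.splitAt-↑ʳ (nV G) (nV G) (tgt e)) ⟩
      s * S (tgt e) ∎

-- Darts and the non-backtracking operator.

module Darts (H : Graph) where
  fwd bwd : Fin (nE H) → Dart H
  fwd e = e ↑ˡ nE H
  bwd e = nE H ↑ʳ e

  dart-elim : ∀ {p} (P : Dart H → Set p) → (∀ e → P (fwd e)) → (∀ e → P (bwd e)) → ∀ d → P d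
  dart-elim P P-fwd P-bwd d with splitAt (nE H) d | Finₚ.join-splitAt (nE H) (nE H) d
  ... | inj₁ e | ≡.refl = P-fwd e
  ... | inj₂ e | ≡.refl = P-bwd e

  dTail-fwd : ∀ e → dTail H (fwd e) ≡ proj₁ (ends H e)
  dTail-fwd e rewrite Finₚ.splitAt-↑ˡ (nE H) e (nE H) = ≡.refl

  dTail-bwd : ∀ e → dTail H (bwd e) ≡ proj₂ (ends H e)
  dTail-bwd e rewrite Finₚ.splitAt-↑ʳ (nE H) (nE H) e = ≡.refl

  dHead-fwd : ∀ e → dHead H (fwd e) ≡ proj₂ (ends H e)
  dHead-fwd e rewrite Finₚ.splitAt-↑ˡ (nE H) e (nE H) = ≡.refl

  dHead-bwd : ∀ e → dHead H (bwd e) ≡ proj₁ (ends H e)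
  dHead-bwd e rewrite Finₚ.splitAt-↑ʳ (nE H) (nE H) e = ≡.refl

  dRev-fwd : ∀ e → dRev H (fwd e) ≡ bwd e
  dRev-fwd e rewrite Finₚ.splitAt-↑ˡ (nE H) e (nE H) = ≡.refl

  dRev-bwd : ∀ e → dRev H (bwd e) ≡ fwd e
  dRev-bwd e rewrite Finₚ.splitAt-↑ʳ (nE H) (nE H) e = ≡.refl

  dRev-involutive : ∀ d → dRev H (dRev H d) ≡ d
  dRev-involutive = dart-elim (λ d → dRev H (dRev H d) ≡ d)
    (λ e → ≡.trans (≡.cong (dRev H) (dRev-fwd e)) (dRev-bwd e))
    (λ e → ≡.trans (≡.cong (dRev H) (dRev-bwd e)) (dRev-fwd e))

  dHead-dRev : ∀ d → dHead H (dRev H d) ≡ dTail H d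
  dHead-dRev = dart-elim (λ d → dHead H (dRev H d) ≡ dTail H d)
    (λ e → ≡.trans (≡.cong (dHead H) (dRev-fwd e)) (≡.trans (dHead-bwd e) (≡.sym (dTail-fwd e))))
    (λ e → ≡.trans (≡.cong (dHead H) (dRev-bwd e)) (≡.trans (dHead-fwd e) (≡.sym (dTail-bwd e))))

  dTail-dRev : ∀ d → dTail H (dRev H d) ≡ dHead H d
  dTail-dRev d = ≡.trans (≡.sym (dHead-dRev (dRev H d))) (≡.cong (dHead H) (dRev-involutive d))

does-sym : ∀ {n} (i j : Fin n) → does (i Fin.≟ j) ≡ does (j Fin.≟ i)
does-sym i j with i Fin.≟ j | j Fin.≟ i
... | yes _   | yes _   = ≡.refl
... | no _    | no _    = ≡.refl
... | yes i≡j | no j≢i  = contradiction (≡.sym i≡j) j≢i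
... | no i≢j  | yes j≡i = contradiction (≡.sym j≡i) i≢j

module NonBacktracking {c ℓ : Level} (R : CommutativeRing c ℓ) (H : Graph) where
  open Sums R
  open Darts H public

  apply : (Dart H → Carrier) → Dart H → Carrier
  apply u k = sumR (nD H) (λ i → NB H k i * u i)

  headSum : (Dart H → Carrier) → Fin (nV H) → Carrier
  headSum u x = sumR (nD H) (λ i → δ (dHead H i) x * u i)

  -- The reverse of k always ends at the tail of k, so excluding it from the darts that end there is
  -- a subtraction.
  NB-entry : ∀ k i → NB H k i ≈ δ (dHead H i) (dTail H k) - δ (dRev H k) i
  NB-entry k i with dHead H i Fin.≟ dTail H k | k Fin.≟ dRev H i | dRev H k Fin.≟ i
  ... | yes _ | yes _   | yes _   = sym (-‿inverseʳ 1#)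
  ... | yes _ | no _    | no _    = solve 0 (:1 := :1 :- :0) refl
  ... | no _  | _       | no _    = solve 0 (:0 := :0 :- :0) refl
  ... | yes _ | yes k≡  | no rk≢i = contradiction (≡.trans (≡.cong (dRev H) k≡) (dRev-involutive i)) rk≢i
  ... | yes _ | no k≢   | yes rk≡i = contradiction (≡.trans (≡.sym (dRev-involutive k)) (≡.cong (dRev H) rk≡i)) k≢
  ... | no h≢ | _       | yes rk≡i = contradiction (≡.trans (≡.cong (dHead H) (≡.sym rk≡i)) (dHead-dRev k)) h≢

  apply≈ : ∀ u k → apply u k ≈ headSum u (dTail H k) - u (dRev H k)
  apply≈ u k = begin
    sumR (nD H) (λ i → NB H k i * u i)
      ≈⟨ sum-cong (λ i → trans (*-congʳ (NB-entry k i)) (solve 3 (λ a b u → (a :- b) :* u := a :* u :- b :* u) refl (δ (dHead H i) (dTail H k)) (δ (dRev H k) i) (u i))) ⟩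
    sumR (nD H) (λ i → δ (dHead H i) (dTail H k) * u i - δ (dRev H k) i * u i)
      ≈⟨ sum-minus (λ i → δ (dHead H i) (dTail H k) * u i) (λ i → δ (dRev H k) i * u i) ⟩
    headSum u (dTail H k) - sumR (nD H) (λ i → δ (dRev H k) i * u i)
      ≈⟨ +-congˡ (-‿cong (sum-δ (dRev H k) u)) ⟩
    headSum u (dTail H k) - u (dRev H k) ∎

  NB-dRev : ∀ k i → NB H k i ≡ NB H (dRev H i) (dRev H k)
  NB-dRev k i = ≡.cong₂ (λ a b → if a ∧ not b then 1# else 0#)
    (≡.trans (does-sym (dHead H i) (dTail H k)) (≡.cong₂ (λ x y → does (x Fin.≟ y)) (≡.sym (dHead-dRev k)) (≡.sym (dTail-dRev i))))
    (≡.trans (does-sym k (dRev H i)) (≡.cong (λ x → does (dRev H i Fin.≟ x)) (≡.sym (dRev-involutive k))))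

  sum-dRev : ∀ f → sumR (nD H) f ≈ sumR (nD H) (f ∘ dRev H)
  sum-dRev f = begin
    sumR (nD H) f ≈⟨ sum-split (nE H) (nE H) f ⟩
    sumR (nE H) (f ∘ fwd) + sumR (nE H) (f ∘ bwd) ≈⟨ +-comm _ _ ⟩
    sumR (nE H) (f ∘ bwd) + sumR (nE H) (f ∘ fwd) ≈⟨ +-cong (sum-cong (λ e → reflexive (≡.cong f (dRev-fwd e)))) (sum-cong (λ e → reflexive (≡.cong f (dRev-bwd e)))) ⟨
    sumR (nE H) (f ∘ dRev H ∘ fwd) + sumR (nE H) (f ∘ dRev H ∘ bwd) ≈⟨ sum-split (nE H) (nE H) (f ∘ dRev H) ⟨
    sumR (nD H) (f ∘ dRev H) ∎

  left-apply : ∀ u i → sumR (nD H) (λ k → u k * NB H k i) ≈ apply (u ∘ dRev H) (dRev H i)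
  left-apply u i = begin
    sumR (nD H) (λ k → u k * NB H k i)
      ≈⟨ sum-dRev (λ k → u k * NB H k i) ⟩
    sumR (nD H) (λ k → u (dRev H k) * NB H (dRev H k) i)
      ≈⟨ sum-cong (λ k → trans (*-comm _ _) (*-congʳ (reflexive (≡.trans (NB-dRev (dRev H k) i) (≡.cong (NB H (dRev H i)) (dRev-involutive k)))))) ⟩
    apply (u ∘ dRev H) (dRev H i) ∎

module NBMultiplicity {c ℓ : Level} (F : CommutativeRing c ℓ) (isField : LinAlg.IsField F) (H : Graph) where
  open Sums F
  open Independence F isField
  open Multiplicity F isField
  open NonBacktracking F H

  -- Reversing all darts transposes the NB matrix, so left eigenvectors are reversed right ones.
  multiplicities : ∀ λ₀ k p v → DualBasis k p v → (∀ t → InNull (nD H) (NB H) λ₀ (v t)) →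
    (∀ (u : Dart H → Carrier) (c : Fin k → Carrier) → (∀ t → u (p t) ≈ 0#) → (∀ d → apply u d ≈ λ₀ * u d + sumR k (λ t → c t * v t d)) → ∀ d → ¬ (u d ≉0)) →
    amNB H λ₀ k × gmNB H λ₀ k
  multiplicities λ₀ k p v v-δ v∈ unique =
    algMult (nD H) (NB H) λ₀ k (dRev H ∘ p) (λ t → v t ∘ dRev H)
      (λ t s → trans (reflexive (≡.cong (v t) (dRev-involutive (p s)))) (v-δ t s))
      (λ t j → trans (left-apply (v t ∘ dRev H) j) (trans (sum-cong {nD H} (λ d → *-congˡ (reflexive (≡.cong (v t) (dRev-involutive d))))) (v∈ t (dRev H j))))
      (λ u c u≈0 eq d ud≉0 → unique (u ∘ dRev H) c u≈0
        (λ d → begin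
          apply (u ∘ dRev H) d
            ≡⟨ ≡.cong (apply (u ∘ dRev H)) (dRev-involutive d) ⟨
          apply (u ∘ dRev H) (dRev H (dRev H d))
            ≈⟨ left-apply u (dRev H d) ⟨
          sumR (nD H) (λ i → u i * NB H i (dRev H d))
            ≈⟨ eq (dRev H d) ⟩
          λ₀ * u (dRev H d) + sumR k (λ t → c t * v t (dRev H (dRev H d)))
            ≈⟨ +-congˡ (sum-cong (λ t → *-congˡ (reflexive (≡.cong (v t) (dRev-involutive d))))) ⟩
          λ₀ * u (dRev H d) + sumR k (λ t → c t * v t d) ∎)
        (dRev H d) (λ u≈0 → ud≉0 (trans (reflexive (≡.cong u (≡.sym (dRev-involutive d)))) u≈0))) ,
    geoMult (nD H) (NB H) λ₀ k p v v-δ v∈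
      (λ u u∈ u≈0 → unique u (λ _ → 0#) u≈0 (λ d → trans (u∈ d) (trans (sym (+-identityʳ _)) (+-congˡ (sym (sum-0 {k} (λ t → zeroˡ _)))))))

-- The chains of the subdivision and the action of B on them.

module Chains (G : Graph) (r′ : ℕ) where
  H : Graph
  H = subdivision G r′

  open Darts H

  outer : Fin (nV G) → Fin (nV H)
  outer v = v ↑ˡ (nE G ℕ.* r′)

  inner : Fin (nE G) → Fin r′ → Fin (nV H)
  inner e i = nV G ↑ʳ combine e i

  outer≢inner : ∀ {v e i} → inner e i ≢ outer v
  outer≢inner {v} {e} {i} eq with ≡.trans (≡.sym (Finₚ.splitAt-↑ʳ (nV G) (nE G ℕ.* r′) (combine e i)))
                               (≡.trans (≡.cong (splitAt (nV G)) eq) (Finₚ.splitAt-↑ˡ (nV G) v (nE G ℕ.* r′)))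
  ... | ()

  outer-injective : ∀ {v w} → outer v ≡ outer w → v ≡ w
  outer-injective {v} {w} = Finₚ.↑ˡ-injective (nE G ℕ.* r′) v w

  inner-injective : ∀ {e i e′ i′} → inner e i ≡ inner e′ i′ → e ≡ e′ × i ≡ i′
  inner-injective {e} {i} {e′} {i′} eq = Finₚ.combine-injective e i e′ i′ (Finₚ.↑ʳ-injective (nV G) _ _ eq)

  chainNode-inner : ∀ e i → chainNode G r′ e (suc (inject₁ i)) ≡ inner e i
  chainNode-inner e i = aux (toℕ (inject₁ i) ℕ.<? r′)
    where
    aux : ∀ d → chainAux G r′ e (inject₁ i) d ≡ inner e i
    aux (yes p) = ≡.cong (inner e) (Finₚ.toℕ-injective (≡.trans (Finₚ.toℕ-fromℕ< p) (Finₚ.toℕ-inject₁ i)))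
    aux (no ¬p) = contradiction (≡.subst (ℕ._< r′) (≡.sym (Finₚ.toℕ-inject₁ i)) (Finₚ.toℕ<n i)) ¬p

  chainNode-last : ∀ e → chainNode G r′ e (suc (fromℕ r′)) ≡ outer (proj₂ (ends G e))
  chainNode-last e = aux (toℕ (fromℕ r′) ℕ.<? r′)
    where
    aux : ∀ d → chainAux G r′ e (fromℕ r′) d ≡ outer (proj₂ (ends G e))
    aux (yes p) = contradiction (≡.subst (ℕ._< r′) (Finₚ.toℕ-fromℕ r′) p) (ℕₚ.<-irrefl ≡.refl)
    aux (no _)  = ≡.refl

  ends-combine : ∀ e j → ends H (combine e j) ≡ (chainNode G r′ e (inject₁ j) , chainNode G r′ e (suc j))
  ends-combine e j = ≡.cong (λ p → chainNode G r′ (proj₁ p) (inject₁ (proj₂ p)) , chainNode G r′ (proj₁ p) (suc (proj₂ p))) (Finₚ.remQuot-combine e j)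

  fwdᶜ bwdᶜ : Fin (nE G) → Fin (suc r′) → Dart H
  fwdᶜ e j = fwd (combine e j)
  bwdᶜ e j = bwd (combine e j)

  dHead-fwdᶜ : ∀ e j → dHead H (fwdᶜ e j) ≡ chainNode G r′ e (suc j)
  dHead-fwdᶜ e j = ≡.trans (dHead-fwd (combine e j)) (≡.cong proj₂ (ends-combine e j))

  dHead-bwdᶜ : ∀ e j → dHead H (bwdᶜ e j) ≡ chainNode G r′ e (inject₁ j)
  dHead-bwdᶜ e j = ≡.trans (dHead-bwd (combine e j)) (≡.cong proj₁ (ends-combine e j))

  dTail-fwdᶜ : ∀ e j → dTail H (fwdᶜ e j) ≡ chainNode G r′ e (inject₁ j)
  dTail-fwdᶜ e j = ≡.trans (dTail-fwd (combine e j)) (≡.cong proj₁ (ends-combine e j))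

  dTail-bwdᶜ : ∀ e j → dTail H (bwdᶜ e j) ≡ chainNode G r′ e (suc j)
  dTail-bwdᶜ e j = ≡.trans (dTail-bwd (combine e j)) (≡.cong proj₂ (ends-combine e j))

  chain-elim : ∀ {p} (P : Dart H → Set p) → (∀ e j → P (fwdᶜ e j)) → (∀ e j → P (bwdᶜ e j)) → ∀ d → P d
  chain-elim P P-fwd P-bwd = dart-elim P
    (λ q → ≡.subst (P ∘ fwd) (Finₚ.combine-remQuot {nE G} (suc r′) q) (P-fwd _ _))
    (λ q → ≡.subst (P ∘ bwd) (Finₚ.combine-remQuot {nE G} (suc r′) q) (P-bwd _ _))

  -- Cases by the tail of the dart, on which the action of B depends: a node of G in the first and
  -- the last case, an inserted node in the two between.
  chain-elim′ : ∀ {p} (P : Dart H → Set p) → (∀ e → P (fwdᶜ e zero)) → (∀ e i → P (fwdᶜ e (suc i))) →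
    (∀ e i → P (bwdᶜ e (inject₁ i))) → (∀ e → P (bwdᶜ e (fromℕ r′))) → ∀ d → P d
  chain-elim′ P first next previous last = chain-elim P (λ { e zero → first e ; e (suc i) → next e i }) backward
    where
    backward : ∀ e j → P (bwdᶜ e j)
    backward e j with view j
    ... | ‵fromℕ     = last e
    ... | ‵inject₁ i = previous e i

module ChainSums {c ℓ : Level} (R : CommutativeRing c ℓ) (G : Graph) (r′ : ℕ) where
  open Sums R
  open Chains G r′ public
  open NonBacktracking R H public

  δ-inject : ∀ {m n} (f : Fin m → Fin n) → (∀ {i j} → f i ≡ f j → i ≡ j) → ∀ i j → δ (f i) (f j) ≈ δ i j
  δ-inject f f-inj i j = ⟦⟧-cong f-inj (≡.cong f) (f i Fin.≟ f j) (i Fin.≟ j)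

  module _ (u : Dart H → Carrier) where
    f g : Fin (nE G) → Fin (suc r′) → Carrier
    f e j = u (fwdᶜ e j)
    g e j = u (bwdᶜ e j)

    outerSum : Fin (nV G) → Carrier
    outerSum v = sumR (nE G) (λ e → δ (proj₂ (ends G e)) v * f e (fromℕ r′) + δ (proj₁ (ends G e)) v * g e zero)

    through : Fin (nE G) → Fin r′ → Carrier
    through e i = f e (inject₁ i) + g e (suc i)

    -- The darts of one chain grouped by head: every inserted node is the head of exactly two, one
    -- for each direction.
    chainSum : Fin (nV H) → Fin (nE G) → Carrier
    chainSum x e = sumR r′ (λ i → δ (inner e i) x * through e i) + (δ (outer (proj₂ (ends G e))) x * f e (fromℕ r′) + δ (outer (proj₁ (ends G e))) x * g e zero)

    headSum≈ : ∀ x → headSum u x ≈ sumR (nE G) (chainSum x)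
    headSum≈ x = begin
      headSum u x
        ≈⟨ sum-split (nE H) (nE H) (λ d → δ (dHead H d) x * u d) ⟩
      sumR (nE H) (λ q → δ (dHead H (fwd q)) x * u (fwd q)) + sumR (nE H) (λ q → δ (dHead H (bwd q)) x * u (bwd q))
        ≈⟨ +-cong (sum-combine (nE G) (suc r′) (λ q → δ (dHead H (fwd q)) x * u (fwd q))) (sum-combine (nE G) (suc r′) (λ q → δ (dHead H (bwd q)) x * u (bwd q))) ⟩
      sumR (nE G) (λ e → sumR (suc r′) (F e)) + sumR (nE G) (λ e → sumR (suc r′) (B e))
        ≈⟨ sum-+ (λ e → sumR (suc r′) (F e)) (λ e → sumR (suc r′) (B e)) ⟨
      sumR (nE G) (λ e → sumR (suc r′) (F e) + sumR (suc r′) (B e))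
        ≈⟨ sum-cong per-edge ⟩
      sumR (nE G) (chainSum x) ∎
      where
      F B : Fin (nE G) → Fin (suc r′) → Carrier
      F e j = δ (dHead H (fwdᶜ e j)) x * f e j
      B e j = δ (dHead H (bwdᶜ e j)) x * g e j
      at : ∀ {y z} t → y ≡ z → δ y x * t ≈ δ z x * t
      at t ≡.refl = refl
      per-edge : ∀ e → sumR (suc r′) (F e) + sumR (suc r′) (B e) ≈ chainSum x e
      per-edge e = begin
        sumR (suc r′) (F e) + (B e zero + sumR r′ (λ i → B e (suc i)))
          ≈⟨ +-congʳ (sum-last (F e)) ⟩
        sumR r′ (λ i → F e (inject₁ i)) + F e (fromℕ r′) + (B e zero + sumR r′ (λ i → B e (suc i)))
          ≈⟨ solve 4 (λ a b c d → a :+ b :+ (c :+ d) := a :+ d :+ (b :+ c)) refl (sumR r′ (λ i → F e (inject₁ i))) (F e (fromℕ r′)) (B e zero) (sumR r′ (λ i → B e (suc i))) ⟩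
        sumR r′ (λ i → F e (inject₁ i)) + sumR r′ (λ i → B e (suc i)) + (F e (fromℕ r′) + B e zero)
          ≈⟨ +-cong (trans (sym (sum-+ (λ i → F e (inject₁ i)) (λ i → B e (suc i)))) (sum-cong inside))
               (+-cong (at (f e (fromℕ r′)) (≡.trans (dHead-fwdᶜ e (fromℕ r′)) (chainNode-last e))) (at (g e zero) (dHead-bwdᶜ e zero))) ⟩
        chainSum x e ∎
        where
        inside : ∀ i → F e (inject₁ i) + B e (suc i) ≈ δ (inner e i) x * through e i
        inside i = trans (+-cong (at (f e (inject₁ i)) (≡.trans (dHead-fwdᶜ e (inject₁ i)) (chainNode-inner e i)))
                                 (at (g e (suc i)) (≡.trans (dHead-bwdᶜ e (suc i)) (chainNode-inner e i)))) (sym (distribˡ _ _ _))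

    headSum-outer : ∀ v → headSum u (outer v) ≈ outerSum v
    headSum-outer v = trans (headSum≈ (outer v)) (sum-cong per-edge)
      where
      off : ∀ e i → δ (inner e i) (outer v) ≈ 0#
      off e i = δ-≢ {i = inner e i} outer≢inner
      per-edge : ∀ e → chainSum (outer v) e ≈ δ (proj₂ (ends G e)) v * f e (fromℕ r′) + δ (proj₁ (ends G e)) v * g e zero
      per-edge e = trans (+-cong (sum-0 {r′} (λ i → trans (*-congʳ (off e i)) (zeroˡ _)))
        (+-cong (*-congʳ (δ-inject outer outer-injective (proj₂ (ends G e)) v)) (*-congʳ (δ-inject outer outer-injective (proj₁ (ends G e)) v)))) (+-identityˡ _)

    headSum-inner : ∀ e i → headSum u (inner e i) ≈ through e i
    headSum-inner e i = begin
      headSum u (inner e i)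
        ≈⟨ headSum≈ (inner e i) ⟩
      sumR (nE G) (chainSum (inner e i))
        ≈⟨ sum-cong per-edge ⟩
      sumR (nE G) (λ e′ → δ e′ e * through e′ i)
        ≈⟨ sum-δ′ e (λ e′ → through e′ i) ⟩
      through e i ∎
      where
      split : ∀ e′ i′ → δ (inner e′ i′) (inner e i) ≈ δ e′ e * δ i′ i
      split e′ i′ with inner e′ i′ Fin.≟ inner e i | e′ Fin.≟ e | i′ Fin.≟ i
      ... | yes _  | yes _      | yes _      = sym (*-identityˡ 1#)
      ... | yes eq | no e≢      | _          = contradiction (proj₁ (inner-injective eq)) e≢
      ... | yes eq | yes _      | no i≢      = contradiction (proj₂ (inner-injective eq)) i≢
      ... | no ≢   | yes ≡.refl | yes ≡.refl = contradiction ≡.refl ≢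
      ... | no _   | yes _      | no _       = sym (zeroʳ _)
      ... | no _   | no _       | _          = sym (zeroˡ _)
      off : ∀ v → δ (outer v) (inner e i) ≈ 0#
      off v = δ-≢ {i = outer v} {inner e i} λ eq → outer≢inner (≡.sym eq)
      per-edge : ∀ e′ → chainSum (inner e i) e′ ≈ δ e′ e * through e′ i
      per-edge e′ = begin
        chainSum (inner e i) e′
          ≈⟨ +-cong (sum-cong {r′} (λ i′ → trans (*-congʳ (split e′ i′)) (solve 3 (λ a b c → a :* b :* c := b :* (a :* c)) refl (δ e′ e) (δ i′ i) (through e′ i′))))
               (+-cong (*-congʳ (off (proj₂ (ends G e′)))) (*-congʳ (off (proj₁ (ends G e′))))) ⟩
        sumR r′ (λ i′ → δ i′ i * (δ e′ e * through e′ i′)) + (0# * f e′ (fromℕ r′) + 0# * g e′ zero)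
          ≈⟨ +-cong (sum-δ′ i (λ i′ → δ e′ e * through e′ i′)) (solve 2 (λ a b → :0 :* a :+ :0 :* b := :0) refl (f e′ (fromℕ r′)) (g e′ zero)) ⟩
        δ e′ e * through e′ i + 0#
          ≈⟨ +-identityʳ _ ⟩
        δ e′ e * through e′ i ∎

    apply-at : ∀ {d x y} → dTail H d ≡ x → dRev H d ≡ y → apply u d ≈ headSum u x - u y
    apply-at {d} ≡.refl ≡.refl = apply≈ u d

    apply-first : ∀ e → apply u (fwdᶜ e zero) ≈ outerSum (proj₁ (ends G e)) - g e zero
    apply-first e = trans (apply-at (dTail-fwdᶜ e zero) (dRev-fwd (combine e zero))) (+-congʳ (headSum-outer _))

    -- An inserted node has degree 2, so a non-backtracking walk has no choice there and B is a
    -- shift along the chain.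
    apply-next : ∀ e i → apply u (fwdᶜ e (suc i)) ≈ f e (inject₁ i)
    apply-next e i = trans (apply-at (≡.trans (dTail-fwdᶜ e (suc i)) (chainNode-inner e i)) (dRev-fwd (combine e (suc i))))
      (trans (+-congʳ (headSum-inner e i)) (solve 2 (λ a b → a :+ b :- b := a) refl (f e (inject₁ i)) (g e (suc i))))

    apply-previous : ∀ e i → apply u (bwdᶜ e (inject₁ i)) ≈ g e (suc i)
    apply-previous e i = trans (apply-at (≡.trans (dTail-bwdᶜ e (inject₁ i)) (chainNode-inner e i)) (dRev-bwd (combine e (inject₁ i))))
      (trans (+-congʳ (headSum-inner e i)) (solve 2 (λ a b → a :+ b :- a := b) refl (f e (inject₁ i)) (g e (suc i))))

    apply-last : ∀ e → apply u (bwdᶜ e (fromℕ r′)) ≈ outerSum (proj₂ (ends G e)) - f e (fromℕ r′)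
    apply-last e = trans (apply-at (≡.trans (dTail-bwdᶜ e (fromℕ r′)) (chainNode-last e)) (dRev-bwd (combine e (fromℕ r′)))) (+-congʳ (headSum-outer _))

-- Eigenvectors from the kernel of the incidence matrix.

module ChainEigenvectors {c ℓ : Level} (F : CommutativeRing c ℓ) (G : Graph) (r′ : ℕ) (s λ₀ : CommutativeRing.Carrier F)
  (s²≈1 : CommutativeRing._≈_ F (CommutativeRing._*_ F s s) (CommutativeRing.1# F))
  (λʳ≈s : CommutativeRing._≈_ F (LinAlg.pow F λ₀ (suc r′)) s) where
  open Sums F
  open ChainSums F G r′
  open Incidence F G s

  -- The inverse of `λ₀`, explicit because λʳ = s and s² = 1.
  ι : Carrier
  ι = s * pow λ₀ r′

  λι≈1 : λ₀ * ι ≈ 1#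
  λι≈1 = begin
    λ₀ * (s * pow λ₀ r′) ≈⟨ solve 3 (λ l s p → l :* (s :* p) := s :* (l :* p)) refl λ₀ s (pow λ₀ r′) ⟩
    s * pow λ₀ (suc r′) ≈⟨ *-congˡ λʳ≈s ⟩
    s * s ≈⟨ s²≈1 ⟩
    1# ∎

  pow-1 : ∀ k → pow 1# k ≈ 1#
  pow-1 zero    = refl
  pow-1 (suc k) = trans (*-identityˡ _) (pow-1 k)

  ιʳ′≈sλ : pow ι r′ ≈ s * λ₀
  ιʳ′≈sλ = begin
    pow ι r′ ≈⟨ solve 1 (λ x → x := :1 :* x) refl (pow ι r′) ⟩
    1# * pow ι r′ ≈⟨ *-congʳ (trans (sym s²≈1) (*-congˡ (sym λʳ≈s))) ⟩
    s * (λ₀ * pow λ₀ r′) * pow ι r′ ≈⟨ solve 4 (λ s l p q → s :* (l :* p) :* q := s :* l :* (p :* q)) refl s λ₀ (pow λ₀ r′) (pow ι r′) ⟩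
    s * λ₀ * (pow λ₀ r′ * pow ι r′) ≈⟨ *-congˡ (trans (sym (pow-* λ₀ ι r′)) (trans (pow-cong r′ λι≈1) (pow-1 r′))) ⟩
    s * λ₀ * 1# ≈⟨ *-identityʳ _ ⟩
    s * λ₀ ∎

  -- The ratios ι and `λ₀` come from the shift along the chain. The backward chain starts with - λ₀
  -- a e because then the equation at `src e` holds as soon as the darts entering that node sum to
  -- 0.
  fwdValue bwdValue : (Fin (nE G) → Carrier) → Fin (nE G) × Fin (suc r′) → Carrier
  fwdValue a (e , j) = pow ι (toℕ j) * a e
  bwdValue a (e , j) = - (pow λ₀ (suc (toℕ j)) * a e)

  onEdge : (Fin (nE G) → Carrier) → Fin (nE H) ⊎ Fin (nE H) → Carrier
  onEdge a = [ (λ q → fwdValue a (remQuot {nE G} (suc r′) q)) , (λ q → bwdValue a (remQuot {nE G} (suc r′) q)) ]′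

  extend : (Fin (nE G) → Carrier) → Dart H → Carrier
  extend a d = onEdge a (splitAt (nE H) d)

  extend-fwd : ∀ a e j → extend a (fwdᶜ e j) ≈ pow ι (toℕ j) * a e
  extend-fwd a e j = reflexive (≡.trans
    (≡.cong (onEdge a) (Finₚ.splitAt-↑ˡ (nE H) (combine e j) (nE H)))
    (≡.cong (fwdValue a) (Finₚ.remQuot-combine e j)))

  extend-bwd : ∀ a e j → extend a (bwdᶜ e j) ≈ - (pow λ₀ (suc (toℕ j)) * a e)
  extend-bwd a e j = reflexive (≡.trans
    (≡.cong (onEdge a) (Finₚ.splitAt-↑ʳ (nE H) (nE H) (combine e j)))
    (≡.cong (bwdValue a) (Finₚ.remQuot-combine e j)))

  -- The inhomogeneous term in `algMult` is a combination of eigenvectors; by linearity it is the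
  -- extension of a single kernel element.
  extend-combination : ∀ k (w : Fin k → Fin (nE G) → Carrier) (x : Fin k → Carrier) d →
    sumR k (λ t → x t * extend (w t) d) ≈ extend (λ e → sumR k (λ t → x t * w t e)) d
  extend-combination k w x = chain-elim (λ d → sumR k (λ t → x t * extend (w t) d) ≈ extend (λ e → sumR k (λ t → x t * w t e)) d)
    (λ e j → trans (sum-cong {k} (λ t → trans (*-congˡ (extend-fwd (w t) e j)) (solve 3 (λ x p w → x :* (p :* w) := p :* (x :* w)) refl (x t) (pow ι (toℕ j)) (w t e))))
      (trans (sum-*ˡ (pow ι (toℕ j)) (λ t → x t * w t e)) (sym (extend-fwd _ e j))))
    (λ e j → trans (sum-cong {k} (λ t → trans (*-congˡ (extend-bwd (w t) e j)) (solve 3 (λ x p w → x :* :- (p :* w) := :- p :* (x :* w)) refl (x t) (pow λ₀ (suc (toℕ j))) (w t e))))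
      (trans (sum-*ˡ (- pow λ₀ (suc (toℕ j))) (λ t → x t * w t e))
        (trans (solve 2 (λ p z → :- p :* z := :- (p :* z)) refl (pow λ₀ (suc (toℕ j))) _) (sym (extend-bwd _ e j)))))

  toℕ-last : ∀ x → pow x (toℕ (fromℕ r′)) ≈ pow x r′
  toℕ-last x = reflexive (≡.cong (pow x) (Finₚ.toℕ-fromℕ r′))

  -- The sum over the darts entering v is - λ₀ times (D a) v; this is where the incidence matrix
  -- comes from.
  outerSum-extend : ∀ a → (∀ v → sumR (nE G) (λ e → a e * incidence v e) ≈ 0#) → ∀ v → outerSum (extend a) v ≈ 0#
  outerSum-extend a a∈ v = begin
    outerSum (extend a) v
      ≈⟨ sum-cong (λ e → trans (+-cong (*-congˡ (trans (extend-fwd a e (fromℕ r′)) (*-congʳ (trans (toℕ-last ι) ιʳ′≈sλ)))) (*-congˡ (extend-bwd a e zero)))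
           (solve 5 (λ t s l a x → t :* (s :* l :* a) :+ x :* :- (l :* :1 :* a) := :- l :* (a :* (x :- s :* t))) refl (δ (tgt e) v) s λ₀ (a e) (δ (src e) v))) ⟩
    sumR (nE G) (λ e → - λ₀ * (a e * incidence v e))
      ≈⟨ trans (sum-*ˡ (- λ₀) (λ e → a e * incidence v e)) (trans (*-congˡ (a∈ v)) (zeroʳ _)) ⟩
    0# ∎

  extend-eigenvector : ∀ a → (∀ v → sumR (nE G) (λ e → a e * incidence v e) ≈ 0#) → InNull (nD H) (NB H) λ₀ (extend a)
  extend-eigenvector a a∈ = chain-elim′ (λ d → apply (extend a) d ≈ λ₀ * extend a d)
    (λ e → begin
      apply (extend a) (fwdᶜ e zero) ≈⟨ apply-first (extend a) e ⟩
      outerSum (extend a) (src e) - extend a (bwdᶜ e zero) ≈⟨ +-cong (outerSum-extend a a∈ (src e)) (-‿cong (extend-bwd a e zero)) ⟩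
      0# - - (λ₀ * 1# * a e) ≈⟨ solve 2 (λ l a → :0 :- :- (l :* :1 :* a) := l :* (:1 :* a)) refl λ₀ (a e) ⟩
      λ₀ * (1# * a e) ≈⟨ *-congˡ (extend-fwd a e zero) ⟨
      λ₀ * extend a (fwdᶜ e zero) ∎)
    (λ e i → begin
      apply (extend a) (fwdᶜ e (suc i)) ≈⟨ apply-next (extend a) e i ⟩
      extend a (fwdᶜ e (inject₁ i)) ≈⟨ extend-fwd a e (inject₁ i) ⟩
      pow ι (toℕ (inject₁ i)) * a e ≈⟨ trans (*-congʳ (reflexive (≡.cong (pow ι) (Finₚ.toℕ-inject₁ i)))) (sym (*-identityˡ _)) ⟩
      1# * (pow ι (toℕ i) * a e) ≈⟨ *-congʳ λι≈1 ⟨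
      λ₀ * ι * (pow ι (toℕ i) * a e) ≈⟨ solve 4 (λ l i p a → l :* i :* (p :* a) := l :* (i :* p :* a)) refl λ₀ ι (pow ι (toℕ i)) (a e) ⟩
      λ₀ * (pow ι (suc (toℕ i)) * a e) ≈⟨ *-congˡ (extend-fwd a e (suc i)) ⟨
      λ₀ * extend a (fwdᶜ e (suc i)) ∎)
    (λ e i → begin
      apply (extend a) (bwdᶜ e (inject₁ i)) ≈⟨ apply-previous (extend a) e i ⟩
      extend a (bwdᶜ e (suc i)) ≈⟨ extend-bwd a e (suc i) ⟩
      - (λ₀ * pow λ₀ (suc (toℕ i)) * a e) ≈⟨ solve 3 (λ l p a → :- (l :* p :* a) := l :* :- (p :* a)) refl λ₀ (pow λ₀ (suc (toℕ i))) (a e) ⟩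
      λ₀ * - (pow λ₀ (suc (toℕ i)) * a e) ≈⟨ *-congˡ (trans (extend-bwd a e (inject₁ i)) (reflexive (≡.cong (λ k → - (pow λ₀ (suc k) * a e)) (Finₚ.toℕ-inject₁ i)))) ⟨
      λ₀ * extend a (bwdᶜ e (inject₁ i)) ∎)
    (λ e → begin
      apply (extend a) (bwdᶜ e (fromℕ r′)) ≈⟨ apply-last (extend a) e ⟩
      outerSum (extend a) (tgt e) - extend a (fwdᶜ e (fromℕ r′)) ≈⟨ +-cong (outerSum-extend a a∈ (tgt e)) (-‿cong (trans (extend-fwd a e (fromℕ r′)) (*-congʳ (trans (toℕ-last ι) ιʳ′≈sλ)))) ⟩
      0# - s * λ₀ * a e ≈⟨ solve 3 (λ s l a → :0 :- s :* l :* a := l :* :- (s :* a)) refl s λ₀ (a e) ⟩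
      λ₀ * - (s * a e) ≈⟨ *-congˡ (trans (extend-bwd a e (fromℕ r′)) (-‿cong (*-congʳ (trans (*-congˡ (toℕ-last λ₀)) λʳ≈s)))) ⟨
      λ₀ * extend a (bwdᶜ e (fromℕ r′)) ∎)

-- Absence of generalized eigenvectors.

-- A solution u of (B − λ₀) u = extend a is governed by the potential S (the sum over the darts entering each node of G):
-- running along the chains gives S (src e) − s S (tgt e) = 2r a e.
module GeneralizedEigenvectors {c ℓ : Level} (F : CommutativeRing c ℓ) (isField : LinAlg.IsField F) (charZero : LinAlg.CharZero F)
  (G : Graph) (r′ : ℕ) (s λ₀ : CommutativeRing.Carrier F)
  (s²≈1 : CommutativeRing._≈_ F (CommutativeRing._*_ F s s) (CommutativeRing.1# F))
  (λʳ≈s : CommutativeRing._≈_ F (LinAlg.pow F λ₀ (suc r′)) s) where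
  open Sums F
  open Independence F isField
  open PrimeField F isField charZero using (natR-cancel)
  open Network F isField charZero using (harmonic⇒potential)
  open ChainSums F G r′
  open Incidence F G s
  open ChainEigenvectors F G r′ s λ₀ s²≈1 λʳ≈s

  module _ (a : Fin (nE G) → Carrier) (a∈ : ∀ v → sumR (nE G) (λ e → a e * incidence v e) ≈ 0#)
           (u : Dart H → Carrier) (u-eq : ∀ d → apply u d ≈ λ₀ * u d + extend a d) where
    α γ : Fin (nE G) → Carrier
    α e = u (fwdᶜ e zero)
    γ e = u (bwdᶜ e zero)

    S : Fin (nV G) → Carrier
    S = outerSum u

    cancel-λ : ∀ {x y} → x ≈ λ₀ * y → y ≈ ι * x
    cancel-λ {x} {y} eq = begin
      y ≈⟨ *-identityˡ y ⟨
      1# * y ≈⟨ *-congʳ λι≈1 ⟨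
      λ₀ * ι * y ≈⟨ solve 3 (λ l i y → l :* i :* y := i :* (l :* y)) refl λ₀ ι y ⟩
      ι * (λ₀ * y) ≈⟨ *-congˡ eq ⟨
      ι * x ∎

    move : ∀ {x y z} → x ≈ y + z → x - z ≈ y
    move {x} {y} {z} eq = trans (+-congʳ eq) (solve 2 (λ y z → y :+ z :- z := y) refl y z)

    -- Resonance: along the chain the inhomogeneous term has the ratio of the homogeneous solution,
    -- which produces the factor linear in j.
    fwd-closed : ∀ e j → u (fwdᶜ e j) ≈ pow ι (toℕ j) * (α e - natR (toℕ j) * ι * a e)
    fwd-closed e = <-weakInduction (λ j → u (fwdᶜ e j) ≈ pow ι (toℕ j) * (α e - natR (toℕ j) * ι * a e))
      (solve 3 (λ x i a → x := :1 :* (x :- :0 :* i :* a)) refl (α e) ι (a e))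
      (λ i ih → begin
        u (fwdᶜ e (suc i))
          ≈⟨ cancel-λ (move (trans (sym (apply-next u e i)) (u-eq (fwdᶜ e (suc i))))) ⟩
        ι * (u (fwdᶜ e (inject₁ i)) - extend a (fwdᶜ e (suc i)))
          ≈⟨ *-congˡ (+-cong (trans ih (reflexive (≡.cong (λ k → pow ι k * (α e - natR k * ι * a e)) (Finₚ.toℕ-inject₁ i)))) (-‿cong (extend-fwd a e (suc i)))) ⟩
        ι * (pow ι (toℕ i) * (α e - natR (toℕ i) * ι * a e) - ι * pow ι (toℕ i) * a e)
          ≈⟨ solve 5 (λ i p x k a → i :* (p :* (x :- k :* i :* a) :- i :* p :* a) := i :* p :* (x :- (:1 :+ k) :* i :* a)) refl ι (pow ι (toℕ i)) (α e) (natR (toℕ i)) (a e) ⟩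
        pow ι (suc (toℕ i)) * (α e - natR (suc (toℕ i)) * ι * a e) ∎)

    bwd-closed : ∀ e j → u (bwdᶜ e j) ≈ pow λ₀ (toℕ j) * (γ e - natR (toℕ j) * a e)
    bwd-closed e = <-weakInduction (λ j → u (bwdᶜ e j) ≈ pow λ₀ (toℕ j) * (γ e - natR (toℕ j) * a e))
      (solve 2 (λ x a → x := :1 :* (x :- :0 :* a)) refl (γ e) (a e))
      (λ i ih → begin
        u (bwdᶜ e (suc i))
          ≈⟨ trans (sym (apply-previous u e i)) (u-eq (bwdᶜ e (inject₁ i))) ⟩
        λ₀ * u (bwdᶜ e (inject₁ i)) + extend a (bwdᶜ e (inject₁ i))
          ≈⟨ +-cong (*-congˡ (trans ih (reflexive (≡.cong (λ k → pow λ₀ k * (γ e - natR k * a e)) (Finₚ.toℕ-inject₁ i)))))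
                    (trans (extend-bwd a e (inject₁ i)) (reflexive (≡.cong (λ k → - (pow λ₀ (suc k) * a e)) (Finₚ.toℕ-inject₁ i)))) ⟩
        λ₀ * (pow λ₀ (toℕ i) * (γ e - natR (toℕ i) * a e)) - λ₀ * pow λ₀ (toℕ i) * a e
          ≈⟨ solve 5 (λ l p x k a → l :* (p :* (x :- k :* a)) :- l :* p :* a := l :* p :* (x :- (:1 :+ k) :* a)) refl λ₀ (pow λ₀ (toℕ i)) (γ e) (natR (toℕ i)) (a e) ⟩
        pow λ₀ (suc (toℕ i)) * (γ e - natR (suc (toℕ i)) * a e) ∎)

    fwd-last : ∀ e → u (fwdᶜ e (fromℕ r′)) ≈ s * (λ₀ * α e) - s * (natR r′ * a e)
    fwd-last e = begin
      u (fwdᶜ e (fromℕ r′))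
        ≈⟨ trans (fwd-closed e (fromℕ r′)) (reflexive (≡.cong (λ k → pow ι k * (α e - natR k * ι * a e)) (Finₚ.toℕ-fromℕ r′))) ⟩
      pow ι r′ * (α e - natR r′ * ι * a e)
        ≈⟨ *-congʳ ιʳ′≈sλ ⟩
      s * λ₀ * (α e - natR r′ * ι * a e)
        ≈⟨ solve 6 (λ s l x k i a → s :* l :* (x :- k :* i :* a) := s :* (l :* x) :- s :* (l :* i) :* (k :* a)) refl s λ₀ (α e) (natR r′) ι (a e) ⟩
      s * (λ₀ * α e) - s * (λ₀ * ι) * (natR r′ * a e)
        ≈⟨ +-congˡ (-‿cong (*-congʳ (trans (*-congˡ λι≈1) (*-identityʳ s)))) ⟩
      s * (λ₀ * α e) - s * (natR r′ * a e) ∎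

    bwd-last : ∀ e → λ₀ * u (bwdᶜ e (fromℕ r′)) ≈ s * (γ e - natR r′ * a e)
    bwd-last e = begin
      λ₀ * u (bwdᶜ e (fromℕ r′))
        ≈⟨ *-congˡ (trans (bwd-closed e (fromℕ r′)) (reflexive (≡.cong (λ k → pow λ₀ k * (γ e - natR k * a e)) (Finₚ.toℕ-fromℕ r′)))) ⟩
      λ₀ * (pow λ₀ r′ * (γ e - natR r′ * a e))
        ≈⟨ *-assoc _ _ _ ⟨
      λ₀ * pow λ₀ r′ * (γ e - natR r′ * a e)
        ≈⟨ *-congʳ λʳ≈s ⟩
      s * (γ e - natR r′ * a e) ∎

    S-src : ∀ e → S (src e) ≈ λ₀ * α e + γ e + a e
    S-src e = begin
      S (src e) ≈⟨ solve 2 (λ x y → x := x :- y :+ y) refl (S (src e)) (γ e) ⟩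
      S (src e) - γ e + γ e ≈⟨ +-congʳ (trans (sym (apply-first u e)) (u-eq (fwdᶜ e zero))) ⟩
      λ₀ * α e + extend a (fwdᶜ e zero) + γ e ≈⟨ +-congʳ (+-congˡ (extend-fwd a e zero)) ⟩
      λ₀ * α e + 1# * a e + γ e ≈⟨ solve 3 (λ x a y → x :+ :1 :* a :+ y := x :+ y :+ a) refl (λ₀ * α e) (a e) (γ e) ⟩
      λ₀ * α e + γ e + a e ∎

    sS-tgt : ∀ e → s * S (tgt e) ≈ λ₀ * α e + γ e - (natR r′ + natR r′ + 1#) * a e
    sS-tgt e = begin
      s * S (tgt e)
        ≈⟨ *-congˡ (solve 2 (λ x y → x := x :- y :+ y) refl (S (tgt e)) (u (fwdᶜ e (fromℕ r′)))) ⟩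
      s * (S (tgt e) - u (fwdᶜ e (fromℕ r′)) + u (fwdᶜ e (fromℕ r′)))
        ≈⟨ *-congˡ (+-congʳ (trans (sym (apply-last u e)) (u-eq (bwdᶜ e (fromℕ r′))))) ⟩
      s * (λ₀ * u (bwdᶜ e (fromℕ r′)) + extend a (bwdᶜ e (fromℕ r′)) + u (fwdᶜ e (fromℕ r′)))
        ≈⟨ *-congˡ (+-cong (+-cong (bwd-last e) (trans (extend-bwd a e (fromℕ r′)) (-‿cong (*-congʳ (trans (*-congˡ (toℕ-last λ₀)) λʳ≈s))))) (fwd-last e)) ⟩
      s * (s * (γ e - natR r′ * a e) + - (s * a e) + (s * (λ₀ * α e) - s * (natR r′ * a e)))
        ≈⟨ solve 5 (λ s y k a x → s :* (s :* (y :- k :* a) :+ :- (s :* a) :+ (s :* x :- s :* (k :* a))) := s :* s :* (x :+ y :- (k :+ k :+ :1) :* a)) refl s (γ e) (natR r′) (a e) (λ₀ * α e) ⟩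
      s * s * (λ₀ * α e + γ e - (natR r′ + natR r′ + 1#) * a e)
        ≈⟨ trans (*-congʳ s²≈1) (*-identityˡ _) ⟩
      λ₀ * α e + γ e - (natR r′ + natR r′ + 1#) * a e ∎

    -- The equation at each of the 2r darts of the chain adds one copy of `a e`: r′ in either
    -- direction from the interior, and one more at either end.
    gradient-S : ∀ e → S (src e) - s * S (tgt e) ≈ natR 2 * (natR (suc r′) * a e)
    gradient-S e = trans (+-cong (S-src e) (-‿cong (sS-tgt e)))
      (solve 3 (λ z k a → z :+ a :- (z :- (k :+ k :+ :1) :* a) := (:1 :+ (:1 :+ :0)) :* ((:1 :+ k) :* a)) refl (λ₀ * α e + γ e) (natR r′) (a e))

    S-potential : Potential S
    S-potential = harmonic⇒potential G s s²≈1 S λ v → begin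
      sumR (nE G) (λ e → (S (src e) - s * S (tgt e)) * incidence v e)
        ≈⟨ sum-cong (λ e → trans (*-congʳ (gradient-S e)) (solve 4 (λ k l a d → k :* (l :* a) :* d := k :* l :* (a :* d)) refl (natR 2) (natR (suc r′)) (a e) (incidence v e))) ⟩
      sumR (nE G) (λ e → natR 2 * natR (suc r′) * (a e * incidence v e))
        ≈⟨ trans (sum-*ˡ (natR 2 * natR (suc r′)) (λ e → a e * incidence v e)) (trans (*-congˡ (a∈ v)) (zeroʳ _)) ⟩
      0# ∎

    a≈0 : ∀ e → a e ≈ 0#
    a≈0 e = natR-cancel r′ (natR-cancel 1 (trans (sym (gradient-S e)) (trans (+-congʳ (S-potential e)) (-‿inverseʳ _))))

    S-src₀ : ∀ e → S (src e) ≈ λ₀ * α e + γ e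
    S-src₀ e = trans (S-src e) (trans (+-congˡ (a≈0 e)) (+-identityʳ _))

    Dα outflow : Fin (nV G) → Carrier
    Dα v      = sumR (nE G) (λ e → α e * incidence v e)
    outflow v = sumR (nE G) (λ e → δ (src e) v * S (src e))

    -- Once a = 0, replacing `γ e` by S (src e) - λ₀ α e in the entering sum at v leaves only S and
    -- α.
    S-divergence : ∀ v → S v ≈ outflow v - λ₀ * Dα v
    S-divergence v = begin
      sumR (nE G) (λ e → δ (tgt e) v * u (fwdᶜ e (fromℕ r′)) + δ (src e) v * γ e)
        ≈⟨ sum-cong (λ e → trans (+-congʳ (*-congˡ (trans (fwd-last e) (trans (+-congˡ (-‿cong (trans (*-congˡ (trans (*-congˡ (a≈0 e)) (zeroʳ _))) (zeroʳ s)))) (solve 1 (λ x → x :- :0 := x) refl (s * (λ₀ * α e)))))))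
             (trans (solve 6 (λ t s l x d y → t :* (s :* (l :* x)) :+ d :* y := d :* (l :* x :+ y) :- l :* (x :* (d :- s :* t))) refl (δ (tgt e) v) s λ₀ (α e) (δ (src e) v) (γ e))
               (+-congʳ (*-congˡ (sym (S-src₀ e)))))) ⟩
      sumR (nE G) (λ e → δ (src e) v * S (src e) - λ₀ * (α e * incidence v e))
        ≈⟨ sum-minus (λ e → δ (src e) v * S (src e)) (λ e → λ₀ * (α e * incidence v e)) ⟩
      outflow v - sumR (nE G) (λ e → λ₀ * (α e * incidence v e))
        ≈⟨ +-congˡ (-‿cong (sum-*ˡ λ₀ (λ e → α e * incidence v e))) ⟩
      outflow v - λ₀ * Dα v ∎

    -- The gradient of S vanishes, so pairing S with the divergence identity kills the α-term.
    squares : sumR (nV G) (λ v → S v * S v) ≈ sumR (nE G) (λ e → S (src e) * S (src e))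
    squares = begin
      sumR (nV G) (λ v → S v * S v)
        ≈⟨ sum-cong (λ v → trans (*-congˡ (S-divergence v)) (solve 4 (λ z x l y → z :* (x :- l :* y) := z :* x :- l :* (z :* y)) refl (S v) (outflow v) λ₀ (Dα v))) ⟩
      sumR (nV G) (λ v → S v * outflow v - λ₀ * (S v * Dα v))
        ≈⟨ sum-minus (λ v → S v * outflow v) (λ v → λ₀ * (S v * Dα v)) ⟩
      sumR (nV G) (λ v → S v * outflow v) - sumR (nV G) (λ v → λ₀ * (S v * Dα v))
        ≈⟨ +-cong diagonal (-‿cong (trans (sum-*ˡ λ₀ (λ v → S v * Dα v)) (trans (*-congˡ orthogonal) (zeroʳ λ₀)))) ⟩
      sumR (nE G) (λ e → S (src e) * S (src e)) - 0#
        ≈⟨ solve 1 (λ x → x :- :0 := x) refl (sumR (nE G) (λ e → S (src e) * S (src e))) ⟩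
      sumR (nE G) (λ e → S (src e) * S (src e)) ∎
      where
      diagonal : sumR (nV G) (λ v → S v * outflow v) ≈ sumR (nE G) (λ e → S (src e) * S (src e))
      diagonal = begin
        sumR (nV G) (λ v → S v * outflow v)
          ≈⟨ sum-cong (λ v → sym (sum-*ˡ (S v) (λ e → δ (src e) v * S (src e)))) ⟩
        sumR (nV G) (λ v → sumR (nE G) (λ e → S v * (δ (src e) v * S (src e))))
          ≈⟨ sum-swap (λ v e → S v * (δ (src e) v * S (src e))) ⟩
        sumR (nE G) (λ e → sumR (nV G) (λ v → S v * (δ (src e) v * S (src e))))
          ≈⟨ sum-cong (λ e → trans (sum-cong (λ v → solve 3 (λ x d y → x :* (d :* y) := d :* (x :* y)) refl (S v) (δ (src e) v) (S (src e)))) (sum-δ (src e) (λ v → S v * S (src e)))) ⟩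
        sumR (nE G) (λ e → S (src e) * S (src e)) ∎
      orthogonal : sumR (nV G) (λ v → S v * Dα v) ≈ 0#
      orthogonal = begin
        sumR (nV G) (λ v → S v * Dα v)
          ≈⟨ sum-cong (λ v → sym (sum-*ˡ (S v) (λ e → α e * incidence v e))) ⟩
        sumR (nV G) (λ v → sumR (nE G) (λ e → S v * (α e * incidence v e)))
          ≈⟨ sum-swap (λ v e → S v * (α e * incidence v e)) ⟩
        sumR (nE G) (λ e → sumR (nV G) (λ v → S v * (α e * incidence v e)))
          ≈⟨ sum-0 (λ e → trans (sum-cong (λ v → solve 3 (λ x a d → x :* (a :* d) := a :* (x :* d)) refl (S v) (α e) (incidence v e)))
               (trans (sum-*ˡ (α e) (λ v → S v * incidence v e)) (trans (*-congˡ (potential⇒kernel S S-potential e)) (zeroʳ _)))) ⟩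
        0# ∎

    module _ (conn : Connected G) (nV<nE : nV G ℕ.< nE G) where
      -- S itself changes by the factor s along an edge; its square does not, and can therefore be
      -- counted over nodes and edges.
      square-constant : ∀ {E v w} → Reach G E v w → S w * S w ≈ S v * S v
      square-constant here = refl
      square-constant (step {v} {w} e _ e∈ reach) = trans (begin
        S w * S w ≈⟨ *-cong (potential-joins s²≈1 S S-potential {e} e∈) (potential-joins s²≈1 S S-potential {e} e∈) ⟩
        s * S v * (s * S v) ≈⟨ solve 2 (λ s x → s :* x :* (s :* x) := s :* s :* (x :* x)) refl s (S v) ⟩
        s * s * (S v * S v) ≈⟨ trans (*-congʳ s²≈1) (*-identityˡ _) ⟩
        S v * S v ∎) (square-constant reach)

      sum-constant : ∀ n x → sumR n (λ _ → x) ≈ natR n * x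
      sum-constant zero    x = sym (zeroˡ x)
      sum-constant (suc n) x = trans (+-congˡ (sum-constant n x)) (solve 2 (λ k x → x :+ k :* x := (:1 :+ k) :* x) refl (natR n) x)

      -- With constant square q, the identity `squares` reads n q = m q, and m - n is a positive
      -- integer, which cancels in characteristic 0.
      S-square : ∀ v → S v * S v ≈ 0#
      S-square v with ℕₚ.m≤n⇒∃[o]m+o≡n nV<nE
      ... | k , nV+k≡nE = natR-cancel k (begin
        natR (suc k) * q ≈⟨ solve 3 (λ k n q → k :* q := n :* q :+ k :* q :- n :* q) refl (natR (suc k)) (natR (nV G)) q ⟩
        natR (nV G) * q + natR (suc k) * q - natR (nV G) * q
          ≈⟨ +-cong (trans (sym (distribʳ _ _ _)) (*-congʳ (trans (sym (natR-+ (nV G) (suc k))) (reflexive (≡.cong natR (≡.trans (ℕₚ.+-suc (nV G) k) nV+k≡nE)))))) refl ⟩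
        natR (nE G) * q - natR (nV G) * q ≈⟨ +-congʳ (trans (sym (sum-constant (nE G) q)) (trans (sum-cong (λ e → sym (square-constant (conn v (src e))))) (trans (sym squares) (trans (sum-cong (λ w → square-constant (conn v w))) (sum-constant (nV G) q))))) ⟩
        natR (nV G) * q - natR (nV G) * q ≈⟨ -‿inverseʳ _ ⟩
        0# ∎)
        where q = S v * S v

      -- A square that vanishes only refutes that S v is nonzero, since inverses are available for
      -- nonzero elements alone. From here stems the double negation in the uniqueness hypotheses of
      -- `geoMult` and `algMult`.
      S~0 : ∀ v → ¬ (S v ≉0)
      S~0 v Sv≉0 = Sv≉0 (nonzero-cancel Sv≉0 (S-square v))

      -- With a = 0 and S = 0 the divergence identity puts α into the kernel of D. Once α vanishes
      -- as well, so does γ, and the closed forms give u = 0.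
      vanishing : ((∀ v → Dα v ≈ 0#) → ∀ e → α e ≈ 0#) → ∀ d → ¬ (u d ≉0)
      vanishing unique d ud≉0 = ¬¬-∀Fin S~0 λ S≈0 → ud≉0 (u≈0 S≈0 d)
        where
        module _ (S≈0 : ∀ v → S v ≈ 0#) where
          α∈ : ∀ v → Dα v ≈ 0#
          α∈ v = trans (cancel-λ {0#} (begin
            0# ≈⟨ solve 0 (:0 := :0 :- :0) refl ⟩
            0# - 0# ≈⟨ +-cong (sym (sum-0 {nE G} (λ e → trans (*-congˡ (S≈0 (src e))) (zeroʳ _)))) (-‿cong (sym (S≈0 v))) ⟩
            outflow v - S v ≈⟨ +-congˡ (-‿cong (S-divergence v)) ⟩
            outflow v - (outflow v - λ₀ * Dα v) ≈⟨ solve 3 (λ x l y → x :- (x :- l :* y) := l :* y) refl (outflow v) λ₀ (Dα v) ⟩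
            λ₀ * Dα v ∎)) (zeroʳ ι)
          α≈0 : ∀ e → α e ≈ 0#
          α≈0 = unique α∈
          γ≈0 : ∀ e → γ e ≈ 0#
          γ≈0 e = begin
            γ e ≈⟨ solve 2 (λ x y → y := x :+ y :- x) refl (λ₀ * α e) (γ e) ⟩
            λ₀ * α e + γ e - λ₀ * α e ≈⟨ +-cong (trans (sym (S-src₀ e)) (S≈0 (src e))) (-‿cong (trans (*-congˡ (α≈0 e)) (zeroʳ λ₀))) ⟩
            0# - 0# ≈⟨ -‿inverseʳ 0# ⟩
            0# ∎
          u≈0 : ∀ d → u d ≈ 0#
          u≈0 = chain-elim (λ d → u d ≈ 0#)
            (λ e j → trans (fwd-closed e j) (trans (*-congˡ (+-cong (α≈0 e) (-‿cong (trans (*-congˡ (a≈0 e)) (zeroʳ _))))) (solve 1 (λ p → p :* (:0 :- :0) := :0) refl (pow ι (toℕ j)))))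
            (λ e j → trans (bwd-closed e j) (trans (*-congˡ (+-cong (γ≈0 e) (-‿cong (trans (*-congˡ (a≈0 e)) (zeroʳ _))))) (solve 1 (λ p → p :* (:0 :- :0) := :0) refl (pow λ₀ (toℕ j)))))

-- Bipartiteness and potentials for s = -1.

module Signs {c ℓ : Level} (F : CommutativeRing c ℓ) (isField : LinAlg.IsField F) (charZero : LinAlg.CharZero F) (G : Graph) where
  open Sums F
  open Independence F isField
  open Elimination F
  open KernelBasis
  open Incidence F G (- 1#)

  1≉-1 : ¬ (1# ≈ - 1#)
  1≉-1 1≈-1 = charZero 1 (trans (solve 0 (:1 :+ (:1 :+ :0) := :1 :+ :1) refl) (trans (+-congˡ 1≈-1) (-‿inverseʳ 1#)))

  [-1]²≈1 : - 1# * - 1# ≈ 1#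
  [-1]²≈1 = solve 0 (:-1 :* :-1 := :1) refl

  colourSign : Bool → Carrier
  colourSign b = if b then 1# else - 1#

  colourSign-≢ : ∀ {a b} → a ≢ b → colourSign a ≈ - 1# * colourSign b
  colourSign-≢ {false} {false} a≢b = contradiction ≡.refl a≢b
  colourSign-≢ {false} {true}  a≢b = solve 0 (:-1 := :-1 :* :1) refl
  colourSign-≢ {true}  {false} a≢b = sym [-1]²≈1
  colourSign-≢ {true}  {true}  a≢b = contradiction ≡.refl a≢b

  colourSign≉0 : ∀ b → colourSign b ≉0
  colourSign≉0 true  1≈0  = 1≉0 1≈0
  colourSign≉0 false -1≈0 = 1≉0 (trans (solve 0 (:1 := :- :-1) refl) (trans (-‿cong -1≈0) (solve 0 (:- :0 := :0) refl)))

  module _ (conn : Connected G) where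
    -- A nonzero solution of w (src e) = − w (tgt e) takes the values ± w₀, which two-colour the nodes.
    sign-colouring : ∀ w u → Potential w → w u ≈ 1# → Bipartite G
    sign-colouring w u pot wu≈1 = (λ v → proj₁ (colour v)) , λ e same → 1≉-1 (clash (colour (src e)) (colour (tgt e)) same (pot e))
      where
      sign-along : ∀ {S v} → Reach G S u v → Σ Bool λ b → w v ≈ colourSign b
      sign-along here = true , wu≈1
      sign-along (step e _ e∈ reach) with sign-along reach
      ... | true  , wv≈1  = false , trans (potential-joins [-1]²≈1 w pot {e} e∈) (trans (*-congˡ wv≈1) (*-identityʳ _))
      ... | false , wv≈-1 = true , trans (potential-joins [-1]²≈1 w pot {e} e∈) (trans (*-congˡ wv≈-1) [-1]²≈1)
      colour : ∀ v → Σ Bool λ b → w v ≈ colourSign b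
      colour v = sign-along (conn u v)
      clash : ∀ {x y} (p : Σ Bool λ b → x ≈ colourSign b) (q : Σ Bool λ b → y ≈ colourSign b) → proj₁ p ≡ proj₁ q → x ≈ - 1# * y → 1# ≈ - 1#
      clash (true  , x≈1)  (true  , y≈1)  _ x≈-y = trans (sym x≈1) (trans x≈-y (trans (*-congˡ y≈1) (*-identityʳ _)))
      clash (false , x≈-1) (false , y≈-1) _ x≈-y = trans (sym [-1]²≈1) (trans (*-congˡ (sym y≈-1)) (trans (sym x≈-y) x≈-1))

    -- A basis vector is 1 at its free node, so its signs can be followed along paths as Booleans
    -- without deciding anything in F.
    nonbipartite-nullity : ∀ {l} → KernelBasis (transpose incidence) l → ¬ Bipartite G → l ≡ 0
    nonbipartite-nullity {zero}  B ¬bip = ≡.refl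
    nonbipartite-nullity {suc l} B ¬bip =
      contradiction (sign-colouring (vector B zero) (free B zero) (kernel⇒potential (vector B zero) (in-kernel B zero)) (trans (dual B zero zero) (δ-refl {suc l} zero))) ¬bip

-- Multiplicities for the subdivision.

module SubdivisionSpectrum {c ℓ : Level} (F : CommutativeRing c ℓ) (isField : LinAlg.IsField F) (charZero : LinAlg.CharZero F)
  (G : Graph) (conn : Connected G) (nV<nE : nV G ℕ.< nE G) (r′ : ℕ) where
  open Sums F
  open Independence F isField
  open Elimination F
  open KernelBasis
  open PrimeField F isField charZero
  private H = subdivision G r′

  module _ (s λ₀ : Carrier) (s²≈1 : s * s ≈ 1#) (λʳ≈s : pow λ₀ (suc r′) ≈ s) where
    open Incidence F G s
    open ChainEigenvectors F G r′ s λ₀ s²≈1 λʳ≈s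
    open Chains G r′ using (fwdᶜ)

    -- The distinguished coordinates are the first forward darts of the free edges: there an
    -- extended vector takes the value of the edge vector, so the echelon form is inherited.
    multiplicities : ∀ {k} → KernelBasis incidence k → amNB H λ₀ k × gmNB H λ₀ k
    multiplicities {k} B = NBMultiplicity.multiplicities F isField H λ₀ k (λ t → fwdᶜ (free B t) zero) (λ t → extend (vector B t))
      (λ t s → trans (extend-fwd (vector B t) (free B s) zero) (trans (*-identityˡ _) (dual B t s)))
      (λ t → extend-eigenvector (vector B t) (in-kernel B t))
      (λ u x u≈0 u-eq → GeneralizedEigenvectors.vanishing F isField charZero G r′ s λ₀ s²≈1 λʳ≈s
        (λ e → sumR k (λ t → x t * vector B t e)) (combination x) u
        (λ d → trans (u-eq d) (+-congˡ (extend-combination k (vector B) x d))) conn nV<nE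
        (λ α∈ → unique B _ α∈ u≈0))
      where
      combination : ∀ (x : Fin k → Carrier) v → sumR (nE G) (λ e → sumR k (λ t → x t * vector B t e) * incidence v e) ≈ 0#
      combination x v = begin
        sumR (nE G) (λ e → sumR k (λ t → x t * vector B t e) * incidence v e)
          ≈⟨ sum-cong {nE G} (λ e → trans (sym (sum-*ʳ (incidence v e) (λ t → x t * vector B t e))) (sum-cong {k} (λ t → *-assoc _ _ _))) ⟩
        sumR (nE G) (λ e → sumR k (λ t → x t * (vector B t e * incidence v e)))
          ≈⟨ sum-swap (λ e t → x t * (vector B t e * incidence v e)) ⟩
        sumR k (λ t → sumR (nE G) (λ e → x t * (vector B t e * incidence v e)))
          ≈⟨ sum-0 {k} (λ t → trans (sum-*ˡ (x t) (λ e → vector B t e * incidence v e)) (trans (*-congˡ (in-kernel B t v)) (zeroʳ _))) ⟩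
        0# ∎

    eigenvalue : ∀ {k} → KernelBasis incidence (suc k) → eigNB H λ₀
    eigenvalue {k} B = extend (vector B zero) , extend-eigenvector (vector B zero) (in-kernel B zero) ,
      fwdᶜ (free B zero) zero , λ ≈0 → 1≉0 (begin
        1# ≈⟨ δ-refl {suc k} zero ⟨
        δ {suc k} zero zero ≈⟨ dual B zero zero ⟨
        vector B zero (free B zero) ≈⟨ *-identityˡ _ ⟨
        1# * vector B zero (free B zero) ≈⟨ extend-fwd (vector B zero) (free B zero) zero ⟨
        extend (vector B zero) (fwdᶜ (free B zero) zero) ≈⟨ ≈0 ⟩
        0# ∎)

    δ-rational : ∀ {n} (i j : Fin n) → IsRational (δ i j)
    δ-rational i j with i Fin.≟ j
    ... | yes _ = 1-rational
    ... | no _  = 0-rational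

    -- The incidence matrix involves s but not `λ₀`, so its entries are rational and pivots can be
    -- decided, although `λ₀` itself need not be rational.
    kernels : IsRational s → ∃₂ λ k l → k ℕ.+ nV G ≡ l ℕ.+ nE G × KernelBasis incidence k × KernelBasis (transpose incidence) l
    kernels s∈ = eliminate rationals (nV G) (nE G) incidence
      (λ v e → +-rational (δ-rational (src e) v) (neg-rational (*-rational s∈ (δ-rational (tgt e) v))))

    eigenvalue-kernel : ∀ {k l} → k ℕ.+ nV G ≡ l ℕ.+ nE G → KernelBasis incidence k → eigNB H λ₀
    eigenvalue-kernel {suc k} eq B = eigenvalue B
    eigenvalue-kernel {zero} {l} eq B = contradiction (ℕₚ.≤-trans nV<nE (ℕₚ.≤-trans (ℕₚ.m≤n+m (nE G) l) (ℕₚ.≤-reflexive (≡.sym eq)))) (ℕₚ.<-irrefl ≡.refl)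

  nullity-difference : ∀ {k l} → k ℕ.+ nV G ≡ l ℕ.+ nE G → k ≡ l ℕ.+ (nE G ∸ nV G)
  nullity-difference {k} {l} eq =
    ≡.trans (≡.sym (ℕₚ.m+n∸n≡m k (nV G))) (≡.trans (≡.cong (_∸ nV G) eq) (ℕₚ.+-∸-assoc l (ℕₚ.<⇒≤ nV<nE)))

  vertex : Fin (nV G)
  vertex = proj₁ (ends G (Fin.fromℕ< nV<nE))

  root-of-1 : ∀ λ₀ → pow λ₀ (suc r′) ≈ 1# →
    eigNB H λ₀ × amNB H λ₀ (suc (nE G ∸ nV G)) × gmNB H λ₀ (suc (nE G ∸ nV G))
  root-of-1 λ₀ λʳ≈1 =
    let k , l , eq , columns , rows = kernels 1# λ₀ (*-identityˡ 1#) λʳ≈1 1-rational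
        l≡1 = ℕₚ.≤-antisym (Incidence.nullity≤1 F G 1# (*-identityˡ 1#) conn 1≉0 rows)
                (Incidence.nullity≥1 F G 1# (*-identityˡ 1#) rows (λ _ → 1#) (λ _ → sym (*-identityˡ 1#)) (vertex , 1≉0))
    in eigenvalue-kernel 1# λ₀ (*-identityˡ 1#) λʳ≈1 {k} {l} eq columns ,
       ≡.subst (λ k → amNB H λ₀ k × gmNB H λ₀ k) (≡.trans (nullity-difference {k} {l} eq) (≡.cong (ℕ._+ (nE G ∸ nV G)) l≡1))
         (multiplicities 1# λ₀ (*-identityˡ 1#) λʳ≈1 columns)

  root-of--1 : ∀ μ → pow μ (suc r′) ≈ - 1# →
    eigNB H μ ×
    (Bipartite G → amNB H μ (suc (nE G ∸ nV G)) × gmNB H μ (suc (nE G ∸ nV G))) ×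
    (¬ Bipartite G → amNB H μ (nE G ∸ nV G) × gmNB H μ (nE G ∸ nV G))
  root-of--1 μ μʳ≈-1 =
    let k , l , eq , columns , rows = kernels (- 1#) μ [-1]²≈1 μʳ≈-1 (neg-rational 1-rational)
        at : ∀ j → l ≡ j → amNB H μ (j ℕ.+ (nE G ∸ nV G)) × gmNB H μ (j ℕ.+ (nE G ∸ nV G))
        at j l≡j = ≡.subst (λ k → amNB H μ k × gmNB H μ k) (≡.trans (nullity-difference {k} {l} eq) (≡.cong (ℕ._+ (nE G ∸ nV G)) l≡j))
          (multiplicities (- 1#) μ [-1]²≈1 μʳ≈-1 columns)
    in eigenvalue-kernel (- 1#) μ [-1]²≈1 μʳ≈-1 {k} {l} eq columns ,
       (λ bip → at 1 (ℕₚ.≤-antisym (Incidence.nullity≤1 F G (- 1#) [-1]²≈1 conn 1≉0 rows)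
         (Incidence.nullity≥1 F G (- 1#) [-1]²≈1 rows (colourSign ∘ proj₁ bip) (λ e → colourSign-≢ (proj₂ bip e)) (vertex , colourSign≉0 (proj₁ bip vertex))))) ,
       (λ ¬bip → at 0 (nonbipartite-nullity conn rows ¬bip))
    where open Signs F isField charZero G

theorem5p4 : ∀ {c ℓ : Level} (F : CommutativeRing c ℓ) →
    let open CommutativeRing F in
    let open LinAlg F in
    IsField → CharZero → AlgClosed →
    (G : Graph) → Connected G → NoLeaf G → AtLeastTwoCycles G →
    (r′ : ℕ) →
    let H = subdivision G r′ in
    let n = nV G in
    let m = nE G in
    (∀ (λ₀ : Carrier) → pow λ₀ (suc r′) ≈ 1# →
    eigNB H λ₀ × amNB H λ₀ (suc (m ∸ n)) × gmNB H λ₀ (suc (m ∸ n))) ×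
    (∀ (μ : Carrier) → pow μ (suc r′) ≈ (- 1#) →
    eigNB H μ ×
    (Bipartite G → amNB H μ (suc (m ∸ n)) × gmNB H μ (suc (m ∸ n))) ×
    (¬ Bipartite G → amNB H μ (m ∸ n) × gmNB H μ (m ∸ n)))
theorem5p4 F isField charZero _ G conn _ cycles r′ = root-of-1 , root-of--1
  where open SubdivisionSpectrum F isField charZero G conn (GF2Cycles.cycles⇒nV<nE G conn cycles) r′
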